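{- Every finite simple graph $G$ with maximum degree $\Delta(G)\ge 7.4\times 10^9$ satisfies $\chi(G)\le \max\{\Delta(G)-1,\omega(G)\}$.
   Context: $\chi(G)$ is the chromatic number of $G$ and $\omega(G)$ is the size of a largest clique of $G$. -}

module Defs where

open import Data.Nat using (ℕ; _⊔_; _≤_)
open import Data.Bool using (Bool; true; false)
open import Data.Fin using (Fin)
open import Data.Fin.Subset using (Subset; _∈_; ∣_∣)
open import Data.List using (foldr; map; allFin)
open import Data.Vec using (tabulate)
open import Data.Product using (Σ; _×_)
open import Relation.Binary.PropositionalEquality using (_≡_; _≢_)

record Graph (n : ℕ) : Set where
  field
    adj   : Fin n → Fin n → Bool
    sym   : ∀ u v → adj u v ≡ adj v u
    irrefl : ∀ v → adj v v ≡ false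
open Graph public

nbhd : ∀ {n} → Graph n → Fin n → Subset n
nbhd G v = tabulate (adj G v)

degree : ∀ {n} → Graph n → Fin n → ℕ
degree G v = ∣ nbhd G v ∣

-- maximum degree Δ(G) (0 for the empty graph)
maxDegree : ∀ {n} → Graph n → ℕ
maxDegree {n} G = foldr _⊔_ 0 (map (degree G) (allFin n))

-- proper colouring with k colours; G is k-colourable iff χ(G) ≤ k
ProperColouring : ∀ {n} → Graph n → (k : ℕ) → (Fin n → Fin k) → Set
ProperColouring G k c = ∀ u v → adj G u v ≡ true → c u ≢ c v

Colourable : ∀ {n} → Graph n → ℕ → Set
Colourable {n} G k = Σ (Fin n → Fin k) (ProperColouring G k)

IsClique : ∀ {n} → Graph n → Subset n → Set
IsClique G S = ∀ u v → u ∈ S → v ∈ S → u ≢ v → adj G u v ≡ true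

IsCliqueNumber : ∀ {n} → Graph n → ℕ → Set
IsCliqueNumber {n} G w =
  Σ (Subset n) (λ S → IsClique G S × ∣ S ∣ ≡ w)
  × (∀ S → IsClique G S → ∣ S ∣ ≤ w)

{-# OPTIONS --safe #-}
module Submission where

-- Fix k ≥ 7.4·10⁹ - 1 and take a graph with the fewest edges among those that have maximum degree at most k + 1,
-- no clique on k + 1 vertices and no k-colouring. It suffices to colour part of it so that every blank vertex v
-- either is good (its neighbours repeat enough colours for v to be coloured last) or has two good blank neighbours.
--
-- If N(v) spans few non-edges, then by minimality (two disjoint non-edges, or an independent triple, with many
-- common neighbours could be coloured alike) v lies in a clique of size nearly k. Let C be a maximum clique meeting
-- it, |C| = k - s. Deleting C and joining an outer vertex y to the outer neighbours of some x ∈ C makes the colour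
-- of y available for x. Hence outer vertices with many neighbours in C hardly interfere, and every z ∈ C has as
-- many light outer neighbours (at most s + 8 neighbours in C) as it needs repeated colours.
--
-- Now label every vertex with one of k colours or one of 8k blanks, uniformly among proper labellings. By counting
-- recolourings, it is very unlikely that a vertex with many non-edges in its neighbourhood sees fewer than two
-- repetitions, or that fewer than two z ∈ C are blank with all their chosen light neighbours repeating colours of
-- C: any such labelling can be altered, a bounded number of times, in far more ways than the alteration can be
-- undone. These bounds hold conditionally on the labels far away, so the lopsided local lemma applies.

-- The blanks make recolouring possible. With 8k of them a vertex rarely has more than about 0.27k
-- coloured neighbours, so some 0.18k colours are absent from three neighbourhoods at once; without
-- blanks there might be none. As crowding cannot be excluded, it is a bad event of its own, and the
-- other events are estimated only among labellings that are uncrowded within distance 2.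
--
-- One alteration multiplies the number of labellings by about k / 10^8. Up to (k + 2)^5 events lie
-- near a given one, since alterations reach distance 2 and events read labels up to distance 3.
-- Hence 28 alterations are made in a row: five of the factors cancel the power of k, and the other
-- 23 beat the constant 8 * 102000000^5. With k / 10^8 at least 73 this works, whence the size of
-- the threshold.
--
-- Minimality is used with edges added as well as removed: deleting `C` frees degree at its outer
-- neighbours, and the new edges spend it. What remains to check is the clique bound of the new
-- graph, and a clique through `y` is excluded by the reduced degree of `y`.

open import Defs renaming (sym to adj-sym; irrefl to adj-irrefl)
open import Data.Bool using (Bool; true; false; _∧_; _∨_; not; if_then_else_)
open import Data.Bool.Properties using () renaming (_≟_ to _≟ᵇ_)
open import Data.Empty using (⊥; ⊥-elim)
open import Data.Fin using (Fin; zero; suc; splitAt; _↑ˡ_; _↑ʳ_)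
open import Data.Fin.Properties using (any?; splitAt-↑ˡ; splitAt-↑ʳ; splitAt⁻¹-↑ˡ) renaming (_≟_ to _≟ᶠ_; suc-injective to suc-injᶠ)
open import Data.Fin.Subset using (Subset; ∣_∣) renaming (_∈_ to _∈ˢ_)
open import Data.Fin.Subset.Properties using (anySubset?)
open import Data.List using (List; []; _∷_; length; foldr; map; allFin)
open import Data.List.Membership.Propositional using (_∈_)
open import Data.List.Membership.Propositional.Properties using (∈-allFin; ∈-map⁺)
open import Data.List.Relation.Unary.All as All using (All; []; _∷_)
open import Data.List.Relation.Unary.AllPairs using ([]; _∷_)
open import Data.List.Relation.Unary.Any using (here; there)
open import Data.List.Relation.Unary.Unique.Propositional using (Unique)
open import Data.Nat hiding (_/_)
open import Data.Nat.DivMod using (_/_; m/n*n≤m; /-monoˡ-≤; m*n/n≡m; m≡m%n+[m/n]*n; m%n<n)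
open import Data.Nat.Properties
open import Data.Nat.Tactic.RingSolver using (solve-∀)
open import Data.Product using (∃; _×_; _,_; proj₁; proj₂)
open import Data.Sum using (_⊎_; inj₁; inj₂; [_,_]′)
open import Data.Vec using (Vec; []; _∷_; lookup; tabulate; replicate; _[_]≔_)
open import Data.Vec.Properties using (lookup∘update; lookup∘update′; lookup∘tabulate; lookup-replicate; []=⇒lookup)
open import Function using (_∘_; id)
open import Relation.Binary.PropositionalEquality hiding (J)
open import Relation.Nullary using (¬_; Dec; yes; no; does)

-- Finite sums and counting

-- Linear arithmetic: all hypotheses are added up into p ≤ q, and what remains is a semiring identity with slack s.
opaque
  lin : ∀ {a b p q} s → p ≤ q → b + p ≡ a + q + s → a ≤ b
  lin {a} {b} {p} {q} s p≤q e = +-cancelʳ-≤ p a b (begin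
    a + p     ≤⟨ +-monoʳ-≤ a p≤q ⟩
    a + q     ≤⟨ m≤m+n (a + q) s ⟩
    a + q + s ≡⟨ e ⟨
    b + p     ∎)
    where open ≤-Reasoning

b2n : Bool → ℕ
b2n true  = 1
b2n false = 0

b2n≤1 : ∀ b → b2n b ≤ 1
b2n≤1 true  = ≤-refl
b2n≤1 false = z≤n

b2n-mono : ∀ {a b} → (a ≡ true → b ≡ true) → b2n a ≤ b2n b
b2n-mono {false} h = z≤n
b2n-mono {true} {true} h = ≤-refl
b2n-mono {true} {false} h with () ← h refl

tf : ∀ b → b ≡ true ⊎ b ≡ false
tf true  = inj₁ refl
tf false = inj₂ refl

true≢false : ∀ {b} → b ≡ true → b ≡ false → ⊥
true≢false refl ()

differ : ∀ {A : Set} (P : A → Bool) {a b} → P a ≡ true → P b ≡ false → a ≢ b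
differ P p q refl = true≢false p q

∧-intro : ∀ {a b} → a ≡ true → b ≡ true → a ∧ b ≡ true
∧-intro refl refl = refl

∧-split : ∀ {a b} → a ∧ b ≡ true → a ≡ true × b ≡ true
∧-split {true} {true} refl = refl , refl

∧ˡ : ∀ {a b} → a ∧ b ≡ true → a ≡ true
∧ˡ e = proj₁ (∧-split e)

∧ʳ : ∀ {a b} → a ∧ b ≡ true → b ≡ true
∧ʳ {a} e = proj₂ (∧-split {a} e)

∨-split : ∀ {a b} → a ∨ b ≡ true → a ≡ true ⊎ b ≡ true
∨-split {true}  e = inj₁ refl
∨-split {false} e = inj₂ e

∨-introˡ : ∀ {a b} → a ≡ true → a ∨ b ≡ true
∨-introˡ refl = refl

∨-introʳ : ∀ {a b} → b ≡ true → a ∨ b ≡ true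
∨-introʳ {true}  refl = refl
∨-introʳ {false} refl = refl

not-true : ∀ {b} → not b ≡ true → b ≡ false
not-true {false} _ = refl

not-intro : ∀ {b} → b ≡ false → not b ≡ true
not-intro refl = refl

≢true : ∀ {b} → ¬ b ≡ true → b ≡ false
≢true {true}  h = ⊥-elim (h refl)
≢true {false} h = refl

bool-ext : ∀ {a b} → (a ≡ true → b ≡ true) → (b ≡ true → a ≡ true) → a ≡ b
bool-ext {true}  {b} f g = sym (f refl)
bool-ext {false} {true}  f g = g refl
bool-ext {false} {false} f g = refl

infix 5 _==_

opaque
  _==_ : ∀ {n} → Fin n → Fin n → Bool
  i == j = does (i ≟ᶠ j)

  ==-refl : ∀ {n} (i : Fin n) → (i == i) ≡ true
  ==-refl i with i ≟ᶠ i
  ... | yes _ = refl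
  ... | no ¬p = ⊥-elim (¬p refl)

  ==⇒≡ : ∀ {n} {i j : Fin n} → (i == j) ≡ true → i ≡ j
  ==⇒≡ {i = i} {j} e with i ≟ᶠ j
  ... | yes p = p

≢⇒== : ∀ {n} {i j : Fin n} → i ≢ j → (i == j) ≡ false
≢⇒== h = ≢true (h ∘ ==⇒≡)

==f⇒≢ : ∀ {n} {i j : Fin n} → (i == j) ≡ false → i ≢ j
==f⇒≢ {i = i} e refl = true≢false (==-refl i) e

dec-true : ∀ {p} {P : Set p} (P? : Dec P) → does P? ≡ true → P
dec-true (yes p) _ = p

true-dec : ∀ {p} {P : Set p} (P? : Dec P) → P → does P? ≡ true
true-dec (yes _) _ = refl
true-dec (no ¬p) p = ⊥-elim (¬p p)

≤ᵇ-true : ∀ {m n} → (m ≤ᵇ n) ≡ true → m ≤ n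
≤ᵇ-true {m} {n} e = ≤ᵇ⇒≤ m n (subst Data.Bool.T (sym e) _)

true-≤ᵇ : ∀ {m n} → m ≤ n → (m ≤ᵇ n) ≡ true
true-≤ᵇ {m} {n} h with m ≤ᵇ n in e
... | true = refl
... | false = ⊥-elim (subst Data.Bool.T e (≤⇒≤ᵇ h))

≤ᵇ-false : ∀ {m n} → (m ≤ᵇ n) ≡ false → n < m
≤ᵇ-false {m} {n} e = ≰⇒> λ h → true≢false (true-≤ᵇ h) e

sum : ∀ {n} → (Fin n → ℕ) → ℕ
sum {zero}  f = 0
sum {suc n} f = f zero + sum (f ∘ suc)

sum-cong : ∀ {n} {f g : Fin n → ℕ} → (∀ i → f i ≡ g i) → sum f ≡ sum g
sum-cong {zero}  h = refl
sum-cong {suc n} h = cong₂ _+_ (h zero) (sum-cong (h ∘ suc))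

sum-+ : ∀ {n} (f g : Fin n → ℕ) → sum (λ i → f i + g i) ≡ sum f + sum g
sum-+ {zero}  f g = refl
sum-+ {suc n} f g = trans (cong (f zero + g zero +_) (sum-+ (f ∘ suc) (g ∘ suc))) (eq (f zero) (g zero) _ _)
  where
  eq : ∀ a b c d → a + b + (c + d) ≡ a + c + (b + d)
  eq = solve-∀

sum-*ˡ : ∀ {n} c (f : Fin n → ℕ) → sum (λ i → c * f i) ≡ c * sum f
sum-*ˡ {zero}  c f = sym (*-zeroʳ c)
sum-*ˡ {suc n} c f = trans (cong (c * f zero +_) (sum-*ˡ c (f ∘ suc))) (sym (*-distribˡ-+ c _ _))

sum-*ʳ : ∀ {n} c (f : Fin n → ℕ) → sum (λ i → f i * c) ≡ sum f * c
sum-*ʳ c f = trans (sum-cong (λ i → *-comm (f i) c)) (trans (sum-*ˡ c f) (*-comm c _))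

sum-zero : ∀ n → sum {n} (λ _ → 0) ≡ 0
sum-zero zero    = refl
sum-zero (suc n) = sum-zero n

sum-swap : ∀ {m n} (f : Fin m → Fin n → ℕ) → sum (λ i → sum (f i)) ≡ sum (λ j → sum (λ i → f i j))
sum-swap {zero}  {n} f = sym (sum-zero n)
sum-swap {suc m} f = trans (cong (sum (f zero) +_) (sum-swap (f ∘ suc))) (sym (sum-+ (f zero) _))

sum-mono : ∀ {n} {f g : Fin n → ℕ} → (∀ i → f i ≤ g i) → sum f ≤ sum g
sum-mono {zero}  h = z≤n
sum-mono {suc n} h = +-mono-≤ (h zero) (sum-mono (h ∘ suc))

sum-const : ∀ n c → sum {n} (λ _ → c) ≡ n * c
sum-const zero    c = refl
sum-const (suc n) c = cong (c +_) (sum-const n c)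

term≤sum : ∀ {n} (f : Fin n → ℕ) i → f i ≤ sum f
term≤sum f zero    = m≤m+n _ _
term≤sum f (suc i) = ≤-trans (term≤sum (f ∘ suc) i) (m≤n+m _ _)

sum-split : ∀ m {n} (f : Fin (m + n) → ℕ) →
            sum f ≡ sum (λ i → f (i ↑ˡ n)) + sum (λ i → f (m ↑ʳ i))
sum-split zero    f = refl
sum-split (suc m) f = trans (cong (f zero +_) (sum-split m (f ∘ suc))) (sym (+-assoc (f zero) _ _))

# : ∀ {n} → (Fin n → Bool) → ℕ
# P = sum (b2n ∘ P)

#-cong : ∀ {n} {P Q : Fin n → Bool} → (∀ i → P i ≡ Q i) → # P ≡ # Q
#-cong h = sum-cong (λ i → cong b2n (h i))

#-mono : ∀ {n} {P Q : Fin n → Bool} → (∀ i → P i ≡ true → Q i ≡ true) → # P ≤ # Q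
#-mono h = sum-mono (λ i → b2n-mono (h i))

#-full : ∀ n → # {n} (λ _ → true) ≡ n
#-full n = trans (sum-const n 1) (*-identityʳ n)

opaque
  #-∃ : ∀ {n} (P : Fin n → Bool) → 0 < # P → ∃ λ i → P i ≡ true
  #-∃ {suc n} P h with P zero in e
  ... | true  = zero , e
  ... | false = let i , p = #-∃ (P ∘ suc) h in suc i , p

#-none : ∀ {n} {P : Fin n → Bool} → (∀ i → P i ≡ false) → # P ≡ 0
#-none {n} {P} h = trans (#-cong {n} {P} {λ _ → false} h) (sum-zero n)

#-pos : ∀ {n} (P : Fin n → Bool) i → P i ≡ true → 0 < # P
#-pos P i p = ≤-trans (subst (λ b → 1 ≤ b2n b) (sym p) ≤-refl) (term≤sum (b2n ∘ P) i)

sum-δ : ∀ {n} (j : Fin n) (f : Fin n → ℕ) → sum (λ i → b2n (i == j) * f i) ≡ f j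
sum-δ {suc n} zero f = trans (cong₂ _+_ (trans (cong (λ b → b2n b * f zero) (==-refl zero)) (+-identityʳ (f zero)))
  (trans (sum-cong {f = λ i → b2n (suc i == zero) * f (suc i)} (λ i → cong (λ b → b2n b * f (suc i)) (≢⇒== {i = suc i} {zero} (λ ())))) (sum-zero n)))
  (+-identityʳ (f zero))
sum-δ (suc j) f = trans (cong₂ _+_ (cong (λ b → b2n b * f zero) (≢⇒== {i = zero} {suc j} (λ ()))) (sum-cong (λ i → cong (λ b → b2n b * f (suc i)) (eq i)))) (sum-δ j (f ∘ suc))
  where
  eq : ∀ i → (suc i == suc j) ≡ (i == j)
  eq i = bool-ext (λ p → subst (λ x → (i == x) ≡ true) (suc-injᶠ (==⇒≡ p)) (==-refl i))
                  (λ p → subst (λ x → (suc i == suc x) ≡ true) (==⇒≡ p) (==-refl (suc i)))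

#-single : ∀ {n} (j : Fin n) → # (λ i → i == j) ≡ 1
#-single j = trans (sum-cong (λ i → sym (*-identityʳ (b2n (i == j))))) (sum-δ j (λ _ → 1))

#-∨ : ∀ {n} (P Q : Fin n → Bool) → # (λ i → P i ∨ Q i) ≤ # P + # Q
#-∨ P Q = ≤-trans (sum-mono (λ i → h (P i) (Q i))) (≤-reflexive (sum-+ (b2n ∘ P) (b2n ∘ Q)))
  where
  h : ∀ a b → b2n (a ∨ b) ≤ b2n a + b2n b
  h true  b = s≤s z≤n
  h false b = ≤-refl

#-disj : ∀ {n} (P Q R : Fin n → Bool) → (∀ i → P i ≡ true → R i ≡ true) → (∀ i → Q i ≡ true → R i ≡ true) →
         (∀ i → P i ≡ true → Q i ≡ true → ⊥) → # P + # Q ≤ # R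
#-disj P Q R p q d = ≤-trans (≤-reflexive (sym (sum-+ (b2n ∘ P) (b2n ∘ Q)))) (sum-mono λ i → h (p i) (q i) (d i))
  where
  h : ∀ {a b c} → (a ≡ true → c ≡ true) → (b ≡ true → c ≡ true) → (a ≡ true → b ≡ true → ⊥) → b2n a + b2n b ≤ b2n c
  h {true}  {true}  p q d = ⊥-elim (d refl refl)
  h {true}  {false} p q d = b2n-mono p
  h {false} {b}     p q d = b2n-mono q

#-cover : ∀ {n} (P Q R : Fin n → Bool) → (∀ i → R i ≡ true → P i ≡ true ⊎ Q i ≡ true) → # R ≤ # P + # Q
#-cover P Q R h = ≤-trans (#-mono (λ i r → f (h i r))) (#-∨ P Q)
  where
  f : ∀ {a b} → a ≡ true ⊎ b ≡ true → a ∨ b ≡ true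
  f (inj₁ x) = ∨-introˡ x
  f (inj₂ y) = ∨-introʳ y

#-split : ∀ {n} (P R : Fin n → Bool) → # R ≡ # (λ i → R i ∧ P i) + # (λ i → R i ∧ not (P i))
#-split P R = trans (sum-cong (λ i → h (R i) (P i))) (sum-+ (λ i → b2n (R i ∧ P i)) (λ i → b2n (R i ∧ not (P i))))
  where
  h : ∀ r p → b2n r ≡ b2n (r ∧ p) + b2n (r ∧ not p)
  h true  true  = refl
  h true  false = refl
  h false _     = refl

#-remove : ∀ {n} (P : Fin n → Bool) j → # P ≤ suc (# (λ i → P i ∧ not (i == j)))
#-remove P j = begin
  # P ≤⟨ #-cover (λ i → i == j) (λ i → P i ∧ not (i == j)) P (λ i p → h (tf (i == j)) p) ⟩
  # (λ i → i == j) + # (λ i → P i ∧ not (i == j)) ≡⟨ cong (_+ # (λ i → P i ∧ not (i == j))) (#-single j) ⟩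
  suc (# (λ i → P i ∧ not (i == j))) ∎
  where
  open ≤-Reasoning
  h : ∀ {a b} → b ≡ true ⊎ b ≡ false → a ≡ true → b ≡ true ⊎ (a ∧ not b) ≡ true
  h (inj₁ x) _ = inj₁ x
  h (inj₂ x) y = inj₂ (∧-intro y (not-intro x))

opaque
  #-pick : ∀ {n} (P : Fin n → Bool) xs → length xs < # P → ∃ λ v → P v ≡ true × All (v ≢_) xs
  #-pick P [] h = let i , p = #-∃ P h in i , p , []
  #-pick P (x ∷ xs) h =
    let v , p , a = #-pick (λ i → P i ∧ not (i == x)) xs (≤-pred (≤-trans h (#-remove P x)))
        p₁ , p₂ = ∧-split p
    in v , p₁ , ==f⇒≢ (not-true p₂) ∷ a

#-list : ∀ {n} (A R : Fin n → Bool) xs → Unique xs → All (λ x → R x ≡ true) xs → (∀ i → A i ≡ true → R i ≡ true) →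
         All (λ x → A x ≡ false) xs → # A + length xs ≤ # R
#-list A R [] u r s f = subst (_≤ # R) (sym (+-identityʳ _)) (#-mono s)
#-list A R (x ∷ xs) (x∉ ∷ u) (rx ∷ r) s (fx ∷ f) = begin
  # A + suc (length xs) ≡⟨ +-suc _ _ ⟩
  suc (# A + length xs) ≤⟨ s≤s (#-list A R′ xs u (All.zipWith (λ (p , q) → ∧-intro p (not-intro (≢⇒== (q ∘ sym)))) (r , x∉)) s′ f) ⟩
  suc (# R′) ≡⟨ cong (_+ # R′) (#-single x) ⟨
  # (λ i → i == x) + # R′ ≤⟨ #-disj (λ i → i == x) R′ R (λ i e → subst (λ v → R v ≡ true) (sym (==⇒≡ e)) rx) (λ i e → ∧ˡ e) (λ i e e′ → true≢false e (not-true {i == x} (∧ʳ {R i} e′))) ⟩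
  # R ∎
  where
  open ≤-Reasoning
  R′ = λ i → R i ∧ not (i == x)
  s′ : ∀ i → A i ≡ true → R′ i ≡ true
  s′ i a = ∧-intro (s i a) (not-intro (≢⇒== λ { refl → true≢false a fx }))

#-one : ∀ {n} (A R : Fin n → Bool) x → R x ≡ true → (∀ i → A i ≡ true → R i ≡ true) → A x ≡ false → # A + 1 ≤ # R
#-one A R x r s f = #-list A R (x ∷ []) ([] ∷ []) (r ∷ []) s (f ∷ [])

#-image : ∀ {n k} (f : Fin n → Fin k) (Q : Fin k → Bool) (P : Fin n → Bool) →
          (∀ c → Q c ≡ true → ∃ λ u → P u ≡ true × f u ≡ c) → # Q ≤ # P
#-image f Q P h = begin
  # Q ≤⟨ sum-mono (λ c → pt c (tf (Q c))) ⟩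
  sum (λ c → sum (λ u → b2n (P u) * b2n (c == f u))) ≡⟨ sum-swap (λ c u → b2n (P u) * b2n (c == f u)) ⟩
  sum (λ u → sum (λ c → b2n (P u) * b2n (c == f u))) ≡⟨ sum-cong (λ u → trans (sum-*ˡ (b2n (P u)) (λ c → b2n (c == f u))) (trans (cong (b2n (P u) *_) (#-single (f u))) (*-identityʳ _))) ⟩
  # P ∎
  where
  open ≤-Reasoning
  pt : ∀ c → Q c ≡ true ⊎ Q c ≡ false → b2n (Q c) ≤ sum (λ u → b2n (P u) * b2n (c == f u))
  pt c (inj₂ e) = subst (λ b → b2n b ≤ _) (sym e) z≤n
  pt c (inj₁ e) with h c e
  ... | u , p , refl = ≤-trans (subst₂ (λ a b → b2n (Q (f u)) ≤ b2n a * b2n b) (sym p) (sym (==-refl (f u))) (b2n≤1 _)) (term≤sum (λ v → b2n (P v) * b2n (f u == f v)) u)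

opaque
  anyᵇ : ∀ {n} → (Fin n → Bool) → Bool
  anyᵇ P = does (any? (λ i → P i ≟ᵇ true))

  anyᵇ-elim : ∀ {n} {P : Fin n → Bool} → anyᵇ P ≡ true → ∃ λ i → P i ≡ true
  anyᵇ-elim {P = P} e = dec-true (any? (λ i → P i ≟ᵇ true)) e

  anyᵇ-intro : ∀ {n} {P : Fin n → Bool} i → P i ≡ true → anyᵇ P ≡ true
  anyᵇ-intro {P = P} i p = true-dec (any? (λ i → P i ≟ᵇ true)) (i , p)

opaque
  argmin : ∀ {n} (P : Fin n → Bool) (r : Fin n → ℕ) i → P i ≡ true →
           ∃ λ v → P v ≡ true × (∀ u → P u ≡ true → r v ≤ r u)
  argmin P r i p = go (suc (r i)) i p ≤-refl
    where
    go : ∀ m i → P i ≡ true → r i < m → ∃ λ v → P v ≡ true × (∀ u → P u ≡ true → r v ≤ r u)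
    go (suc m) i p (s≤s h) with any? (λ u → (P u ∧ (suc (r u) ≤ᵇ r i)) ≟ᵇ true)
    ... | yes (u , q) = go m u (∧ˡ q) (≤-trans (≤ᵇ-true (∧ʳ {P u} q)) h)
    ... | no ¬q = i , p , λ u pu → ≮⇒≥ λ lt → ¬q (u , ∧-intro pu (true-≤ᵇ lt))

-- Greedy colouring

memᵇ : ∀ {n} → List (Fin n) → Fin n → Bool
memᵇ []       u = false
memᵇ (x ∷ xs) u = (u == x) ∨ memᵇ xs u

memᵇ-false : ∀ {n} {u : Fin n} {xs} → All (u ≢_) xs → memᵇ xs u ≡ false
memᵇ-false [] = refl
memᵇ-false (h ∷ a) = trans (cong (_∨ _) (≢⇒== h)) (memᵇ-false a)

false-memᵇ : ∀ {n} {u : Fin n} xs → memᵇ xs u ≡ false → All (u ≢_) xs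
false-memᵇ [] e = []
false-memᵇ {u = u} (x ∷ xs) e with u == x in q
... | false = ==f⇒≢ q ∷ false-memᵇ xs e

All-memᵇ : ∀ {n} {P : Fin n → Set} {u : Fin n} {xs} → All P xs → memᵇ xs u ≡ true → P u
All-memᵇ {P = P} {u} {x ∷ xs} (p ∷ a) e with u == x in q
... | true  = subst P (sym (==⇒≡ q)) p
... | false = All-memᵇ a e

all-memᵇ : ∀ {n} (xs : List (Fin n)) → All (λ x → memᵇ xs x ≡ true) xs
all-memᵇ [] = []
all-memᵇ (x ∷ xs) = ∨-introˡ (==-refl x) ∷ All.map ∨-introʳ (all-memᵇ xs)

deg : ∀ {n} → Graph n → Fin n → ℕ
deg G v = # (adj G v)

adj-≢ : ∀ {n} (G : Graph n) {u v} → adj G u v ≡ true → u ≢ v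
adj-≢ G {u} e refl = true≢false e (adj-irrefl G u)

adj-sym′ : ∀ {n} (G : Graph n) {u v} → adj G u v ≡ true → adj G v u ≡ true
adj-sym′ G {u} {v} e = trans (adj-sym G v u) e

-- Blank neighbours of equal rank are pending for each other, so the order inside a rank is free.
pending : ∀ {n} → Graph n → (Fin n → Bool) → (Fin n → ℕ) → Fin n → Fin n → Bool
pending G S rank v u = not (S u) ∧ adj G v u ∧ (rank u ≤ᵇ rank v)

module _ {n k : ℕ} (G : Graph n) where

  ProperOn : (Fin n → Bool) → (Fin n → Fin k) → Set
  ProperOn S c = ∀ u v → S u ≡ true → S v ≡ true → adj G u v ≡ true → c u ≢ c v

  seen : (Fin n → Fin k) → (Fin n → Bool) → Fin n → Fin k → Bool
  seen c S v a = anyᵇ (λ u → S u ∧ adj G v u ∧ (c u == a))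

  -- The vertices of xs are neighbours of v that need not be counted when v is coloured:
  -- coloured ones repeating a colour, and uncoloured ones of higher rank.
  Dropped : (Fin n → Fin k) → (Fin n → Bool) → (Fin n → ℕ) → Fin n → List (Fin n) → Set
  Dropped c S rank v xs = All (λ x → adj G v x ≡ true ×
    ((S x ≡ true × ∃ λ u → S u ≡ true × adj G v u ≡ true × All (u ≢_) xs × c u ≡ c x) ⊎
     (S x ≡ false × rank v < rank x))) xs

  -- A coloured vertex of the list has a twin of its colour outside the list, so every colour seen
  -- at `v` is shown by an unlisted neighbour; the uncoloured vertices of the list outrank `v` and
  -- are not pending. Hence the seen colours, the pending vertices and the list together fit into
  -- the degree.
  dropped-bound : ∀ c S rank v xs → Unique xs → Dropped c S rank v xs → deg G v < k + length xs →
                  # (seen c S v) + # (pending G S rank v) < k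
  dropped-bound c S rank v xs u d h = +-cancelʳ-< (length xs) (# (seen c S v) + # (pending G S rank v)) k (begin-strict
    # (seen c S v) + # (pending G S rank v) + length xs ≤⟨ +-monoˡ-≤ (length xs) (+-monoˡ-≤ _ (#-image c (seen c S v) A image)) ⟩
    # A + # (pending G S rank v) + length xs ≤⟨ +-monoˡ-≤ (length xs) (#-disj A (pending G S rank v) B (λ _ → ∨-introˡ) (λ _ → ∨-introʳ)
         (λ i a p → true≢false (∧ˡ a) (not-true (∧ˡ {not (S i)} p)))) ⟩
    # B + length xs ≤⟨ #-list B (adj G v) xs u (All.map proj₁ d) B⊆ (All.zipWith B∌ (d , all-memᵇ xs)) ⟩
    deg G v <⟨ h ⟩
    k + length xs ∎)
    where
    open ≤-Reasoning
    A = λ u → S u ∧ adj G v u ∧ not (memᵇ xs u)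
    B = λ u → A u ∨ pending G S rank v u
    B⊆ : ∀ i → B i ≡ true → adj G v i ≡ true
    B⊆ i b with ∨-split {A i} b
    ... | inj₁ a = ∧ˡ (∧ʳ {S i} a)
    ... | inj₂ p = ∧ˡ (∧ʳ {not (S i)} p)
    B∌ : ∀ {x} → (adj G v x ≡ true × ((S x ≡ true × ∃ λ u → S u ≡ true × adj G v u ≡ true × All (u ≢_) xs × c u ≡ c x) ⊎
         (S x ≡ false × rank v < rank x))) × memᵇ xs x ≡ true → B x ≡ false
    B∌ {x} ((ax , o) , m) = ≢true λ b → [ (λ a → true≢false m (not-true (∧ʳ {adj G v x} (∧ʳ {S x} a)))) ,
      (λ p → let ns , q = ∧-split {not (S x)} p in
        [ (λ (sx , _) → true≢false sx (not-true ns)) ,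
          (λ (_ , r) → <⇒≱ r (≤ᵇ-true (∧ʳ {adj G v x} q))) ]′ o) ]′ (∨-split {A x} b)
    image : ∀ a → seen c S v a ≡ true → ∃ λ u → A u ≡ true × c u ≡ a
    image a e with anyᵇ-elim e
    ... | w , p with ∧-split {S w} p
    ... | sw , p′ with ∧-split {adj G v w} p′
    ... | aw , cw with tf (memᵇ xs w)
    ... | inj₂ f = w , ∧-intro sw (∧-intro aw (not-intro f)) , ==⇒≡ cw
    ... | inj₁ t with All-memᵇ d t
    ... | _ , inj₂ (s , _) = ⊥-elim (true≢false sw s)
    ... | _ , inj₁ (_ , u , su , au , nu , cu) = u , ∧-intro su (∧-intro au (not-intro (memᵇ-false nu))) , trans cu (==⇒≡ cw)

  -- The room condition survives when a blank vertex of least rank is coloured: it was pending for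
  -- each remaining blank neighbour, so there one pending vertex is traded for at most one new seen
  -- colour.
  greedy : ∀ (c : Fin n → Fin k) S rank → ProperOn S c →
           (∀ v → S v ≡ false → # (seen c S v) + # (pending G S rank v) < k) → Colourable G k
  greedy c S rank = go (# (not ∘ S)) c S ≤-refl
    where
    go : ∀ m (c : Fin n → Fin k) S → # (not ∘ S) ≤ m → ProperOn S c →
         (∀ v → S v ≡ false → # (seen c S v) + # (pending G S rank v) < k) → Colourable G k
    go m c S h proper room with any? (λ v → not (S v) ≟ᵇ true)
    ... | no ¬v = c , λ u v e → proper u v (all u) (all v) e
      where
      all : ∀ v → S v ≡ true
      all v with S v in e
      ... | true = refl
      ... | false = ⊥-elim (¬v (v , cong not e))
    go zero c S h proper room | yes (v , p) = ⊥-elim (<⇒≱ (#-pos (not ∘ S) v p) h)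
    go (suc m) c S h proper room | yes (v , p) with argmin (not ∘ S) rank v p
    ... | v₀ , p₀ , min with #-∃ (not ∘ seen c S v₀) pos
      where
      pos : 0 < # (not ∘ seen c S v₀)
      pos = +-cancelˡ-< (# (seen c S v₀)) 0 _ (begin-strict
        # (seen c S v₀) + 0 ≤⟨ +-monoʳ-≤ (# (seen c S v₀)) z≤n ⟩
        # (seen c S v₀) + # (pending G S rank v₀) <⟨ room v₀ (not-true p₀) ⟩
        k ≡⟨ #-full k ⟨
        # {k} (λ _ → true) ≡⟨ #-split (seen c S v₀) (λ _ → true) ⟩
        # (seen c S v₀) + # (not ∘ seen c S v₀) ∎)
        where open ≤-Reasoning
    ... | a , fresh = go m c′ S′ h′ proper′ room′
      where
      open ≤-Reasoning
      c′ = λ u → if u == v₀ then a else c u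
      S′ = λ u → S u ∨ (u == v₀)
      c′-new : c′ v₀ ≡ a
      c′-new = cong (if_then a else c v₀) (==-refl v₀)
      c′-old : ∀ {u} → u ≢ v₀ → c′ u ≡ c u
      c′-old {u} ne = cong (if_then a else c u) (≢⇒== ne)
      unseen : ∀ u → S u ≡ true → adj G v₀ u ≡ true → c u ≢ a
      unseen u su au refl = true≢false (anyᵇ-intro u (∧-intro su (∧-intro au (==-refl (c u))))) (not-true fresh)
      S-≢ : ∀ {u} → S u ≡ true → u ≢ v₀
      S-≢ su refl = true≢false su (not-true p₀)
      h′ : # (not ∘ S′) ≤ m
      h′ = ≤-pred (≤-trans (subst (_≤ # (not ∘ S)) (+-comm _ 1) (#-list (not ∘ S′) (not ∘ S) (v₀ ∷ []) ([] ∷ []) (p₀ ∷ [])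
             (λ i e → not-intro (≢true λ s → true≢false (∨-introˡ {S i} {i == v₀} s) (not-true e)))
             (cong not (∨-introʳ {S v₀} (==-refl v₀)) ∷ []))) h)
      proper′ : ProperOn S′ c′
      proper′ u w su sw e eq with ∨-split {S u} su | ∨-split {S w} sw
      ... | inj₁ s | inj₁ s′ = proper u w s s′ e (trans (sym (c′-old (S-≢ s))) (trans eq (c′-old (S-≢ s′))))
      ... | inj₁ s | inj₂ q with refl ← ==⇒≡ q = unseen u s (adj-sym′ G e) (trans (sym (c′-old (S-≢ s))) (trans eq c′-new))
      ... | inj₂ q | inj₁ s with refl ← ==⇒≡ q = unseen w s e (trans (sym (c′-old (S-≢ s))) (trans (sym eq) c′-new))
      ... | inj₂ q | inj₂ q′ = adj-≢ G e (trans (==⇒≡ q) (sym (==⇒≡ q′)))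
      pend⊆ : ∀ v i → pending G S′ rank v i ≡ true → pending G S rank v i ≡ true
      pend⊆ v i e = let x , y = ∧-split {not (S′ i)} e in
        ∧-intro (not-intro (≢true λ s → true≢false (∨-introˡ {S i} {i == v₀} s) (not-true x))) y
      seen⊆ : ∀ v b → seen c′ S′ v b ≡ true → seen c S v b ≡ true ⊎ (adj G v v₀ ≡ true × b ≡ a)
      seen⊆ v b e with anyᵇ-elim e
      ... | w , p with ∧-split {S′ w} p
      ... | sw , p′ with ∧-split {adj G v w} p′
      ... | aw , cw with ∨-split {S w} sw
      ... | inj₁ s = inj₁ (anyᵇ-intro w (∧-intro s (∧-intro aw (subst (λ x → (x == b) ≡ true) (c′-old (S-≢ s)) cw))))
      ... | inj₂ q with refl ← ==⇒≡ q = inj₂ (aw , trans (sym (==⇒≡ cw)) c′-new)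
      room′ : ∀ v → S′ v ≡ false → # (seen c′ S′ v) + # (pending G S′ rank v) < k
      room′ v e with tf (S v)
      ... | inj₁ s = ⊥-elim (true≢false (∨-introˡ {S v} {v == v₀} s) e)
      ... | inj₂ s with tf (adj G v v₀)
      ... | inj₂ na = ≤-<-trans (+-mono-≤ (#-mono (λ b q → [ id , (λ (x , _) → ⊥-elim (true≢false x na)) ]′ (seen⊆ v b q))) (#-mono (pend⊆ v))) (room v s)
      ... | inj₁ av = begin-strict
        # (seen c′ S′ v) + # (pending G S′ rank v) ≤⟨ +-monoˡ-≤ _ (#-cover (seen c S v) (_== a) (seen c′ S′ v)
              (λ b q → [ inj₁ , (λ (_ , y) → inj₂ (subst (λ z → (z == a) ≡ true) (sym y) (==-refl a))) ]′ (seen⊆ v b q))) ⟩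
        # (seen c S v) + # (_== a) + # (pending G S′ rank v) ≡⟨ cong (λ x → # (seen c S v) + x + # (pending G S′ rank v)) (#-single a) ⟩
        # (seen c S v) + 1 + # (pending G S′ rank v) ≡⟨ +-assoc (# (seen c S v)) 1 _ ⟩
        # (seen c S v) + (1 + # (pending G S′ rank v)) ≡⟨ cong (# (seen c S v) +_) (+-comm 1 _) ⟩
        # (seen c S v) + (# (pending G S′ rank v) + 1) ≤⟨ +-monoʳ-≤ (# (seen c S v)) (#-list (pending G S′ rank v) (pending G S rank v) (v₀ ∷ []) ([] ∷ [])
              (∧-intro p₀ (∧-intro av (true-≤ᵇ (min v (not-intro s)))) ∷ []) (pend⊆ v)
              (cong (λ b → not b ∧ adj G v v₀ ∧ (rank v₀ ≤ᵇ rank v)) (∨-introʳ {S v₀} (==-refl v₀)) ∷ [])) ⟩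
        # (seen c S v) + # (pending G S rank v) <⟨ room v s ⟩
        k ∎

-- Critical graphs

Clique : ∀ {n} → Graph n → (Fin n → Bool) → Set
Clique G T = ∀ u v → T u ≡ true → T v ≡ true → u ≢ v → adj G u v ≡ true

module _ {A : Set} {P : A → Set} where

  all₁ : ∀ {a xs} → All P (a ∷ xs) → P a
  all₁ (p ∷ _) = p

  all₂ : ∀ {a b xs} → All P (a ∷ b ∷ xs) → P b
  all₂ (_ ∷ p ∷ _) = p

  all₃ : ∀ {a b c xs} → All P (a ∷ b ∷ c ∷ xs) → P c
  all₃ (_ ∷ _ ∷ p ∷ _) = p

  all₄ : ∀ {a b c d xs} → All P (a ∷ b ∷ c ∷ d ∷ xs) → P d
  all₄ (_ ∷ _ ∷ _ ∷ p ∷ _) = p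

upd : ∀ {n} {A : Set} → (Fin n → A) → Fin n → A → Fin n → A
upd c x a u = if u == x then a else c u

upd-new : ∀ {n} {A : Set} (c : Fin n → A) x a → upd c x a x ≡ a
upd-new c x a = cong (if_then a else c x) (==-refl x)

upd-old : ∀ {n} {A : Set} (c : Fin n → A) x a {u} → u ≢ x → upd c x a u ≡ c u
upd-old c x a {u} ne = cong (if_then a else c u) (≢⇒== ne)

infixl 6 _⊕_
_⊕_ : ∀ {n} → (Fin n → Bool) → Fin n → Fin n → Bool
(S ⊕ x) u = S u ∨ (u == x)

⊕-new : ∀ {n} (S : Fin n → Bool) x → (S ⊕ x) x ≡ true
⊕-new S x = ∨-introʳ {S x} (==-refl x)

⊕-split : ∀ {n} (S : Fin n → Bool) x {u} → (S ⊕ x) u ≡ true → S u ≡ true ⊎ u ≡ x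
⊕-split S x {u} e with ∨-split {S u} e
... | inj₁ s = inj₁ s
... | inj₂ q = inj₂ (==⇒≡ q)

⊕-false : ∀ {n} (S : Fin n → Bool) x {u} → (S ⊕ x) u ≡ false → S u ≡ false × u ≢ x
⊕-false S x {u} e = ≢true (λ s → true≢false (∨-introˡ s) e) , λ { refl → true≢false (⊕-new S x) e }

false-⊕ : ∀ {n} (S : Fin n → Bool) x {u} → S u ≡ false → u ≢ x → (S ⊕ x) u ≡ false
false-⊕ S x s ne = ≢true λ e → [ (λ t → true≢false t s) , ne ]′ (⊕-split S x e)

-- Vertices are deleted by isolating them, so the vertex set does not change.
opaque
  modify : ∀ {n} → Graph n → (Fin n → Bool) → (Fin n → Fin n → Bool) → Graph n
  modify {n} G C r = record { adj = A ; sym = A-sym ; irrefl = A-irr }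
    where
    E : Fin n → Fin n → Bool
    E a b = adj G a b ∨ ((r a b ∨ r b a) ∧ not (a == b))
    A : Fin n → Fin n → Bool
    A a b = not (C a) ∧ not (C b) ∧ E a b
    A-sym→ : ∀ a b → A a b ≡ true → A b a ≡ true
    A-sym→ a b e with ∧-split {not (C a)} e
    ... | ca , e₁ with ∧-split {not (C b)} e₁
    ... | cb , e₂ with ∨-split {adj G a b} e₂
    ... | inj₁ ab = ∧-intro cb (∧-intro ca (∨-introˡ (adj-sym′ G ab)))
    ... | inj₂ rr with ∧-split {r a b ∨ r b a} rr
    ... | rr′ , ne = ∧-intro cb (∧-intro ca (∨-introʳ {adj G b a} (∧-intro
          ([ (λ x → ∨-introʳ {r b a} x) , ∨-introˡ ]′ (∨-split {r a b} rr′))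
          (not-intro (≢⇒== λ { refl → true≢false (==-refl b) (not-true ne) })))))
    A-sym : ∀ a b → A a b ≡ A b a
    A-sym a b = bool-ext (A-sym→ a b) (A-sym→ b a)
    A-irr : ∀ a → A a a ≡ false
    A-irr a = ≢true λ e → [ (λ x → true≢false x (adj-irrefl G a)) ,
       (λ y → true≢false (==-refl a) (not-true (∧ʳ {r a a ∨ r a a} y))) ]′
       (∨-split {adj G a a} (∧ʳ {not (C a)} (∧ʳ {not (C a)} e)))

  modify-elim : ∀ {n} (G : Graph n) C r {a b} → adj (modify G C r) a b ≡ true →
                C a ≡ false × C b ≡ false × (adj G a b ≡ true ⊎ (r a b ∨ r b a) ≡ true)
  modify-elim G C r {a} {b} e =
    let ca , e₁ = ∧-split {not (C a)} e
        cb , e₂ = ∧-split {not (C b)} e₁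
    in not-true ca , not-true cb , [ inj₁ , (λ rr → inj₂ (∧ˡ {r a b ∨ r b a} rr)) ]′ (∨-split {adj G a b} e₂)

  modify-old : ∀ {n} (G : Graph n) C r {a b} → C a ≡ false → C b ≡ false → adj G a b ≡ true → adj (modify G C r) a b ≡ true
  modify-old G C r ca cb e = ∧-intro (not-intro ca) (∧-intro (not-intro cb) (∨-introˡ e))

  modify-new : ∀ {n} (G : Graph n) C r {a b} → C a ≡ false → C b ≡ false → r a b ≡ true → a ≢ b → adj (modify G C r) a b ≡ true
  modify-new G C r {a} {b} ca cb e ne = ∧-intro (not-intro ca) (∧-intro (not-intro cb) (∨-introʳ {adj G a b} (∧-intro (∨-introˡ e) (not-intro (≢⇒== ne)))))

module _ {n : ℕ} (G : Graph n) (C : Fin n → Bool) (r : Fin n → Fin n → Bool) where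

  modify-deg : ∀ t u → C u ≡ false → # (λ b → r u b ∨ r b u) + t ≤ # (λ b → adj G u b ∧ C b) → deg (modify G C r) u + t ≤ deg G u
  modify-deg t u cu h = begin
    deg (modify G C r) u + t ≤⟨ +-monoˡ-≤ t (#-cover (λ b → adj G u b ∧ not (C b)) (λ b → r u b ∨ r b u) (adj (modify G C r) u) cov) ⟩
    # (λ b → adj G u b ∧ not (C b)) + # (λ b → r u b ∨ r b u) + t ≡⟨ +-assoc (# (λ b → adj G u b ∧ not (C b))) _ t ⟩
    # (λ b → adj G u b ∧ not (C b)) + (# (λ b → r u b ∨ r b u) + t) ≤⟨ +-monoʳ-≤ (# (λ b → adj G u b ∧ not (C b))) h ⟩
    # (λ b → adj G u b ∧ not (C b)) + # (λ b → adj G u b ∧ C b) ≡⟨ +-comm (# (λ b → adj G u b ∧ not (C b))) _ ⟩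
    # (λ b → adj G u b ∧ C b) + # (λ b → adj G u b ∧ not (C b)) ≡⟨ #-split C (adj G u) ⟨
    deg G u ∎
    where
    open ≤-Reasoning
    cov : ∀ b → adj (modify G C r) u b ≡ true → (adj G u b ∧ not (C b)) ≡ true ⊎ (r u b ∨ r b u) ≡ true
    cov b e with modify-elim G C r e
    ... | _ , cb , inj₁ x = inj₁ (∧-intro x (not-intro cb))
    ... | _ , cb , inj₂ y = inj₂ y

  modify-deg₀ : ∀ u → C u ≡ true → deg (modify G C r) u ≡ 0
  modify-deg₀ u cu = #-none {P = adj (modify G C r) u} λ b → ≢true λ e → true≢false cu (proj₁ (modify-elim G C r e))

proper-⊕ : ∀ {n k} (G : Graph n) (c : Fin n → Fin k) S x a → ProperOn G S c → S x ≡ false →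
           (∀ u → S u ≡ true → adj G x u ≡ true → c u ≢ a) → ProperOn G (S ⊕ x) (upd c x a)
proper-⊕ G c S x a p sx h u v su sv e eq with ⊕-split S x su | ⊕-split S x sv
... | inj₁ s | inj₁ t = p u v s t e (trans (sym (upd-old c x a (S≢ s))) (trans eq (upd-old c x a (S≢ t))))
  where
  S≢ : ∀ {u} → S u ≡ true → u ≢ x
  S≢ s refl = true≢false s sx
... | inj₁ s | inj₂ refl = h u s (adj-sym′ G e) (trans (sym (upd-old c x a (adj-≢ G e))) (trans eq (upd-new c x a)))
... | inj₂ refl | inj₁ t = h v t e (trans (sym (upd-old c x a (adj-≢ G e ∘ sym))) (trans (sym eq) (upd-new c x a)))
... | inj₂ refl | inj₂ refl = adj-≢ G e refl

opaque
  free-colour : ∀ {n k} (c : Fin n → Fin k) (P : Fin n → Bool) as → # P + length as < k →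
                ∃ λ a → (∀ u → P u ≡ true → c u ≢ a) × All (a ≢_) as
  free-colour {n} {k} c P as h =
    let a , p , q = #-pick (not ∘ hit) as (+-cancelˡ-< (# hit) (length as) _ (begin-strict
          # hit + length as ≤⟨ +-monoˡ-≤ (length as) (#-image c hit P (λ a e → let u , p = anyᵇ-elim e in u , ∧ˡ p , ==⇒≡ (∧ʳ {P u} p))) ⟩
          # P + length as <⟨ h ⟩
          k ≡⟨ #-full k ⟨
          # {k} (λ _ → true) ≡⟨ #-split hit (λ _ → true) ⟩
          # hit + # (not ∘ hit) ∎))
    in a , (λ u pu e → true≢false (anyᵇ-intro u (∧-intro pu (subst (λ z → (c u == z) ≡ true) e (==-refl (c u))))) (not-true p)) , q
    where
    open ≤-Reasoning
    hit : Fin k → Bool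
    hit a = anyᵇ (λ u → P u ∧ (c u == a))

-- `IH` compares degrees vertex by vertex instead of edge sets, so the smaller graph may contain
-- edges that `G` lacks.
module Critical {n k : ℕ} (G : Graph n)
  (deg≤ : ∀ v → deg G v ≤ suc k)
  (noK : ∀ T → Clique G T → # T ≤ k)
  (IH : ∀ (G′ : Graph n) → (∀ u → deg G′ u ≤ deg G u) → (∃ λ u → deg G′ u < deg G u) →
        (∀ T → Clique G′ T → # T ≤ k) → Colourable G′ k)
  (nc : ¬ Colourable G k) where

  finish : ∀ (c : Fin n → Fin k) S rank → ProperOn G S c →
           (∀ v → S v ≡ false → ∃ λ xs → Unique xs × Dropped G c S rank v xs × deg G v < k + length xs) → ⊥
  finish c S rank p h = nc (greedy G c S rank p λ v sv →
    let xs , u , d , l = h v sv in dropped-bound G c S rank v xs u d l)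

  -- A vertex outside `C` loses its edges into `C` and may receive as many new ones, given by `r`,
  -- without its degree growing; `x₀` makes the descent strict.
  reduce : ∀ C r x₀ → C x₀ ≡ true → 0 < deg G x₀ →
    (∀ u → C u ≡ false → # (λ b → r u b ∨ r b u) ≤ # (λ b → adj G u b ∧ C b)) →
    (∀ T → Clique (modify G C r) T → # T ≤ k) →
    ∃ λ (c : Fin n → Fin k) → ProperOn G (not ∘ C) c × (∀ u v → C u ≡ false → C v ≡ false → r u v ≡ true → u ≢ v → c u ≢ c v)
  reduce C r x₀ cx dx h noK′ = let c , p = IH (modify G C r) le (x₀ , subst (_< deg G x₀) (sym (modify-deg₀ G C r x₀ cx)) dx) noK′ in
    c , (λ u v cu cv e → p u v (modify-old G C r (not-true cu) (not-true cv) e)) ,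
        (λ u v cu cv e ne → p u v (modify-new G C r cu cv e ne))
    where
    le : ∀ u → deg (modify G C r) u ≤ deg G u
    le u with tf (C u)
    ... | inj₁ cu = subst (_≤ deg G u) (sym (modify-deg₀ G C r u cu)) z≤n
    ... | inj₂ cu = subst (_≤ deg G u) (+-identityʳ _) (modify-deg G C r 0 u cu (subst (_≤ # (λ b → adj G u b ∧ C b)) (sym (+-identityʳ _)) (h u cu)))

  delete : ∀ C x₀ → C x₀ ≡ true → 0 < deg G x₀ → ∃ λ (c : Fin n → Fin k) → ProperOn G (not ∘ C) c
  delete C x₀ cx dx = let c , p , _ = reduce C (λ _ _ → false) x₀ cx dx
                                        (λ u _ → subst (_≤ # (λ b → adj G u b ∧ C b)) (sym (sum-zero n)) z≤n)
                                        (λ T cl → noK T λ u v tu tv ne → old (modify-elim G C (λ _ _ → false) (cl u v tu tv ne)))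
                      in c , p
    where
    old : ∀ {u v} → C u ≡ false × C v ≡ false × (adj G u v ≡ true ⊎ false ≡ true) → adj G u v ≡ true
    old (_ , _ , inj₁ x) = x

  -- Otherwise a colouring of the rest would leave a colour for `v`. Isolated vertices are excepted,
  -- because deleting one removes no edge.
  min-degree : ∀ v → 0 < deg G v → k ≤ deg G v
  min-degree v dv = ≮⇒≥ λ lt →
    let c , p = delete (_== v) v (==-refl v) dv in
    finish c (not ∘ (_== v)) (λ _ → 0) p λ u su → [] , [] , [] ,
      subst₂ (λ w m → deg G w < m) (sym (==⇒≡ (not-f su))) (sym (+-identityʳ k)) lt
    where
    not-f : ∀ {b} → not b ≡ false → b ≡ true
    not-f {true} _ = refl

  nbhd-outside : ∀ x (C W : Fin n → Bool) → (∀ w → W w ≡ true → adj G x w ≡ true × C w ≡ true) →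
                 # (λ u → adj G x u ∧ not (C u)) + # W ≤ suc k
  nbhd-outside x C W h = ≤-trans (#-disj (λ u → adj G x u ∧ not (C u)) W (adj G x) (λ i e → ∧ˡ e) (λ i w → proj₁ (h i w))
    (λ i e w → true≢false (proj₂ (h i w)) (not-true (∧ʳ {adj G x i} e)))) (deg≤ x)

  module _ (W : Fin n → Bool) where

    -- `W` lies in both neighbourhoods and is uncoloured, so `a` and `b` together have at most 2(k +
    -- 1 - |W|) coloured neighbours. The hypothesis makes this plus the length of `as` less than k.
    pair-alike : ∀ (c : Fin n → Fin k) S a b as → ProperOn G S c → (∀ u → S u ≡ true → W u ≡ false) → S a ≡ false → S b ≡ false → a ≢ b →
           (∀ w → W w ≡ true → adj G w a ≡ true) → (∀ w → W w ≡ true → adj G w b ≡ true) → adj G a b ≡ false → length as + k + 3 ≤ 2 * # W →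
           ∃ λ α → All (α ≢_) as × ∃ λ c′ → ProperOn G (S ⊕ a ⊕ b) c′ × c′ a ≡ α × c′ b ≡ α × (∀ u → u ≢ a → u ≢ b → c′ u ≡ c u)
    pair-alike c S a b as p SW sa sb ne adja adjb nab h =
      let α , f , g = free-colour c (λ u → (adj G a u ∧ not (T u)) ∨ (adj G b u ∧ not (T u))) as small in
      α , g , upd (upd c a α) b α , proper-⊕ G (upd c a α) (S ⊕ a) b α
        (proper-⊕ G c S a α p sa λ u su e → f u (∨-introˡ (∧-intro e (cong not (notT su)))))
        (false-⊕ S a sb (ne ∘ sym))
        (λ u su e → [ (λ s → subst (_≢ α) (sym (upd-old c a α λ { refl → true≢false s sa }))
                        (f u (∨-introʳ {adj G a u ∧ not (T u)} (∧-intro e (cong not (notT s)))))) ,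
                     (λ { refl → ⊥-elim (true≢false (adj-sym′ G e) nab) }) ]′ (⊕-split S a su)) ,
        trans (upd-old (upd c a α) b α ne) (upd-new c a α) , upd-new (upd c a α) b α , λ u ua ub → trans (upd-old (upd c a α) b α ub) (upd-old c a α ua)
      where
      T = not ∘ S
      notT : ∀ {u} → S u ≡ true → T u ≡ false
      notT = cong not
      bnd : ∀ x → (∀ w → W w ≡ true → adj G w x ≡ true) → # (λ u → adj G x u ∧ not (T u)) + # W ≤ suc k
      bnd x a = nbhd-outside x T W λ w ww → adj-sym′ G (a w ww) , not-intro (≢true λ s → true≢false ww (SW w s))
      small : # (λ u → (adj G a u ∧ not (T u)) ∨ (adj G b u ∧ not (T u))) + length as < k
      small = lin 0 (+-mono-≤ (+-mono-≤ (+-mono-≤ (bnd a adja) (bnd b adjb))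
               (#-∨ (λ u → adj G a u ∧ not (T u)) (λ u → adj G b u ∧ not (T u)))) h)
               (eq _ (# (λ u → adj G a u ∧ not (T u))) (# (λ u → adj G b u ∧ not (T u))) (# W) (length as) k)
        where
        eq : ∀ u x y w l k → k + (x + w + (y + w) + u + (l + k + 3)) ≡ suc (u + l) + (suc k + suc k + (x + y) + 2 * w) + 0
        eq = solve-∀

    -- Every vertex of W sees two repeated colours, so W can be coloured last.
    save-two : ∀ (c : Fin n → Fin k) S a b d e → ProperOn G S c → (∀ w → S w ≡ false → W w ≡ true) →
               (∀ w → W w ≡ true → All (λ x → adj G w x ≡ true) (a ∷ b ∷ d ∷ e ∷ [])) → All (λ x → S x ≡ true) (a ∷ b ∷ d ∷ e ∷ []) →
               a ≢ b → a ≢ e → d ≢ b → d ≢ e → b ≢ e → c a ≡ c b → c d ≡ c e → ⊥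
    save-two c S a b d e p SW adjW (Sa ∷ Sb ∷ Sd ∷ Se ∷ []) a≢b a≢e d≢b d≢e b≢e cab cde = finish c S (λ _ → 0) p λ w sw →
      let aw = adjW w (SW w sw) in
      b ∷ e ∷ [] , (b≢e ∷ []) ∷ [] ∷ [] ,
      (all₂ aw , inj₁ (Sb , a , Sa , all₁ aw , a≢b ∷ a≢e ∷ [] , cab)) ∷
      (all₄ aw , inj₁ (Se , d , Sd , all₃ aw , d≢b ∷ d≢e ∷ [] , cde)) ∷ [] ,
      ≤-trans (s≤s (deg≤ w)) (≤-reflexive (+-comm 2 k))

    outside : List (Fin n) → Fin n → Bool
    outside xs u = not (W u ∨ memᵇ xs u)

    outside-W : ∀ xs u → outside xs u ≡ true → W u ≡ false
    outside-W xs u s = ≢true λ w → true≢false (∨-introˡ {W u} w) (not-true s)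

    outside-∌ : ∀ xs {u} → memᵇ xs u ≡ true → outside xs u ≡ false
    outside-∌ xs {u} m = cong not (∨-introʳ {W u} m)

    outside-false : ∀ xs u → outside xs u ≡ false → All (u ≢_) xs → W u ≡ true
    outside-false xs u s a with tf (W u)
    ... | inj₁ t = t
    ... | inj₂ f = ⊥-elim (true≢false (cong not (trans (cong (_∨ memᵇ xs u) f) (memᵇ-false a))) s)

    delete-W : ∀ a xs → memᵇ xs a ≡ true → (∀ w → W w ≡ true → adj G w a ≡ true) → 0 < # W → ∃ λ (c : Fin n → Fin k) → ProperOn G (outside xs) c
    delete-W a xs m adja h = delete (λ u → W u ∨ memᵇ xs u) a (∨-introʳ {W a} m) (≤-trans h (#-mono λ w ww → adj-sym′ G (adja w ww)))

    -- At most 2(k + 1 - |W|), hence at most k - 2, colours are blocked for each pair, so even the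
    -- second pair, which also avoids the colour of the first, finds one.
    two-nonedges : ∀ a b d e → Unique (a ∷ b ∷ d ∷ e ∷ []) → adj G a b ≡ false → adj G d e ≡ false →
                   (∀ w → W w ≡ true → All (λ x → adj G w x ≡ true) (a ∷ b ∷ d ∷ e ∷ [])) → k + 4 ≤ 2 * # W → ⊥
    two-nonedges a b d e ((a≢b ∷ a≢d ∷ a≢e ∷ []) ∷ (b≢d ∷ b≢e ∷ []) ∷ (d≢e ∷ []) ∷ [] ∷ []) nab nde adjW h =
      let ms = all-memᵇ xs ; ma = all₁ ms ; mb = all₂ ms ; md = all₃ ms ; me = all₄ ms
          c , p = delete-W a xs ma adja (*-cancelˡ-< 2 0 (# W) (≤-trans (s≤s z≤n) (≤-trans (m≤n+m 4 k) h)))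
          α , _ , c₁ , p₁ , c₁a , c₁b , _ = pair-alike c S₀ a b [] p (outside-W xs) (outside-∌ xs ma) (outside-∌ xs mb) a≢b adja adjb nab (lin 1 h (eq₁ k (# W)))
          β , _ , c₂ , p₂ , c₂d , c₂e , old = pair-alike c₁ S₁ d e (α ∷ []) p₁ SW
              (false-⊕ (S₀ ⊕ a) b (false-⊕ S₀ a (outside-∌ xs md) (a≢d ∘ sym)) (b≢d ∘ sym))
              (false-⊕ (S₀ ⊕ a) b (false-⊕ S₀ a (outside-∌ xs me) (a≢e ∘ sym)) (b≢e ∘ sym)) d≢e adjd adje nde (lin 0 h (eq₂ k (# W)))
      in save-two c₂ (S₁ ⊕ d ⊕ e) a b d e p₂ inW adjW
           (∨-introˡ (∨-introˡ (∨-introˡ (⊕-new S₀ a))) ∷ ∨-introˡ (∨-introˡ (⊕-new (S₀ ⊕ a) b)) ∷ ∨-introˡ (⊕-new S₁ d) ∷ ⊕-new (S₁ ⊕ d) e ∷ [])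
           a≢b a≢e (b≢d ∘ sym) d≢e b≢e
           (trans (old a a≢d a≢e) (trans c₁a (trans (sym c₁b) (sym (old b b≢d b≢e)))))
           (trans c₂d (sym c₂e))
      where
      xs = a ∷ b ∷ d ∷ e ∷ []
      S₀ = outside xs
      S₁ = S₀ ⊕ a ⊕ b
      adja : ∀ w → W w ≡ true → adj G w a ≡ true
      adja w ww = all₁ (adjW w ww)
      adjb : ∀ w → W w ≡ true → adj G w b ≡ true
      adjb w ww = all₂ (adjW w ww)
      adjd : ∀ w → W w ≡ true → adj G w d ≡ true
      adjd w ww = all₃ (adjW w ww)
      adje : ∀ w → W w ≡ true → adj G w e ≡ true
      adje w ww = all₄ (adjW w ww)
      eq₁ : ∀ k w → 2 * w + (k + 4) ≡ 0 + k + 3 + 2 * w + 1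
      eq₁ = solve-∀
      eq₂ : ∀ k w → 2 * w + (k + 4) ≡ 1 + k + 3 + 2 * w + 0
      eq₂ = solve-∀
      SW : ∀ u → S₁ u ≡ true → W u ≡ false
      SW u s = ≢true λ w → [ (λ s₁ → [ (λ s₂ → true≢false w (outside-W xs u s₂)) ,
                 (λ { refl → adj-≢ G (adja u w) refl }) ]′ (⊕-split S₀ a s₁)) ,
                 (λ { refl → adj-≢ G (adjb u w) refl }) ]′ (⊕-split (S₀ ⊕ a) b s)
      inW : ∀ w → (S₁ ⊕ d ⊕ e) w ≡ false → W w ≡ true
      inW w s = let s₃ , n₄ = ⊕-false (S₁ ⊕ d) e s
                    s₂ , n₃ = ⊕-false S₁ d s₃
                    s₁ , n₂ = ⊕-false (S₀ ⊕ a) b s₂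
                    s₀ , n₁ = ⊕-false S₀ a s₁
                in outside-false xs w s₀ (n₁ ∷ n₂ ∷ n₃ ∷ n₄ ∷ [])

    -- Three vertices of one colour save two colours: `a` is the twin of both `b` and `d`. They have
    -- at most 3(k + 1 - |W|) coloured neighbours, which is below k exactly when 2k + 4 is at most
    -- 3|W|.
    independent-triple : ∀ a b d → Unique (a ∷ b ∷ d ∷ []) → adj G a b ≡ false → adj G a d ≡ false → adj G b d ≡ false →
                   (∀ w → W w ≡ true → All (λ x → adj G w x ≡ true) (a ∷ b ∷ d ∷ [])) → 2 * k + 4 ≤ 3 * # W → ⊥
    independent-triple a b d ((a≢b ∷ a≢d ∷ []) ∷ (b≢d ∷ []) ∷ [] ∷ []) nab nad nbd adjW h =
      let ms = all-memᵇ xs ; ma = all₁ ms ; mb = all₂ ms ; md = all₃ ms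
          c , p = delete-W a xs ma adja (*-cancelˡ-< 3 0 (# W) (≤-trans (s≤s z≤n) (≤-trans (m≤n+m 4 (2 * k)) h)))
          α , f , _ = free-colour c P [] small
          p₁ = proper-⊕ G c S₀ a α p (outside-∌ xs ma) λ u su e → f u (∨-introˡ (∧-intro e su))
          p₂ = proper-⊕ G (upd c a α) (S₀ ⊕ a) b α p₁ (false-⊕ S₀ a (outside-∌ xs mb) (a≢b ∘ sym)) λ u su e →
                 [ (λ s → subst (_≢ α) (sym (upd-old c a α λ { refl → true≢false s (outside-∌ xs ma) })) (f u (∨-introʳ {adj G a u ∧ S₀ u} (∨-introˡ (∧-intro e s))))) ,
                   (λ { refl → ⊥-elim (true≢false (adj-sym′ G e) nab) }) ]′ (⊕-split S₀ a su)
          p₃ = proper-⊕ G (upd (upd c a α) b α) (S₀ ⊕ a ⊕ b) d α p₂ (false-⊕ (S₀ ⊕ a) b (false-⊕ S₀ a (outside-∌ xs md) (a≢d ∘ sym)) (b≢d ∘ sym)) λ u su e →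
                 [ (λ s′ → [ (λ s → subst (_≢ α) (sym (trans (upd-old (upd c a α) b α λ { refl → true≢false s (outside-∌ xs mb) }) (upd-old c a α λ { refl → true≢false s (outside-∌ xs ma) })))
                                     (f u (∨-introʳ {adj G a u ∧ S₀ u} (∨-introʳ {adj G b u ∧ S₀ u} (∧-intro e s))))) ,
                              (λ { refl → ⊥-elim (true≢false (adj-sym′ G e) nad) }) ]′ (⊕-split S₀ a s′)) ,
                   (λ { refl → ⊥-elim (true≢false (adj-sym′ G e) nbd) }) ]′ (⊕-split (S₀ ⊕ a) b su)
          ca = trans (upd-old (upd (upd c a α) b α) d α a≢d) (trans (upd-old (upd c a α) b α a≢b) (upd-new c a α))
          cb = trans (upd-old (upd (upd c a α) b α) d α b≢d) (upd-new (upd c a α) b α)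
          cd = upd-new (upd (upd c a α) b α) d α
      in save-two (upd (upd (upd c a α) b α) d α) (S₀ ⊕ a ⊕ b ⊕ d) a b a d p₃ inW
           (λ w ww → adja w ww ∷ adjb w ww ∷ adja w ww ∷ adjd w ww ∷ [])
           (Sa ∷ ∨-introˡ (⊕-new (S₀ ⊕ a) b) ∷ Sa ∷ ⊕-new (S₀ ⊕ a ⊕ b) d ∷ [])
           a≢b a≢d a≢b a≢d b≢d (trans ca (sym cb)) (trans ca (sym cd))
      where
      xs = a ∷ b ∷ d ∷ []
      S₀ = outside xs
      adja : ∀ w → W w ≡ true → adj G w a ≡ true
      adja w ww = all₁ (adjW w ww)
      adjb : ∀ w → W w ≡ true → adj G w b ≡ true
      adjb w ww = all₂ (adjW w ww)
      adjd : ∀ w → W w ≡ true → adj G w d ≡ true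
      adjd w ww = all₃ (adjW w ww)
      Sa : (S₀ ⊕ a ⊕ b ⊕ d) a ≡ true
      Sa = ∨-introˡ (∨-introˡ (⊕-new S₀ a))
      nb : Fin n → Fin n → Bool
      nb x u = adj G x u ∧ S₀ u
      P : Fin n → Bool
      P u = nb a u ∨ (nb b u ∨ nb d u)
      bnd : ∀ x → (∀ w → W w ≡ true → adj G w x ≡ true) → # (nb x) + # W ≤ suc k
      bnd x h = nbhd-outside x (λ u → W u ∨ memᵇ xs u) W λ w ww → adj-sym′ G (h w ww) , ∨-introˡ ww
      small : # P + 0 < k
      small = lin 0 (+-mono-≤ (+-mono-≤ (+-mono-≤ (+-mono-≤ (+-mono-≤ (bnd a adja) (bnd b adjb)) (bnd d adjd))
                (#-∨ (nb a) (λ u → nb b u ∨ nb d u))) (#-∨ (nb b) (nb d))) h) (eq (# P) (# (nb a)) (# (nb b)) (# (nb d)) _ (# W) k)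
        where
        eq : ∀ p x y z yz w k → k + (x + w + (y + w) + (z + w) + p + yz + (2 * k + 4)) ≡ suc (p + 0) + (suc k + suc k + suc k + (x + yz) + (y + z) + 3 * w) + 0
        eq = solve-∀
      inW : ∀ w → (S₀ ⊕ a ⊕ b ⊕ d) w ≡ false → W w ≡ true
      inW w s = let s₂ , n₃ = ⊕-false (S₀ ⊕ a ⊕ b) d s
                    s₁ , n₂ = ⊕-false (S₀ ⊕ a) b s₂
                    s₀ , n₁ = ⊕-false S₀ a s₁
                in outside-false xs w s₀ (n₁ ∷ n₂ ∷ n₃ ∷ [])

-- Large cliques in critical graphs

#-inter : ∀ {n} (P Q R : Fin n → Bool) → (∀ i → P i ≡ true → R i ≡ true) → (∀ i → Q i ≡ true → R i ≡ true) →
          # P + # Q ≤ # (λ i → P i ∧ Q i) + # R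
#-inter P Q R p q = ≤-trans (≤-reflexive (sym (sum-+ (b2n ∘ P) (b2n ∘ Q))))
  (≤-trans (sum-mono λ i → h (p i) (q i)) (≤-reflexive (sum-+ (λ i → b2n (P i ∧ Q i)) (b2n ∘ R))))
  where
  h : ∀ {a b c} → (a ≡ true → c ≡ true) → (b ≡ true → c ≡ true) → b2n a + b2n b ≤ b2n (a ∧ b) + b2n c
  h {true}  {b}     {true}  p q = ≤-reflexive (+-comm 1 (b2n b))
  h {true}  {b}     {false} p q with () ← p refl
  h {false} p q = b2n-mono q

b2n-list : ∀ {n} (R : Fin n → Bool) xs → Unique xs → All (λ x → R x ≡ true) xs → length xs ≤ # R
b2n-list {n} R xs u r = subst (λ m → m + length xs ≤ # R) (sum-zero n) (#-list (λ _ → false) R xs u r (λ _ ()) (All.universal (λ _ → refl) xs))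

clique-deg : ∀ {n} (H : Graph n) T y → Clique H T → T y ≡ true → # T ≤ suc (deg H y)
clique-deg H T y cl ty = ≤-trans (#-remove T y) (s≤s (#-mono λ i e →
  let ti , ne = ∧-split {T i} e in cl y i ty ti (==f⇒≢ (not-true ne) ∘ sym)))

module CliqueStructure {n k : ℕ} (G : Graph n)
  (deg≤ : ∀ v → deg G v ≤ suc k)
  (noK : ∀ T → Clique G T → # T ≤ k)
  (IH : ∀ (G′ : Graph n) → (∀ u → deg G′ u ≤ deg G u) → (∃ λ u → deg G′ u < deg G u) →
        (∀ T → Clique G′ T → # T ≤ k) → Colourable G′ k)
  (nc : ¬ Colourable G k)
  (C : Fin n → Bool) (cl : Clique G C) where

  open Critical G deg≤ noK IH nc

  dC : Fin n → ℕ
  dC u = # (λ b → adj G u b ∧ C b)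

  ext : Fin n → Fin n → Bool
  ext x u = adj G x u ∧ not (C u)

  ext-count : ∀ x → C x ≡ true → # C + # (ext x) ≡ suc (deg G x)
  ext-count x cx = trans (cong (_+ # (ext x)) eq) (cong suc (sym (#-split C (adj G x))))
    where
    eq : # C ≡ suc (dC x)
    eq = ≤-antisym (≤-trans (#-remove C x) (s≤s (#-mono λ i e → let ci , ne = ∧-split {C i} e in
                     ∧-intro (cl x i cx ci (==f⇒≢ (not-true ne) ∘ sym)) ci)))
                   (subst (_≤ # C) (+-comm (dC x) 1) (#-list (λ b → adj G x b ∧ C b) C (x ∷ []) ([] ∷ []) (cx ∷ [])
                     (λ i e → ∧ʳ {adj G x i} e) (cong (_∧ C x) (adj-irrefl G x) ∷ [])))

  ext-≤ : ∀ x → C x ≡ true → # C + # (ext x) ≤ suc (suc k)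
  ext-≤ x cx = ≤-trans (≤-reflexive (ext-count x cx)) (s≤s (deg≤ x))

  C-≢ : ∀ {x y} → C x ≡ true → C y ≡ false → x ≢ y
  C-≢ cx cy refl = true≢false cx cy

  dC-pos : ∀ {u x} → C x ≡ true → adj G u x ≡ true → 1 ≤ dC u
  dC-pos {u} {x} cx a = #-pos (λ b → adj G u b ∧ C b) x (∧-intro a cx)

  Saved : (Fin n → Fin k) → (Fin n → Bool) → Fin n → List (Fin n) → Set
  Saved c S v xs = All (λ x → adj G v x ≡ true × S x ≡ true × ∃ λ u → S u ≡ true × adj G v u ≡ true × All (u ≢_) xs × c u ≡ c x) xs

  -- The rest of `C` is coloured in the order: ordinary vertices, `z₃`, `z₁`. An ordinary vertex
  -- still has two uncoloured neighbours, `z₃` has one and sees one colour twice, and `z₁` comes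
  -- last and lives on repetitions alone.
  finish-clique : ∀ (c : Fin n → Fin k) S z₁ z₃ xs y → ProperOn G S c → (∀ u → S u ≡ false → C u ≡ true) →
    S z₁ ≡ false → S z₃ ≡ false → z₁ ≢ z₃ → Unique xs → Saved c S z₁ xs → deg G z₁ < k + length xs → Saved c S z₃ (y ∷ []) → ⊥
  finish-clique c S z₁ z₃ xs y p SC s₁ s₃ ne u sv₁ d₁ ((zy , sy , w , sw , zw , w≢y ∷ [] , cwy) ∷ []) = finish c S rank p h
    where
    rank : Fin n → ℕ
    rank v = if v == z₁ then 2 else (if v == z₃ then 1 else 0)
    r₁ : rank z₁ ≡ 2
    r₁ = cong (if_then 2 else (if z₁ == z₃ then 1 else 0)) (==-refl z₁)
    r₃ : rank z₃ ≡ 1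
    r₃ = trans (cong (if_then 2 else (if z₃ == z₃ then 1 else 0)) (≢⇒== (ne ∘ sym))) (cong (if_then 1 else 0) (==-refl z₃))
    r₀ : ∀ {v} → v ≢ z₁ → v ≢ z₃ → rank v ≡ 0
    r₀ {v} a b = trans (cong (if_then 2 else (if v == z₃ then 1 else 0)) (≢⇒== a)) (cong (if_then 1 else 0) (≢⇒== b))
    S-≢ : ∀ {a b} → S a ≡ true → S b ≡ false → a ≢ b
    S-≢ sa sb refl = true≢false sa sb
    h : ∀ v → S v ≡ false → ∃ λ xs → Unique xs × Dropped G c S rank v xs × deg G v < k + length xs
    h v s with v ≟ᶠ z₁
    ... | yes refl = xs , u , All.map (λ (a , b , d) → a , inj₁ (b , d)) sv₁ , d₁
    ... | no v≢z₁ with v ≟ᶠ z₃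
    ... | yes refl = y ∷ z₁ ∷ [] , (S-≢ sy s₁ ∷ []) ∷ [] ∷ [] ,
          (zy , inj₁ (sy , w , sw , zw , w≢y ∷ S-≢ sw s₁ ∷ [] , cwy)) ∷
          (cl v z₁ (SC v s) (SC z₁ s₁) v≢z₁ , inj₂ (s₁ , subst₂ _<_ (sym r₃) (sym r₁) ≤-refl)) ∷ [] ,
          ≤-trans (s≤s (deg≤ v)) (≤-reflexive (+-comm 2 k))
    ... | no v≢z₃ = z₁ ∷ z₃ ∷ [] , (ne ∷ []) ∷ [] ∷ [] ,
          (cl v z₁ (SC v s) (SC z₁ s₁) v≢z₁ , inj₂ (s₁ , subst₂ _<_ (sym (r₀ v≢z₁ v≢z₃)) (sym r₁) (s≤s z≤n))) ∷
          (cl v z₃ (SC v s) (SC z₃ s₃) v≢z₃ , inj₂ (s₃ , subst₂ _<_ (sym (r₀ v≢z₁ v≢z₃)) (sym r₃) (s≤s z≤n))) ∷ [] ,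
          ≤-trans (s≤s (deg≤ v)) (≤-reflexive (+-comm 2 k))

  -- Joining y to the outer neighbours of x makes the colour of y available for x.
  merge : ∀ y x s → C y ≡ false → C x ≡ true → adj G x y ≡ false → 0 < deg G x →
    # (λ b → s y b ∨ s b y) + # (ext x) + 2 ≤ dC y →
    (∀ u → C u ≡ false → u ≢ y → # (λ b → s u b ∨ s b u) + b2n (ext x u) ≤ dC u) →
    (∀ T → Clique (modify G C s) T → T y ≡ false → # T ≤ k) →
    ∃ λ (c : Fin n → Fin k) → ProperOn G (not ∘ C) c × (∀ u → C u ≡ false → adj G x u ≡ true → c u ≢ c y) ×
      (∀ u v → C u ≡ false → C v ≡ false → s u v ≡ true → u ≢ v → c u ≢ c v)
  merge y x s cy cx nxy dx hy hu hK =
    let c , p , q = reduce C r x cx dx le noK′ in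
    c , p , (λ u cu e eq → q y u cy cu (∨-introʳ {s y u} (∧-intro (==-refl y) (∧-intro e (not-intro cu)))) (λ { refl → true≢false e nxy }) (sym eq)) ,
    (λ u v cu cv e → q u v cu cv (∨-introˡ e))
    where
    r : Fin n → Fin n → Bool
    r a b = s a b ∨ ((a == y) ∧ ext x b)
    nexy : ext x y ≡ false
    nexy = cong (_∧ not (C y)) nxy
    at-y : # (λ b → r y b ∨ r b y) ≤ # (λ b → s y b ∨ s b y) + # (ext x)
    at-y = #-cover (λ b → s y b ∨ s b y) (ext x) (λ b → r y b ∨ r b y) λ b e →
      [ (λ e₁ → [ (λ a → inj₁ (∨-introˡ a)) , (λ a → inj₂ (∧ʳ {y == y} a)) ]′ (∨-split {s y b} e₁)) ,
        (λ e₂ → [ (λ a → inj₁ (∨-introʳ {s y b} a)) , (λ a → ⊥-elim (true≢false (∧ʳ {b == y} a) nexy)) ]′ (∨-split {s b y} e₂)) ]′ (∨-split {r y b} e)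
    at-u : ∀ u → u ≢ y → # (λ b → r u b ∨ r b u) ≤ # (λ b → s u b ∨ s b u) + b2n (ext x u)
    at-u u ne with tf (ext x u)
    ... | inj₁ q = subst (λ m → # (λ b → r u b ∨ r b u) ≤ # (λ b → s u b ∨ s b u) + m) (trans (#-single y) (cong b2n (sym q)))
       (#-cover (λ b → s u b ∨ s b u) (_== y) (λ b → r u b ∨ r b u) λ b e →
         [ (λ e₁ → [ (λ a → inj₁ (∨-introˡ a)) , (λ a → ⊥-elim (ne (==⇒≡ (∧ˡ a)))) ]′ (∨-split {s u b} e₁)) ,
           (λ e₂ → [ (λ a → inj₁ (∨-introʳ {s u b} a)) , (λ a → inj₂ (∧ˡ a)) ]′ (∨-split {s b u} e₂)) ]′ (∨-split {r u b} e))
    ... | inj₂ q = ≤-trans (#-mono {P = λ b → r u b ∨ r b u} {λ b → s u b ∨ s b u} λ b e →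
         [ (λ e₁ → [ (λ a → ∨-introˡ a) , (λ a → ⊥-elim (ne (==⇒≡ (∧ˡ a)))) ]′ (∨-split {s u b} e₁)) ,
           (λ e₂ → [ (λ a → ∨-introʳ {s u b} a) , (λ a → ⊥-elim (true≢false (∧ʳ {b == y} a) q)) ]′ (∨-split {s b u} e₂)) ]′ (∨-split {r u b} e)) (m≤m+n _ _)
    hy′ : # (λ b → r y b ∨ r b y) + 2 ≤ dC y
    hy′ = ≤-trans (+-monoˡ-≤ 2 at-y) hy
    le : ∀ u → C u ≡ false → # (λ b → r u b ∨ r b u) ≤ dC u
    le u cu with u ≟ᶠ y
    ... | yes refl = ≤-trans (m≤m+n _ 2) hy′
    ... | no ne = ≤-trans (at-u u ne) (hu u cu ne)
    noK′ : ∀ T → Clique (modify G C r) T → # T ≤ k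
    noK′ T clT with tf (T y)
    -- The summand 2 in `hy` is spent here: `y` ends with degree at most k - 1, so a clique through
    -- `y` has at most k vertices.
    ... | inj₁ ty = ≤-trans (clique-deg (modify G C r) T y clT ty)
                      (≤-pred (≤-trans (≤-reflexive (+-comm 2 _)) (≤-trans (modify-deg G C r 2 y cy hy′) (deg≤ y))))
    ... | inj₂ ny = hK T (λ u v tu tv ne → conv tu tv ne (modify-elim G C r (clT u v tu tv ne))) ny
      where
      T-≢ : ∀ {u} → T u ≡ true → u ≢ y
      T-≢ tu refl = true≢false tu ny
      conv : ∀ {u v} → T u ≡ true → T v ≡ true → u ≢ v → C u ≡ false × C v ≡ false × (adj G u v ≡ true ⊎ (r u v ∨ r v u) ≡ true) → adj (modify G C s) u v ≡ true
      conv tu tv ne (cu , cv , inj₁ e) = modify-old G C s cu cv e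
      conv {u} {v} tu tv ne (cu , cv , inj₂ e) with ∨-split {r u v} e
      ... | inj₁ e₁ = [ (λ a → modify-new G C s cu cv a ne) , (λ a → ⊥-elim (T-≢ tu (==⇒≡ (∧ˡ a)))) ]′ (∨-split {s u v} e₁)
      ... | inj₂ e₂ = [ (λ a → adj-sym′ (modify G C s) (modify-new G C s cv cu a (ne ∘ sym))) , (λ a → ⊥-elim (T-≢ tv (==⇒≡ (∧ˡ a)))) ]′ (∨-split {s v u} e₂)

  S₁ : Fin n → Fin n → Bool
  S₁ x = (not ∘ C) ⊕ x

  S₁-C : ∀ x u → S₁ x u ≡ false → C u ≡ true
  S₁-C x u s with C u | proj₁ (⊕-false (not ∘ C) x s)
  ... | true | _ = refl

  S₁-out : ∀ x {u} → C u ≡ false → S₁ x u ≡ true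
  S₁-out x cu = ∨-introˡ (not-intro cu)

  S₁-in : ∀ x {u} → C u ≡ true → u ≢ x → S₁ x u ≡ false
  S₁-in x cu ne = false-⊕ (not ∘ C) x (cong not cu) ne

  proper-S₁ : ∀ (c : Fin n → Fin k) x y → ProperOn G (not ∘ C) c → C x ≡ true → (∀ u → C u ≡ false → adj G x u ≡ true → c u ≢ c y) →
              ProperOn G (S₁ x) (upd c x (c y))
  proper-S₁ c x y p cx h = proper-⊕ G c (not ∘ C) x (c y) p (cong not cx) λ u su e → h u (not-true su) e

  saved-by : ∀ (c : Fin n → Fin k) S z y x → adj G z y ≡ true → S y ≡ true → S x ≡ true → adj G z x ≡ true → x ≢ y → c x ≡ c y → Saved c S z (y ∷ [])
  saved-by c S z y x a sy sx b ne e = (a , sy , x , sx , b , ne ∷ [] , e) ∷ []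

  -- With |C| = k - s, heavy means at least s + 5 neighbours in `C`, while a vertex of `C` has at
  -- most s + 2 outer neighbours. So in `merge` a heavy `y` loses at least three edges more than it
  -- gains.
  heavy-ext : ∀ x y → C x ≡ true → k + 5 ≤ dC y + # C → # (ext x) + 3 ≤ dC y
  heavy-ext x y cx h = lin 0 (+-mono-≤ (ext-≤ x cx) h) (eq (# (ext x)) (dC y) (# C) k)
    where
    eq : ∀ e d c k → d + (c + e + (k + 5)) ≡ e + 3 + (suc (suc k) + (d + c)) + 0
    eq = solve-∀

  -- Once `x` has the colour of `y`, every neighbour of `y` in `C` sees that colour twice. For a
  -- vertex of degree at most k this single repetition is enough.
  heavy-nbr-degree : ∀ y x z₁ → C y ≡ false → C x ≡ true → adj G x y ≡ false → k + 5 ≤ dC y + # C →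
    C z₁ ≡ true → adj G y z₁ ≡ true → ¬ deg G z₁ ≤ k
  heavy-nbr-degree y x z₁ cy cx nxy h cz yz dz =
    let c , p , q , _ = merge y x (λ _ _ → false) cy cx nxy (#-pos (adj G x) z₁ xz)
                          (subst (λ m → m + # (ext x) + 2 ≤ dC y) (sym (sum-zero n)) (≤-trans (+-monoʳ-≤ (# (ext x)) (s≤s (s≤s z≤n))) hx))
                          (λ u cu ne → subst (λ m → m + b2n (ext x u) ≤ dC u) (sym (sum-zero n)) (one u))
                          (λ T clT _ → noK T λ u v tu tv ne → old (modify-elim G C (λ _ _ → false) (clT u v tu tv ne)))
        z₃ , e₃ , a₃ = #-pick (λ b → adj G y b ∧ C b) (z₁ ∷ []) (≤-trans (≤-trans (s≤s (s≤s z≤n)) (m≤n+m 3 _)) hx)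
        yz₃ , cz₃ = ∧-split {adj G y z₃} e₃
        x≢z₃ = differ (λ u → adj G u y) (adj-sym′ G yz₃) nxy ∘ sym
        eq = trans (upd-new c x (c y)) (sym (upd-old c x (c y) (C-≢ cx cy ∘ sym)))
    in finish-clique (upd c x (c y)) (S₁ x) z₁ z₃ (y ∷ []) y (proper-S₁ c x y p cx q) (S₁-C x)
         (S₁-in x cz (x≢z₁ ∘ sym)) (S₁-in x cz₃ (x≢z₃ ∘ sym)) (all₁ a₃ ∘ sym) ([] ∷ [])
         (saved-by (upd c x (c y)) (S₁ x) z₁ y x (adj-sym′ G yz) (S₁-out x cy) (⊕-new (not ∘ C) x) (adj-sym′ G xz) (C-≢ cx cy) eq)
         (≤-trans (s≤s dz) (≤-reflexive (+-comm 1 k)))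
         (saved-by (upd c x (c y)) (S₁ x) z₃ y x (adj-sym′ G yz₃) (S₁-out x cy) (⊕-new (not ∘ C) x) (cl z₃ x cz₃ cx (x≢z₃ ∘ sym)) (C-≢ cx cy) eq)
    where
    x≢z₁ : x ≢ z₁
    x≢z₁ refl = true≢false (adj-sym′ G yz) nxy
    xz : adj G x z₁ ≡ true
    xz = cl x z₁ cx cz x≢z₁
    hx = heavy-ext x y cx h
    one : ∀ u → b2n (ext x u) ≤ dC u
    one u with tf (ext x u)
    ... | inj₁ q = ≤-trans (b2n≤1 _) (dC-pos cx (adj-sym′ G (∧ˡ q)))
    ... | inj₂ q = subst (λ b → b2n b ≤ dC u) (sym q) z≤n
    old : ∀ {u v} → C u ≡ false × C v ≡ false × (adj G u v ≡ true ⊎ false ≡ true) → adj G u v ≡ true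
    old (_ , _ , inj₁ x) = x

  -- Pays for the new edges at an outer vertex: each gain comes with its own neighbour in `C`, and
  -- the edge to that neighbour is deleted.
  two-in-C : ∀ u x x′ → C x ≡ true → C x′ ≡ true → x ≢ x′ → b2n (adj G x u) + b2n (adj G x′ u) ≤ dC u
  two-in-C u x x′ cx cx′ ne with tf (adj G x u) | tf (adj G x′ u)
  ... | inj₁ e | inj₁ e′ = ≤-trans (+-mono-≤ (b2n≤1 (adj G x u)) (b2n≤1 (adj G x′ u)))
        (b2n-list (λ b → adj G u b ∧ C b) (x ∷ x′ ∷ []) ((ne ∷ []) ∷ [] ∷ []) (∧-intro (adj-sym′ G e) cx ∷ ∧-intro (adj-sym′ G e′) cx′ ∷ []))
  ... | inj₁ e | inj₂ f = subst (λ b → b2n (adj G x u) + b2n b ≤ dC u) (sym f) (≤-trans (≤-reflexive (+-identityʳ _)) (≤-trans (b2n≤1 _) (dC-pos cx (adj-sym′ G e))))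
  ... | inj₂ f | inj₁ e = subst (λ b → b2n b + b2n (adj G x′ u) ≤ dC u) (sym f) (≤-trans (b2n≤1 _) (dC-pos cx′ (adj-sym′ G e)))
  ... | inj₂ f | inj₂ f′ = subst₂ (λ a b → b2n a + b2n b ≤ dC u) (sym f) (sym f′) z≤n

  ext≤adj : ∀ x u → b2n (ext x u) ≤ b2n (adj G x u)
  ext≤adj x u = b2n-mono {ext x u} (λ e → ∧ˡ e)

  -- Two merges at once: `x` takes the colour of `y` and `x′` that of `y′`, so the common neighbour
  -- `z₁` sees two repetitions and can be coloured last.
  two-heavy : ∀ y y′ x x′ z₁ → C y ≡ false → C y′ ≡ false → y ≢ y′ → C x ≡ true → C x′ ≡ true → x ≢ x′ →
    adj G x y ≡ false → adj G x′ y′ ≡ false → k + 5 ≤ dC y + # C → k + 5 ≤ dC y′ + # C →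
    C z₁ ≡ true → adj G y z₁ ≡ true → adj G y′ z₁ ≡ true → ⊥
  two-heavy y y′ x x′ z₁ cy cy′ y≢y′ cx cx′ x≢x′ nxy nxy′ h h′ cz yz yz′ =
    let c , p , q , r = merge y x s cy cx nxy (#-pos (adj G x) z₁ xz) at-y at-u noK-s
        z₃ , e₃ , a₃ = #-pick (λ b → adj G y b ∧ C b) (z₁ ∷ x′ ∷ []) (≤-trans (m≤n+m 3 _) hx)
        yz₃ , cz₃ = ∧-split {adj G y z₃} e₃
        z₃≢x = differ (λ u → adj G u y) (adj-sym′ G yz₃) nxy
        c₁ = upd c x (c y)
        c₂ = upd c₁ x′ (c y′)
        p₁ = proper-S₁ c x y p cx q
        p₂ = proper-⊕ G c₁ (S₁ x) x′ (c y′) p₁ (S₁-in x cx′ (x≢x′ ∘ sym)) λ u su e →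
               [ (λ su′ eq → r y′ u cy′ (not-true su′)
                     (∧-intro (==-refl y′) (∨-introˡ (∧-intro e su′)))
                     (differ (adj G x′) e nxy′ ∘ sym)
                     (sym (trans (sym (upd-old c x (c y) (C-≢ cx (not-true su′) ∘ sym))) eq))) ,
                 (λ u≡x eq → r y′ y cy′ cy (∧-intro (==-refl y′) (∨-introʳ {ext x′ y} (==-refl y))) (y≢y′ ∘ sym)
                     (sym (trans (sym (upd-new c x (c y))) (trans (cong c₁ (sym u≡x)) eq)))) ]′ (⊕-split (not ∘ C) x su)
        c₂x = trans (upd-old c₁ x′ (c y′) x≢x′) (upd-new c x (c y))
        c₂y = trans (upd-old c₁ x′ (c y′) (C-≢ cx′ cy ∘ sym)) (upd-old c x (c y) (C-≢ cx cy ∘ sym))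
        c₂y′ = trans (upd-old c₁ x′ (c y′) (C-≢ cx′ cy′ ∘ sym)) (upd-old c x (c y) (C-≢ cx cy′ ∘ sym))
        Sx = ∨-introˡ {S₁ x x} {x == x′} (⊕-new (not ∘ C) x)
        Sy = ∨-introˡ {S₁ x y} {y == x′} (S₁-out x cy)
    in finish-clique c₂ (S₁ x ⊕ x′) z₁ z₃ (y ∷ y′ ∷ []) y p₂
         (λ u su → S₁-C x u (proj₁ (⊕-false (S₁ x) x′ su)))
         (false-⊕ (S₁ x) x′ (S₁-in x cz z₁≢x) z₁≢x′)
         (false-⊕ (S₁ x) x′ (S₁-in x cz₃ z₃≢x) (all₂ a₃)) (all₁ a₃ ∘ sym) ((y≢y′ ∷ []) ∷ [] ∷ [])
         ((adj-sym′ G yz , Sy , x , Sx , adj-sym′ G xz , C-≢ cx cy ∷ C-≢ cx cy′ ∷ [] , trans c₂x (sym c₂y)) ∷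
          (adj-sym′ G yz′ , ∨-introˡ {S₁ x y′} {y′ == x′} (S₁-out x cy′) , x′ , ⊕-new (S₁ x) x′ , cl z₁ x′ cz cx′ z₁≢x′ ,
             C-≢ cx′ cy ∷ C-≢ cx′ cy′ ∷ [] , trans (upd-new c₁ x′ (c y′)) (sym c₂y′)) ∷ [])
         (≤-trans (s≤s (deg≤ z₁)) (≤-reflexive (+-comm 2 k)))
         (saved-by c₂ (S₁ x ⊕ x′) z₃ y x (adj-sym′ G yz₃) Sy Sx (cl z₃ x cz₃ cx z₃≢x) (C-≢ cx cy) (trans c₂x (sym c₂y)))
    where
    -- Besides performing the second merge, `s` joins `y′` to `y`: their colours go to the adjacent
    -- vertices `x` and `x′` and have to differ.
    s : Fin n → Fin n → Bool
    s a b = (a == y′) ∧ (ext x′ b ∨ (b == y))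
    z₁≢x : z₁ ≢ x
    z₁≢x = differ (λ u → adj G u y) (adj-sym′ G yz) nxy
    z₁≢x′ : z₁ ≢ x′
    z₁≢x′ = differ (λ u → adj G u y′) (adj-sym′ G yz′) nxy′
    xz : adj G x z₁ ≡ true
    xz = cl x z₁ cx cz (z₁≢x ∘ sym)
    hx = heavy-ext x y cx h
    hx′ = heavy-ext x′ y′ cx′ h′
    at-y : # (λ b → s y b ∨ s b y) + # (ext x) + 2 ≤ dC y
    at-y = ≤-trans (+-monoˡ-≤ 2 (+-monoˡ-≤ (# (ext x)) le)) (≤-trans (≤-reflexive (eq (# (ext x)))) hx)
      where
      le : # (λ b → s y b ∨ s b y) ≤ 1
      le = subst (# (λ b → s y b ∨ s b y) ≤_) (#-single y′) (#-mono λ b e →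
             [ (λ a → ⊥-elim (y≢y′ (==⇒≡ (∧ˡ a)))) , (λ a → ∧ˡ a) ]′ (∨-split {s y b} e))
      eq : ∀ a → 1 + a + 2 ≡ a + 3
      eq = solve-∀
    s-y′ : # (λ b → s y′ b ∨ s b y′) ≤ # (ext x′) + 1
    s-y′ = subst (λ m → # (λ b → s y′ b ∨ s b y′) ≤ # (ext x′) + m) (#-single y) (#-cover (ext x′) (_== y) (λ b → s y′ b ∨ s b y′) λ b e →
             [ (λ a → ∨-split {ext x′ b} (∧ʳ {y′ == y′} a)) ,
               (λ a → [ (λ w → ⊥-elim (true≢false (∧ˡ w) nxy′)) , (λ w → ⊥-elim (y≢y′ (sym (==⇒≡ w)))) ]′
                        (∨-split {ext x′ y′} (∧ʳ {b == y′} a))) ]′ (∨-split {s y′ b} e))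
    at-u : ∀ u → C u ≡ false → u ≢ y → # (λ b → s u b ∨ s b u) + b2n (ext x u) ≤ dC u
    at-u u cu u≢y with u ≟ᶠ y′
    ... | yes refl = ≤-trans (+-mono-≤ s-y′ (b2n≤1 _)) (≤-trans (≤-reflexive (+-assoc (# (ext x′)) 1 1)) (≤-trans (+-monoʳ-≤ (# (ext x′)) (s≤s (s≤s z≤n))) hx′))
    ... | no u≢y′ = ≤-trans (+-mono-≤ le (ext≤adj x u)) (≤-trans (≤-reflexive (+-comm (b2n (adj G x′ u)) _)) (two-in-C u x x′ cx cx′ x≢x′))
      where
      hit : ∀ b → (s u b ∨ s b u) ≡ true → b ≡ y′ × adj G x′ u ≡ true
      hit b e = [ (λ a → ⊥-elim (u≢y′ (==⇒≡ (∧ˡ a)))) ,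
                  (λ a → ==⇒≡ (∧ˡ a) , [ (λ w → ∧ˡ w) , (λ w → ⊥-elim (u≢y (==⇒≡ w))) ]′ (∨-split {ext x′ u} (∧ʳ {b == y′} a))) ]′ (∨-split {s u b} e)
      le : # (λ b → s u b ∨ s b u) ≤ b2n (adj G x′ u)
      le with tf (adj G x′ u)
      ... | inj₁ t = subst (# (λ b → s u b ∨ s b u) ≤_) (trans (#-single y′) (cong b2n (sym t)))
                       (#-mono λ b e → subst (λ w → (w == y′) ≡ true) (sym (proj₁ (hit b e))) (==-refl y′))
      ... | inj₂ f = ≤-trans (≤-reflexive (#-none {P = λ b → s u b ∨ s b u} λ b → ≢true λ e → true≢false (proj₂ (hit b e)) f)) z≤n
    noK-s : ∀ T → Clique (modify G C s) T → T y ≡ false → # T ≤ k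
    noK-s T clT ny with tf (T y′)
    ... | inj₁ ty = ≤-trans (clique-deg (modify G C s) T y′ clT ty)
                      (≤-pred (≤-trans (≤-reflexive (+-comm 2 _)) (≤-trans (modify-deg G C s 2 y′ cy′
                        (≤-trans (+-monoˡ-≤ 2 s-y′) (≤-trans (≤-reflexive (+-assoc (# (ext x′)) 1 2)) hx′))) (deg≤ y′))))
    ... | inj₂ ny′ = noK T λ u v tu tv ne → conv tu tv (modify-elim G C s (clT u v tu tv ne))
      where
      conv : ∀ {u v} → T u ≡ true → T v ≡ true → C u ≡ false × C v ≡ false × (adj G u v ≡ true ⊎ (s u v ∨ s v u) ≡ true) → adj G u v ≡ true
      conv tu tv (_ , _ , inj₁ e) = e
      conv {u} {v} tu tv (_ , _ , inj₂ e) = ⊥-elim ([ (λ a → differ T tu ny′ (==⇒≡ (∧ˡ a))) , (λ a → differ T tv ny′ (==⇒≡ (∧ˡ a))) ]′ (∨-split {s u v} e))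

  -- If l₁ and y get the same colour, then z₁ sees it three times; otherwise z₂ can take the colour of l₁.
  -- In both cases z₁ saves two colours.
  split-lights : ∀ y x z₁ z₂ l₁ l₂ → C y ≡ false → C x ≡ true → adj G x y ≡ false → k + 5 ≤ dC y + # C →
    C z₁ ≡ true → C z₂ ≡ true → z₁ ≢ z₂ → adj G y z₁ ≡ true → adj G y z₂ ≡ true →
    C l₁ ≡ false → C l₂ ≡ false → l₁ ≢ y → l₂ ≢ y → l₁ ≢ l₂ → adj G z₁ l₁ ≡ true → adj G z₂ l₂ ≡ true →
    (∀ u → ext z₂ u ≡ true → u ≡ y ⊎ u ≡ l₂) →
    ¬ (∀ T → Clique (modify G C (λ a b → (a == l₁) ∧ (b == l₂))) T → # T ≤ k)
  split-lights y x z₁ z₂ l₁ l₂ cy cx nxy h cz₁ cz₂ z₁≢z₂ yz₁ yz₂ cl₁ cl₂ l₁≢y l₂≢y l₁≢l₂ zl₁ zl₂ only hK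
    with merge y x s cy cx nxy (#-pos (adj G x) z₁ (cl x z₁ cx cz₁ (z₁≢x ∘ sym))) at-y at-u (λ T clT _ → hK T clT)
    where
    -- The edge makes the colours of `l₁` and `l₂` differ. As `z₂` has no outer neighbours but `y`
    -- and `l₂`, the colour of `l₁` is then free at `z₂` unless `y` has it.
    s : Fin n → Fin n → Bool
    s a b = (a == l₁) ∧ (b == l₂)
    z₁≢x : z₁ ≢ x
    z₁≢x = differ (λ u → adj G u y) (adj-sym′ G yz₁) nxy
    z₂≢x : z₂ ≢ x
    z₂≢x = differ (λ u → adj G u y) (adj-sym′ G yz₂) nxy
    hx = heavy-ext x y cx h
    none : ∀ u → u ≢ l₁ → u ≢ l₂ → # (λ b → s u b ∨ s b u) ≡ 0
    none u n₁ n₂ = #-none {P = λ b → s u b ∨ s b u} λ b → ≢true λ e →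
      [ (λ a → n₁ (==⇒≡ (∧ˡ a))) , (λ a → n₂ (==⇒≡ (∧ʳ {b == l₁} a))) ]′ (∨-split {s u b} e)
    at-y : # (λ b → s y b ∨ s b y) + # (ext x) + 2 ≤ dC y
    at-y = subst (λ m → m + # (ext x) + 2 ≤ dC y) (sym (none y (l₁≢y ∘ sym) (l₂≢y ∘ sym))) (≤-trans (+-monoʳ-≤ (# (ext x)) (s≤s (s≤s z≤n))) hx)
    le₁ : # (λ b → s l₁ b ∨ s b l₁) ≤ 1
    le₁ = subst (# (λ b → s l₁ b ∨ s b l₁) ≤_) (#-single l₂) (#-mono λ b e →
            [ (λ a → ∧ʳ {l₁ == l₁} a) , (λ a → ⊥-elim (l₁≢l₂ (==⇒≡ (∧ʳ {b == l₁} a)))) ]′ (∨-split {s l₁ b} e))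
    le₂ : # (λ b → s l₂ b ∨ s b l₂) ≤ 1
    le₂ = subst (# (λ b → s l₂ b ∨ s b l₂) ≤_) (#-single l₁) (#-mono λ b e →
            [ (λ a → ⊥-elim (l₁≢l₂ (sym (==⇒≡ (∧ˡ a))))) , (λ a → ∧ˡ a) ]′ (∨-split {s l₂ b} e))
    with-z : ∀ u z → C z ≡ true → z ≢ x → adj G z u ≡ true → # (λ b → s u b ∨ s b u) ≤ 1 → # (λ b → s u b ∨ s b u) + b2n (ext x u) ≤ dC u
    with-z u z cz ne zu le = ≤-trans (+-mono-≤ (≤-trans le (≤-reflexive (cong b2n (sym zu)))) (ext≤adj x u)) (two-in-C u z x cz cx ne)
    at-u : ∀ u → C u ≡ false → u ≢ y → # (λ b → s u b ∨ s b u) + b2n (ext x u) ≤ dC u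
    at-u u cu u≢y with u ≟ᶠ l₁
    ... | yes refl = with-z u z₁ cz₁ z₁≢x zl₁ le₁
    ... | no u≢l₁ with u ≟ᶠ l₂
    ... | yes refl = with-z u z₂ cz₂ z₂≢x zl₂ le₂
    ... | no u≢l₂ = subst (λ m → m + b2n (ext x u) ≤ dC u) (sym (none u u≢l₁ u≢l₂)) (≤-trans (ext≤adj x u) (≤-trans (m≤m+n _ _) (two-in-C u x z₁ cx cz₁ (z₁≢x ∘ sym))))
  ... | c , p , q , r with c l₁ ≟ᶠ c y
  ...   | yes same = finish-clique c₁ (S₁ x) z₁ z₂ (y ∷ l₁ ∷ []) y p₁ (S₁-C x) (S₁-in x cz₁ z₁≢x) (S₁-in x cz₂ z₂≢x) z₁≢z₂ ((l₁≢y ∘ sym ∷ []) ∷ [] ∷ [])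
           ((adj-sym′ G yz₁ , S₁-out x cy , x , Sx , z₁x , C-≢ cx cy ∷ C-≢ cx cl₁ ∷ [] , xy) ∷
            (zl₁ , S₁-out x cl₁ , x , Sx , z₁x , C-≢ cx cy ∷ C-≢ cx cl₁ ∷ [] , trans xy (trans (c₁-out cy) (trans (sym same) (sym (c₁-out cl₁))))) ∷ [])
           (≤-trans (s≤s (deg≤ z₁)) (≤-reflexive (+-comm 2 k)))
           (saved-by c₁ (S₁ x) z₂ y x (adj-sym′ G yz₂) (S₁-out x cy) Sx (cl z₂ x cz₂ cx z₂≢x) (C-≢ cx cy) xy)
    where
    c₁ = upd c x (c y)
    p₁ = proper-S₁ c x y p cx q
    z₁≢x = differ (λ u → adj G u y) (adj-sym′ G yz₁) nxy
    z₂≢x = differ (λ u → adj G u y) (adj-sym′ G yz₂) nxy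
    z₁x = cl z₁ x cz₁ cx z₁≢x
    Sx = ⊕-new (not ∘ C) x
    c₁-out : ∀ {u} → C u ≡ false → c₁ u ≡ c u
    c₁-out cu = upd-old c x (c y) (C-≢ cx cu ∘ sym)
    xy = trans (upd-new c x (c y)) (sym (c₁-out cy))
  ...   | no other =
    let z₃ , e₃ , a₃ = #-pick (λ b → adj G y b ∧ C b) (z₁ ∷ z₂ ∷ []) (≤-trans (m≤n+m 3 _) (heavy-ext x y cx h))
        yz₃ , cz₃ = ∧-split {adj G y z₃} e₃
        z₃≢x = differ (λ u → adj G u y) (adj-sym′ G yz₃) nxy
    in finish-clique c₂ (S₁ x ⊕ z₂) z₁ z₃ (y ∷ l₁ ∷ []) y p₂ (λ u su → S₁-C x u (proj₁ (⊕-false (S₁ x) z₂ su)))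
         (false-⊕ (S₁ x) z₂ (S₁-in x cz₁ z₁≢x) z₁≢z₂) (false-⊕ (S₁ x) z₂ (S₁-in x cz₃ z₃≢x) (all₂ a₃)) (all₁ a₃ ∘ sym) ((l₁≢y ∘ sym ∷ []) ∷ [] ∷ [])
         ((adj-sym′ G yz₁ , S-out cy , x , Sx , cl z₁ x cz₁ cx z₁≢x , C-≢ cx cy ∷ C-≢ cx cl₁ ∷ [] , xy) ∷
          (zl₁ , S-out cl₁ , z₂ , ⊕-new (S₁ x) z₂ , cl z₁ z₂ cz₁ cz₂ z₁≢z₂ , C-≢ cz₂ cy ∷ C-≢ cz₂ cl₁ ∷ [] , trans (upd-new c₁ z₂ (c l₁)) (sym (c₂-out cl₁))) ∷ [])
         (≤-trans (s≤s (deg≤ z₁)) (≤-reflexive (+-comm 2 k)))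
         (saved-by c₂ (S₁ x ⊕ z₂) z₃ y x (adj-sym′ G yz₃) (S-out cy) Sx (cl z₃ x cz₃ cx z₃≢x) (C-≢ cx cy) xy)
    where
    c₁ = upd c x (c y)
    c₂ = upd c₁ z₂ (c l₁)
    z₁≢x = differ (λ u → adj G u y) (adj-sym′ G yz₁) nxy
    z₂≢x = differ (λ u → adj G u y) (adj-sym′ G yz₂) nxy
    c₁-out : ∀ {u} → C u ≡ false → c₁ u ≡ c u
    c₁-out cu = upd-old c x (c y) (C-≢ cx cu ∘ sym)
    c₂-out : ∀ {u} → C u ≡ false → c₂ u ≡ c u
    c₂-out cu = trans (upd-old c₁ z₂ (c l₁) (C-≢ cz₂ cu ∘ sym)) (c₁-out cu)
    Sx : (S₁ x ⊕ z₂) x ≡ true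
    Sx = ∨-introˡ (⊕-new (not ∘ C) x)
    S-out : ∀ {u} → C u ≡ false → (S₁ x ⊕ z₂) u ≡ true
    S-out cu = ∨-introˡ (S₁-out x cu)
    xy : c₂ x ≡ c₂ y
    xy = trans (trans (upd-old c₁ z₂ (c l₁) (z₂≢x ∘ sym)) (upd-new c x (c y))) (sym (c₂-out cy))
    p₂ : ProperOn G (S₁ x ⊕ z₂) c₂
    p₂ = proper-⊕ G c₁ (S₁ x) z₂ (c l₁) (proper-S₁ c x y p cx q) (S₁-in x cz₂ z₂≢x) λ u su e →
      [ (λ su′ eq → [ (λ { refl → other (sym (trans (sym (c₁-out cy)) eq)) }) ,
                      (λ { refl → r l₁ u cl₁ cl₂ (∧-intro (==-refl l₁) (==-refl u)) l₁≢l₂ (sym (trans (sym (c₁-out cl₂)) eq)) }) ]′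
                    (only u (∧-intro e su′))) ,
        (λ u≡x eq → other (sym (trans (sym (upd-new c x (c y))) (trans (cong c₁ (sym u≡x)) eq)))) ]′ (⊕-split (not ∘ C) x su)

  module Maximal (C₀ : Fin n → Bool)
    (maximal : ∀ T → Clique G T → (∃ λ u → T u ≡ true × C₀ u ≡ true) → # T ≤ # C)
    (meet : 2 ≤ # (λ u → C u ∧ C₀ u)) (big : 2 * k + 7 ≤ 3 * # C) (13≤k : 13 ≤ k) where

    -- `C` is largest only among the cliques that meet `C₀`, so an exchange of a vertex has to leave
    -- some vertex of `C₀` in place. Two common vertices ensure this.
    meet-avoiding : ∀ x → ∃ λ u → C u ≡ true × C₀ u ≡ true × u ≢ x
    meet-avoiding x = let u , e , a = #-pick (λ u → C u ∧ C₀ u) (x ∷ []) meet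
                          cu , c₀u = ∧-split e in u , cu , c₀u , all₁ a

    nonneighbour : ∀ y → C y ≡ false → ∃ λ x → C x ≡ true × adj G x y ≡ false
    nonneighbour y cy with any? (λ x → (C x ∧ not (adj G x y)) ≟ᵇ true)
    ... | yes (x , e) = x , ∧ˡ e , not-true (∧ʳ {C x} e)
    ... | no none = ⊥-elim (<⇒≱ (subst (_≤ # (C ⊕ y)) (+-comm (# C) 1) (#-list C (C ⊕ y) (y ∷ []) ([] ∷ []) (⊕-new C y ∷ []) (λ i → ∨-introˡ) (cy ∷ [])))
            (maximal (C ⊕ y) clique (let u , cu , c₀u , _ = meet-avoiding y in u , ∨-introˡ cu , c₀u)))
      where
      all : ∀ x → C x ≡ true → adj G x y ≡ true
      all x cx with tf (adj G x y)
      ... | inj₁ t = t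
      ... | inj₂ f = ⊥-elim (none (x , ∧-intro cx (not-intro f)))
      clique : Clique G (C ⊕ y)
      clique u v tu tv ne with ⊕-split C y tu | ⊕-split C y tv
      ... | inj₁ cu | inj₁ cv = cl u v cu cv ne
      ... | inj₁ cu | inj₂ refl = all u cu
      ... | inj₂ refl | inj₁ cv = adj-sym′ G (all v cv)
      ... | inj₂ refl | inj₂ refl = ⊥-elim (ne refl)

    -- `two-heavy` applies unless both vertices miss the same single `x` of `C`. In that case, if
    -- `y` and `y′` are adjacent, exchanging `x` for both enlarges `C`; if not, `x`, `y`, `y′` are
    -- independent with the rest of `C` as common neighbours.
    heavies-apart : ∀ y y′ z → C y ≡ false → C y′ ≡ false → y ≢ y′ → k + 5 ≤ dC y + # C → k + 5 ≤ dC y′ + # C →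
      C z ≡ true → adj G y z ≡ true → adj G y′ z ≡ true → ⊥
    heavies-apart y y′ z cy cy′ ne h h′ cz yz yz′ with nonneighbour y cy | nonneighbour y′ cy′
    ... | x , cx , nx | x′ , cx′ , nx′ with x ≟ᶠ x′
    ... | no x≢x′ = two-heavy y y′ x x′ z cy cy′ ne cx cx′ x≢x′ nx nx′ h h′ cz yz yz′
    ... | yes refl with any? (λ w → (C w ∧ not (adj G w y) ∧ not (w == x)) ≟ᵇ true)
    ... | yes (w , e) = let cw , e′ = ∧-split e ; nw , w≢x = ∧-split e′ in
            two-heavy y y′ w x z cy cy′ ne cw cx (==f⇒≢ (not-true w≢x)) (not-true nw) nx′ h h′ cz yz yz′
    ... | no only with any? (λ w → (C w ∧ not (adj G w y′) ∧ not (w == x)) ≟ᵇ true)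
    ... | yes (w , e) = let cw , e′ = ∧-split e ; nw , w≢x = ∧-split e′ in
            two-heavy y y′ x w z cy cy′ ne cx cw (==f⇒≢ (not-true w≢x) ∘ sym) nx (not-true nw) h h′ cz yz yz′
    ... | no only′ = [ swap , triple ]′ (tf (adj G y y′))
      where
      C₁ : Fin n → Bool
      C₁ u = C u ∧ not (u == x)
      full : ∀ {v} → ¬ (∃ λ w → (C w ∧ not (adj G w v) ∧ not (w == x)) ≡ true) → ∀ u → C₁ u ≡ true → adj G u v ≡ true
      full {v} o u e with tf (adj G u v)
      ... | inj₁ t = t
      ... | inj₂ f = let cu , u≢ = ∧-split {C u} e in ⊥-elim (o (u , ∧-intro cu (∧-intro (not-intro f) u≢)))
      C₁-C : ∀ {u} → C₁ u ≡ true → C u ≡ true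
      C₁-C e = ∧ˡ e
      swap : adj G y y′ ≡ true → ⊥
      swap yy = <⇒≱ (≤-trans (s≤s (#-remove C x)) (subst (_≤ # T) (+-comm (# C₁) 2) (#-list C₁ T (y ∷ y′ ∷ []) ((ne ∷ []) ∷ [] ∷ [])
                  (∨-introˡ (⊕-new C₁ y) ∷ ⊕-new (C₁ ⊕ y) y′ ∷ []) (λ i e → ∨-introˡ (∨-introˡ e)) (cong (_∧ not (y == x)) cy ∷ cong (_∧ not (y′ == x)) cy′ ∷ []))))
                (maximal T clique (let u , cu , c₀u , u≢x = meet-avoiding x in u , ∨-introˡ (∨-introˡ (∧-intro cu (not-intro (≢⇒== u≢x)))) , c₀u))
        where
        T = C₁ ⊕ y ⊕ y′
        clique : Clique G T
        clique u v tu tv u≢v with ⊕-split (C₁ ⊕ y) y′ tu | ⊕-split (C₁ ⊕ y) y′ tv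
        ... | inj₂ refl | inj₂ refl = ⊥-elim (u≢v refl)
        clique u v tu tv u≢v | inj₁ a | inj₂ refl with ⊕-split C₁ y a
        ... | inj₁ e = full only′ u e
        ... | inj₂ refl = yy
        clique u v tu tv u≢v | inj₂ refl | inj₁ b with ⊕-split C₁ y b
        ... | inj₁ e = adj-sym′ G (full only′ v e)
        ... | inj₂ refl = adj-sym′ G yy
        clique u v tu tv u≢v | inj₁ a | inj₁ b with ⊕-split C₁ y a | ⊕-split C₁ y b
        ... | inj₁ e | inj₁ e′ = cl u v (C₁-C e) (C₁-C e′) u≢v
        ... | inj₁ e | inj₂ refl = full only u e
        ... | inj₂ refl | inj₁ e = adj-sym′ G (full only v e)
        ... | inj₂ refl | inj₂ refl = ⊥-elim (u≢v refl)
      triple : adj G y y′ ≡ false → ⊥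
      triple nyy = independent-triple C₁ x y y′ ((C-≢ cx cy ∷ C-≢ cx cy′ ∷ []) ∷ (ne ∷ []) ∷ [] ∷ []) nx nx′ nyy
        (λ w e → cl w x (C₁-C e) cx (==f⇒≢ (not-true (∧ʳ {C w} e))) ∷ full only w e ∷ full only′ w e ∷ [])
        (lin 0 (+-mono-≤ (*-monoʳ-≤ 3 (#-remove C x)) big) (eq (# C₁) (# C) k))
        where
        eq : ∀ a c k → 3 * a + (3 * c + (2 * k + 7)) ≡ 2 * k + 4 + (3 * suc a + 3 * c) + 0
        eq = solve-∀

    -- Any two outer neighbours l₁, l₂ resist being joined, so they lie in a common near-clique;
    -- three of them contradict independent-triple.
    no-heavy-at-k : ∀ y → C y ≡ false → # C ≡ k → 9 ≤ dC y → ⊥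
    no-heavy-at-k y cy Ck h9 =
      let z₁ , e₁ = #-∃ A (≤-trans (s≤s z≤n) h9)
          l₁ , L₁ = light z₁ e₁ in
      go₁ z₁ l₁ e₁ L₁
      where
      eq : ∀ w a b d k → 3 * w + (3 * (a + b + d + k + k) + 13) ≡ 2 * k + 4 + (3 * (w + d + suc k + suc a + suc b) + k) + 0
      eq = solve-∀
      x = proj₁ (nonneighbour y cy)
      cx = proj₁ (proj₂ (nonneighbour y cy))
      nx = proj₂ (proj₂ (nonneighbour y cy))
      A : Fin n → Bool
      A b = adj G y b ∧ C b
      hy : k + 5 ≤ dC y + # C
      hy = lin 4 (+-mono-≤ h9 (≤-reflexive (sym Ck))) (eq′ k (dC y) (# C))
        where
        eq′ : ∀ k d c → d + c + (9 + k) ≡ k + 5 + (d + c) + 4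
        eq′ = solve-∀
      Light : Fin n → Fin n → Set
      Light z l = adj G z l ≡ true × C l ≡ false × l ≢ y × (∀ u → ext z u ≡ true → u ≡ y ⊎ u ≡ l)
      light : ∀ z → A z ≡ true → ∃ (Light z)
      light z e = let l , el , a = #-pick (ext z) (y ∷ []) (≤-reflexive (sym two))
                      zl , cl′ = ∧-split {adj G z l} el
                  in l , zl , not-true cl′ , all₁ a , only l el (all₁ a)
        where
        yz = ∧ˡ e
        cz = ∧ʳ {adj G y z} e
        -- The other vertices of `C` take k - 1 of the edges at `z`, and the degree is k + 1 by
        -- `heavy-nbr-degree`.
        two : # (ext z) ≡ 2
        two = +-cancelˡ-≡ k _ _ (trans (cong (_+ # (ext z)) (sym Ck)) (trans (ext-count z cz) (trans (cong suc (≤-antisym (deg≤ z)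
                (≰⇒> (heavy-nbr-degree y x z cy cx nx hy cz yz)))) (+-comm 2 k))))
        only : ∀ l → ext z l ≡ true → l ≢ y → ∀ u → ext z u ≡ true → u ≡ y ⊎ u ≡ l
        only l el l≢y u eu with u ≟ᶠ y | u ≟ᶠ l
        ... | yes p | _ = inj₁ p
        ... | no _ | yes p = inj₂ p
        ... | no p | no q = ⊥-elim (<⇒≱ (b2n-list (ext z) (y ∷ l ∷ u ∷ []) ((l≢y ∘ sym ∷ p ∘ sym ∷ []) ∷ (q ∘ sym ∷ []) ∷ [] ∷ [])
              (∧-intro (adj-sym′ G yz) (not-intro cy) ∷ el ∷ eu ∷ [])) (≤-reflexive two))
      small : ∀ z → A z ≡ true → ∀ l → Light z l → dC l ≤ 4
      small z e l (zl , cl′ , l≢y , _) = ≤-pred (≰⇒> λ 5≤ → heavies-apart y l z cy cl′ (l≢y ∘ sym) hy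
        (≤-trans (≤-reflexive (+-comm k 5)) (+-mono-≤ 5≤ (≤-reflexive (sym Ck)))) (∧ʳ {adj G y z} e) (∧ˡ e) (adj-sym′ G zl))
      few₁ : ∀ l → dC l ≤ 4 → 0 < # (λ b → A b ∧ not (adj G l b))
      few₁ l h = lin 4 (+-mono-≤ (+-mono-≤ h9 h) (#-cover (λ b → adj G l b ∧ C b) (λ b → A b ∧ not (adj G l b)) A cov)) (eq′ (# (λ b → A b ∧ not (adj G l b))) (dC y) (dC l))
        where
        eq′ : ∀ w a d → w + (9 + d + a) ≡ 1 + (a + 4 + (d + w)) + 4
        eq′ = solve-∀
        cov : ∀ b → A b ≡ true → (adj G l b ∧ C b) ≡ true ⊎ (A b ∧ not (adj G l b)) ≡ true
        cov b e with tf (adj G l b)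
        ... | inj₁ t = inj₁ (∧-intro t (∧ʳ {adj G y b} e))
        ... | inj₂ f = inj₂ (∧-intro e (not-intro f))
      -- Here the 9 is used: two vertices with at most four neighbours in `C` each cannot cover the
      -- nine neighbours of `y`.
      few₂ : ∀ l l′ → dC l ≤ 4 → dC l′ ≤ 4 → 0 < # (λ b → A b ∧ not (adj G l b ∨ adj G l′ b))
      few₂ l l′ h h′ = lin 0 (+-mono-≤ (+-mono-≤ (+-mono-≤ (+-mono-≤ h9 h) h′)
          (#-cover (λ b → (adj G l b ∧ C b) ∨ (adj G l′ b ∧ C b)) (λ b → A b ∧ not (adj G l b ∨ adj G l′ b)) A cov))
          (#-∨ (λ b → adj G l b ∧ C b) (λ b → adj G l′ b ∧ C b))) (eq′ (# (λ b → A b ∧ not (adj G l b ∨ adj G l′ b))) (dC y) (dC l) (dC l′) _)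
        where
        eq′ : ∀ w a d e u → w + (9 + d + e + a + u) ≡ 1 + (a + 4 + 4 + (u + w) + (d + e)) + 0
        eq′ = solve-∀
        cov : ∀ b → A b ≡ true → ((adj G l b ∧ C b) ∨ (adj G l′ b ∧ C b)) ≡ true ⊎ (A b ∧ not (adj G l b ∨ adj G l′ b)) ≡ true
        cov b e with tf (adj G l b) | tf (adj G l′ b)
        ... | inj₁ t | _ = inj₁ (∨-introˡ (∧-intro t (∧ʳ {adj G y b} e)))
        ... | inj₂ _ | inj₁ t = inj₁ (∨-introʳ {adj G l b ∧ C b} (∧-intro t (∧ʳ {adj G y b} e)))
        ... | inj₂ f | inj₂ f′ = inj₂ (∧-intro e (not-intro (≢true λ t → [ (λ t → true≢false t f) , (λ t → true≢false t f′) ]′ (∨-split {adj G l b} t))))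
      apart : ∀ {z z′ l l′} → Light z l → Light z′ l′ → adj G l z′ ≡ false → l ≢ l′
      apart {z} {z′} _ (zl , _) nl = differ (λ l → adj G l z′) (adj-sym′ G zl) nl ∘ sym
      join : ∀ z z′ l l′ → A z ≡ true → A z′ ≡ true → Light z l → Light z′ l′ → l ≢ l′ →
             (∀ T → Clique (modify G C (λ a b → (a == l) ∧ (b == l′))) T → k < # T → ⊥) → ⊥
      join z z′ l l′ e e′ (zl , cl′ , l≢y , o) (zl′ , cl″ , l′≢y , o′) ne f with z ≟ᶠ z′
      ... | yes refl = [ l′≢y , ne ∘ sym ]′ (o l′ (∧-intro zl′ (not-intro cl″)))
      ... | no z≢z′ = split-lights y x z z′ l l′ cy cx nx hy (∧ʳ {adj G y z} e) (∧ʳ {adj G y z′} e′) z≢z′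
          (∧ˡ e) (∧ˡ e′) cl′ cl″ l≢y l′≢y ne zl zl′ o′ λ T c → ≮⇒≥ (f T c)
      Near : Fin n → Fin n → Set
      Near l l′ = adj G l l′ ≡ false × ∃ λ W → k ≤ suc (# W) × (∀ w → W w ≡ true → adj G l w ≡ true × adj G l′ w ≡ true)
      -- More than k vertices cannot form a clique of `G`, so the clique uses the new edge: `l` and
      -- `l′` are non-adjacent in `G`, and its other vertices, at least k - 1, are common
      -- neighbours.
      near : ∀ l l′ → l ≢ l′ → ∀ T → Clique (modify G C (λ a b → (a == l) ∧ (b == l′))) T → k < # T →
             Near l l′
      near l l′ ne T clT big =
        ≢true (λ ll → notG λ u v tu tv u≢v → [ id , [ (λ (p , q) → subst₂ (λ a b → adj G a b ≡ true) (sym p) (sym q) ll) ,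
                  (λ (p , q) → subst₂ (λ a b → adj G a b ≡ true) (sym q) (sym p) (adj-sym′ G ll)) ]′ ]′ (edge u v tu tv u≢v)) ,
        W , ≤-pred (≤-trans big (≤-trans (#-remove T l) (s≤s (#-remove (λ u → T u ∧ not (u == l)) l′)))) ,
        λ w e → let e₁ , w≢l′ = ∧-split {T w ∧ not (w == l)} e
                    tw , w≢l = ∧-split {T w} e₁
                    w≢l = ==f⇒≢ (not-true w≢l) ; w≢l′ = ==f⇒≢ (not-true w≢l′)
                in [ id , [ (λ (p , q) → ⊥-elim (w≢l′ q)) , (λ (p , q) → ⊥-elim (w≢l p)) ]′ ]′ (edge l w Tl tw (w≢l ∘ sym)) ,
                   [ id , [ (λ (p , q) → ⊥-elim (ne (sym p))) , (λ (p , q) → ⊥-elim (w≢l p)) ]′ ]′ (edge l′ w Tl′ tw (w≢l′ ∘ sym))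
        where
        W : Fin n → Bool
        W u = (T u ∧ not (u == l)) ∧ not (u == l′)
        edge : ∀ u v → T u ≡ true → T v ≡ true → u ≢ v → adj G u v ≡ true ⊎ ((u ≡ l × v ≡ l′) ⊎ (v ≡ l × u ≡ l′))
        edge u v tu tv u≢v with modify-elim G C (λ a b → (a == l) ∧ (b == l′)) (clT u v tu tv u≢v)
        ... | _ , _ , inj₁ e = inj₁ e
        ... | _ , _ , inj₂ e = inj₂ ([ (λ a → inj₁ (==⇒≡ (∧ˡ a) , ==⇒≡ (∧ʳ {u == l} a))) ,
                                       (λ a → inj₂ (==⇒≡ (∧ˡ a) , ==⇒≡ (∧ʳ {v == l} a))) ]′ (∨-split {(u == l) ∧ (v == l′)} e))
        notG : ¬ Clique G T
        notG c = <⇒≱ big (noK T c)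
        Tl : T l ≡ true
        Tl with tf (T l)
        ... | inj₁ t = t
        ... | inj₂ f = ⊥-elim (notG λ u v tu tv u≢v → [ id , [ (λ (p , q) → ⊥-elim (differ T tu f p)) , (λ (p , q) → ⊥-elim (differ T tv f p)) ]′ ]′ (edge u v tu tv u≢v))
        Tl′ : T l′ ≡ true
        Tl′ with tf (T l′)
        ... | inj₁ t = t
        ... | inj₂ f = ⊥-elim (notG λ u v tu tv u≢v → [ id , [ (λ (p , q) → ⊥-elim (differ T tv f q)) , (λ (p , q) → ⊥-elim (differ T tu f q)) ]′ ]′ (edge u v tu tv u≢v))
      core : ∀ z₁ z₂ z₃ l₁ l₂ l₃ → A z₁ ≡ true → A z₂ ≡ true → A z₃ ≡ true → Light z₁ l₁ → Light z₂ l₂ → Light z₃ l₃ →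
             l₁ ≢ l₂ → l₁ ≢ l₃ → l₂ ≢ l₃ → ⊥
      core z₁ z₂ z₃ l₁ l₂ l₃ e₁ A₂ A₃ L₁ L₂ L₃ l₁≢l₂ l₁≢l₃ l₂≢l₃ =
         join z₁ z₂ l₁ l₂ e₁ A₂ L₁ L₂ l₁≢l₂ λ T₁₂ cl₁₂ big₁₂ →
         join z₁ z₃ l₁ l₃ e₁ A₃ L₁ L₃ l₁≢l₃ λ T₁₃ cl₁₃ big₁₃ →
         join z₂ z₃ l₂ l₃ A₂ A₃ L₂ L₃ l₂≢l₃ λ T₂₃ cl₂₃ big₂₃ →
         end (near l₁ l₂ l₁≢l₂ T₁₂ cl₁₂ big₁₂) (near l₁ l₃ l₁≢l₃ T₁₃ cl₁₃ big₁₃) (proj₁ (near l₂ l₃ l₂≢l₃ T₂₃ cl₂₃ big₂₃))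
         where
         end : Near l₁ l₂ → Near l₁ l₃ → adj G l₂ l₃ ≡ false → ⊥
         end (n₁₂ , W₁₂ , c₁₂ , a₁₂) (n₁₃ , W₁₃ , c₁₃ , a₁₃) n₂₃ =
            independent-triple (λ w → W₁₂ w ∧ W₁₃ w) l₁ l₂ l₃ ((l₁≢l₂ ∷ l₁≢l₃ ∷ []) ∷ (l₂≢l₃ ∷ []) ∷ [] ∷ []) n₁₂ n₁₃ n₂₃
              (λ w e → let p , q = ∧-split {W₁₂ w} e in
                 adj-sym′ G (proj₁ (a₁₂ w p)) ∷ adj-sym′ G (proj₂ (a₁₂ w p)) ∷ adj-sym′ G (proj₂ (a₁₃ w q)) ∷ [])
              -- Inside the neighbourhood of `l₁` the two sets meet in at least 2(k - 1) - (k + 1) =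
              -- k - 3 vertices, and 3(k - 3) reaches 2k + 4 from k = 13 on.
              (lin 0 (+-mono-≤ (*-monoʳ-≤ 3 (+-mono-≤ (+-mono-≤ (+-mono-≤ (#-inter W₁₂ W₁₃ (adj G l₁) (λ w → proj₁ ∘ a₁₂ w) (λ w → proj₁ ∘ a₁₃ w)) (deg≤ l₁)) c₁₂) c₁₃)) 13≤k)
                     (eq (# (λ w → W₁₂ w ∧ W₁₃ w)) (# W₁₂) (# W₁₃) (deg G l₁) k))
      go₂ : ∀ z₁ z₂ l₁ l₂ → A z₁ ≡ true → A z₂ ≡ true → Light z₁ l₁ → Light z₂ l₂ → l₁ ≢ l₂ → ⊥
      go₂ z₁ z₂ l₁ l₂ e₁ e₂ L₁ L₂ l₁≢l₂ =
        let z₃ , e₃ = #-∃ (λ b → A b ∧ not (adj G l₁ b ∨ adj G l₂ b)) (few₂ l₁ l₂ (small z₁ e₁ l₁ L₁) (small z₂ e₂ l₂ L₂))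
            A₃ , nl₃ = ∧-split {A z₃} e₃
            l₃ , L₃ = light z₃ A₃
        in core z₁ z₂ z₃ l₁ l₂ l₃ e₁ e₂ A₃ L₁ L₂ L₃ l₁≢l₂ (apart L₁ L₃ (≢true λ e → true≢false (∨-introˡ e) (not-true nl₃)))
             (apart L₂ L₃ (≢true λ e → true≢false (∨-introʳ {adj G l₁ z₃} e) (not-true nl₃)))
      go₁ : ∀ z₁ l₁ → A z₁ ≡ true → Light z₁ l₁ → ⊥
      go₁ z₁ l₁ e₁ L₁ =
        let z₂ , e₂ = #-∃ (λ b → A b ∧ not (adj G l₁ b)) (few₁ l₁ (small z₁ e₁ l₁ L₁))
            A₂ , nl₁z₂ = ∧-split {A z₂} e₂
            l₂ , L₂ = light z₂ A₂
        in go₂ z₁ z₂ l₁ l₂ e₁ A₂ L₁ L₂ (apart L₁ L₂ (not-true nl₁z₂))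

    light : Fin n → Fin n → Bool
    light z u = ext z u ∧ (dC u + # C ≤ᵇ k + 8)

    -- By `heavies-apart` at most one outer neighbour of `z` is not light. If there is one, `z` has
    -- degree k + 1 and |C| < k by `no-heavy-at-k`, and this pays for the loss. The first bound
    -- provides the repetitions that `z` needs, the second the s + 1 light neighbours used in double
    -- counting.
    light-count : ∀ z → C z ≡ true → suc (deg G z) ≤ k + # (light z) × suc k ≤ # C + # (light z)
    light-count z cz with any? (λ u → (ext z u ∧ not (dC u + # C ≤ᵇ k + 8)) ≟ᵇ true)
    ... | no none = ≤-trans (≤-trans (≤-reflexive (sym (ext-count z cz))) (+-monoʳ-≤ (# C) le)) (+-monoˡ-≤ _ (noK C cl)) ,
                    ≤-trans (≤-trans (s≤s (min-degree z pos)) (≤-reflexive (sym (ext-count z cz)))) (+-monoʳ-≤ (# C) le)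
      where
      le : # (ext z) ≤ # (light z)
      le = #-mono λ u e → ∧-intro e ([ id , (λ f → ⊥-elim (none (u , ∧-intro e (not-intro f)))) ]′ (tf (dC u + # C ≤ᵇ k + 8)))
      pos : 0 < deg G z
      pos = let u , cu , _ , ne = meet-avoiding z in #-pos (adj G z) u (cl z u cz cu (ne ∘ sym))
    ... | yes (y , e) = lin 0 (+-mono-≤ (+-mono-≤ snd C<k) (deg≤ z)) (eq₁ (deg G z) k (# C) (# (light z))) , snd
      where
      ey = ∧ˡ {ext z y} e
      cy = not-true (∧ʳ {adj G z y} ey)
      zy = ∧ˡ ey
      h9 : k + 9 ≤ dC y + # C
      h9 = ≤-trans (≤-reflexive (+-suc k 8)) (≤ᵇ-false (not-true (∧ʳ {ext z y} e)))
      weaken : ∀ {m} → k + 9 ≤ m → k + 5 ≤ m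
      weaken = ≤-trans (+-monoʳ-≤ k (s≤s (s≤s (s≤s (s≤s (s≤s z≤n))))))
      C<k : # C < k
      C<k = ≤∧≢⇒< (noK C cl) λ eq → no-heavy-at-k y cy eq (+-cancelʳ-≤ k 9 (dC y) (≤-trans (≤-reflexive (+-comm 9 k)) (subst (λ m → k + 9 ≤ dC y + m) eq h9)))
      dz : suc k ≤ deg G z
      dz = let x , cx , nx = nonneighbour y cy in ≰⇒> (heavy-nbr-degree y x z cy cx nx (weaken h9) cz (adj-sym′ G zy))
      le : # (ext z) ≤ # (light z) + 1
      le = subst (λ m → # (ext z) ≤ # (light z) + m) (#-single y) (#-cover (light z) (_== y) (ext z) cov)
        where
        cov : ∀ u → ext z u ≡ true → light z u ≡ true ⊎ (u == y) ≡ true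
        cov u eu with tf (dC u + # C ≤ᵇ k + 8) | u ≟ᶠ y
        ... | inj₁ t | _ = inj₁ (∧-intro eu t)
        ... | inj₂ f | yes refl = inj₂ (==-refl u)
        ... | inj₂ f | no ne = ⊥-elim (heavies-apart u y z (not-true (∧ʳ {adj G z u} eu)) cy ne
                (weaken (≤-trans (≤-reflexive (+-suc k 8)) (≤ᵇ-false f))) (weaken h9) cz (adj-sym′ G (∧ˡ eu)) (adj-sym′ G zy))
      snd : suc k ≤ # C + # (light z)
      snd = lin 0 (+-mono-≤ (+-mono-≤ le dz) (≤-reflexive (sym (ext-count z cz)))) (eq₂ (deg G z) k (# C) (# (light z)) (# (ext z)))
        where
        eq₂ : ∀ d k c l e → c + l + (e + suc k + suc d) ≡ suc k + (l + 1 + d + (c + e)) + 0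
        eq₂ = solve-∀
      eq₁ : ∀ d k c l → k + l + (suc k + suc c + d) ≡ suc d + (c + l + k + suc k) + 0
      eq₁ = solve-∀

-- Disjoint systems of light neighbours

infixr 5 _◂_
_◂_ : ∀ {j} {A : Set} → A → (Fin j → A) → Fin (suc j) → A
(x ◂ f) zero    = x
(x ◂ f) (suc i) = f i

Apart : ∀ {j n} → (Fin j → Fin n) → (Fin j → Fin n) → Set
Apart f g = ∀ i i′ → i ≢ i′ → f i ≢ g i′

apart-◂ : ∀ {j n} {x y : Fin n} {f g : Fin j → Fin n} → (∀ i → x ≢ g i) → (∀ i → y ≢ f i) → Apart f g → Apart (x ◂ f) (y ◂ g)
apart-◂ h h′ p zero    zero    ne = ⊥-elim (ne refl)
apart-◂ h h′ p zero    (suc i) ne = h i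
apart-◂ h h′ p (suc i) zero    ne = h′ i ∘ sym
apart-◂ h h′ p (suc i) (suc j) ne = p i j (ne ∘ cong suc)

-- The sets {a i, b i} are pairwise disjoint; a vertex z i of degree at most k needs only one light neighbour, and then b i may equal a i.
record Units {n : ℕ} (P : Fin n → Bool) (light : Fin n → Fin n → Bool) (d : Fin n → ℕ) (k j : ℕ) : Set where
  field
    z a b   : Fin j → Fin n
    z∈      : ∀ i → P (z i) ≡ true
    a-light : ∀ i → light (z i) (a i) ≡ true
    b-light : ∀ i → light (z i) (b i) ≡ true
    enough  : ∀ i → d (z i) ≤ k ⊎ a i ≢ b i
    zz      : Apart z z
    aa      : Apart a a
    ab      : Apart a b
    bb      : Apart b b

  ba : Apart b a
  ba i i′ ne = ab i′ i (ne ∘ sym) ∘ sym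

  used : Fin n → Bool
  used u = anyᵇ (λ i → (u == a i) ∨ (u == b i))

  used-a : ∀ i → used (a i) ≡ true
  used-a i = anyᵇ-intro i (∨-introˡ (==-refl (a i)))

  used-b : ∀ i → used (b i) ≡ true
  used-b i = anyᵇ-intro i (∨-introʳ {b i == a i} (==-refl (b i)))

  #used : # used ≤ j + j
  #used = ≤-trans (#-cover (λ u → anyᵇ (λ i → u == a i)) (λ u → anyᵇ (λ i → u == b i)) used λ u e → spl u (anyᵇ-elim e))
            (+-mono-≤ (img a) (img b))
    where
    spl : ∀ u → (∃ λ i → ((u == a i) ∨ (u == b i)) ≡ true) → anyᵇ (λ i → u == a i) ≡ true ⊎ anyᵇ (λ i → u == b i) ≡ true
    spl u (i , e) = [ (λ p → inj₁ (anyᵇ-intro i p)) , (λ p → inj₂ (anyᵇ-intro i p)) ]′ (∨-split {u == a i} e)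
    img : ∀ (f : Fin j → Fin n) → # (λ u → anyᵇ (λ i → u == f i)) ≤ j
    img f = ≤-trans (#-image f (λ u → anyᵇ (λ i → u == f i)) (λ _ → true) (λ u e → let i , p = anyᵇ-elim e in i , refl , sym (==⇒≡ p))) (≤-reflexive (#-full j))

  centres : Fin n → Bool
  centres u = anyᵇ (λ i → u == z i)

  #centres : # centres ≤ j
  #centres = ≤-trans (#-image z centres (λ _ → true) (λ u e → let i , p = anyᵇ-elim e in i , refl , sym (==⇒≡ p))) (≤-reflexive (#-full j))

module _ {n : ℕ} (P : Fin n → Bool) (light : Fin n → Fin n → Bool) (d : Fin n → ℕ) (k s : ℕ)
  (k≤d : ∀ x → P x ≡ true → k ≤ d x) (d≤k : ∀ x → d x ≤ suc k)
  (many : ∀ x → P x ≡ true → suc (d x) ≤ k + # (light x)) (more : ∀ x → P x ≡ true → suc s ≤ # (light x))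
  (spread : ∀ u → # (λ x → P x ∧ light x u) ≤ s + 8) where

  private
    Un = Units P light d k

  units-add : ∀ {j} (U : Un j) x p q → P x ≡ true → Units.centres U x ≡ false → light x p ≡ true → light x q ≡ true →
              Units.used U p ≡ false → Units.used U q ≡ false → d x ≤ k ⊎ p ≢ q → Un (suc j)
  units-add U x p q px zx lp lq up uq o = record
    { z = x ◂ z ; a = p ◂ a ; b = q ◂ b
    ; z∈ = λ { zero → px ; (suc i) → z∈ i }
    ; a-light = λ { zero → lp ; (suc i) → a-light i }
    ; b-light = λ { zero → lq ; (suc i) → b-light i }
    ; enough = λ { zero → o ; (suc i) → enough i }
    ; zz = apart-◂ {f = z} {g = z} nz nz zz
    ; aa = apart-◂ {f = a} {g = a} (na up) (na up) aa
    ; ab = apart-◂ {f = a} {g = b} (nb up) (na uq) ab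
    ; bb = apart-◂ {f = b} {g = b} (nb uq) (nb uq) bb }
    where
    open Units U
    nz : ∀ i → x ≢ z i
    nz i refl = true≢false (anyᵇ-intro i (==-refl (z i))) zx
    na : ∀ {u} → used u ≡ false → ∀ i → u ≢ a i
    na f i refl = true≢false (used-a i) f
    nb : ∀ {u} → used u ≡ false → ∀ i → u ≢ b i
    nb f i refl = true≢false (used-b i) f

  module _ {j : ℕ} (U : Un j) (large : 19 * suc j ≤ # P) where
    open Units U

    private
      free : Fin n → Fin n → Bool
      free x u = light x u ∧ not (used u)

      ok : Fin n → Bool
      ok x = (P x ∧ not (centres x)) ∧ (suc (d x) ≤ᵇ k + # (free x))

      R : Fin n → Bool
      R x = P x ∧ not (centres x)

      taken : Fin n → Fin n → Bool
      taken x u = light x u ∧ used u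

      -- With the maximum, s + 8 is at most 9 * `s⁺` even when s = 0.
      s⁺ = 1 ⊔ s

      module None (none : anyᵇ ok ≡ false) where

        -- A vertex that cannot be added has at most d - k free light neighbours. Then `many` forces
        -- at least one taken neighbour, and `more` together with d ≤ k + 1 forces at least s.
        few : ∀ x → R x ≡ true → s⁺ ≤ # (taken x)
        few x rx = ⊔-lub one ess
          where
          px = ∧ˡ rx
          fr : k + # (free x) ≤ d x
          fr = ≤-pred (≰⇒> λ le → true≢false (anyᵇ-intro x (∧-intro rx (true-≤ᵇ le))) none)
          sp : # (light x) ≤ # (taken x) + # (free x)
          sp = ≤-reflexive (#-split used (light x))
          one : 1 ≤ # (taken x)
          one = lin 0 (+-mono-≤ (+-mono-≤ (many x px) fr) sp) (eq₁ k (d x) (# (free x)) (# (light x)) (# (taken x)))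
            where
            eq₁ : ∀ k d f l t → t + (suc d + (k + f) + l) ≡ 1 + (k + l + d + (t + f)) + 0
            eq₁ = solve-∀
          ess : s ≤ # (taken x)
          ess = lin 0 (+-mono-≤ (+-mono-≤ (+-mono-≤ (more x px) fr) sp) (d≤k x)) (eq₂ k (d x) (# (free x)) (# (light x)) (# (taken x)) s)
            where
            eq₂ : ∀ k d f l t s → t + (suc s + (k + f) + l + d) ≡ s + (l + d + (t + f) + suc k) + 0
            eq₂ = solve-∀

        per-u : ∀ u → # (λ x → R x ∧ taken x u) ≤ b2n (used u) * (9 * s⁺)
        per-u u with tf (used u)
        ... | inj₂ f = ≤-trans (≤-reflexive (#-none {P = λ x → R x ∧ taken x u} λ x → ≢true λ e →
                          true≢false (∧ʳ {light x u} (∧ʳ {R x} e)) f)) z≤n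
        ... | inj₁ t = ≤-trans (#-mono {Q = λ x → P x ∧ light x u} λ x e → let rx , e₁ = ∧-split {R x} e in ∧-intro (∧ˡ {P x} rx) (∧ˡ {light x u} e₁))
               (≤-trans (spread u) (≤-trans (+-mono-≤ (m≤n⊔m 1 s) (*-monoʳ-≤ 8 (m≤m⊔n 1 s))) (≤-reflexive (sym (trans (cong (λ b → b2n b * (9 * s⁺)) t) (*-identityˡ _))))))

        double : # R * s⁺ ≤ (j + j) * (9 * s⁺)
        double = begin
          # R * s⁺ ≡⟨ sum-*ʳ s⁺ (b2n ∘ R) ⟨
          sum (λ x → b2n (R x) * s⁺) ≤⟨ sum-mono pt ⟩
          sum (λ x → # (λ u → R x ∧ taken x u)) ≡⟨ sum-swap (λ x u → b2n (R x ∧ taken x u)) ⟩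
          sum (λ u → # (λ x → R x ∧ taken x u)) ≤⟨ sum-mono per-u ⟩
          sum (λ u → b2n (used u) * (9 * s⁺)) ≡⟨ sum-*ʳ (9 * s⁺) (b2n ∘ used) ⟩
          # used * (9 * s⁺) ≤⟨ *-monoˡ-≤ (9 * s⁺) #used ⟩
          (j + j) * (9 * s⁺) ∎
          where
          open ≤-Reasoning
          pt : ∀ x → b2n (R x) * s⁺ ≤ # (λ u → R x ∧ taken x u)
          pt x with R x in e
          ... | true  = ≤-trans (≤-reflexive (+-identityʳ s⁺)) (few x e)
          ... | false = z≤n

        absurd : ⊥
        absurd = <⇒≱ (*-monoʳ-< 19 (n<1+n j)) (≤-trans large (≤-trans
          (#-cover centres R P λ x e → [ inj₁ , (λ q → inj₂ (∧-intro e (not-intro q))) ]′ (tf (centres x))) (+-mono-≤ #centres R≤)))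
          where
          eq₄ : ∀ j s → (j + j) * (9 * s) ≡ 18 * j * s
          eq₄ = solve-∀
          R≤ : # R ≤ 18 * j
          R≤ = *-cancelʳ-≤ (# R) (18 * j) s⁺ {{>-nonZero (m≤m⊔n 1 s)}} (≤-trans double (≤-reflexive (eq₄ j s⁺)))

      choose : ∀ x → P x ≡ true → centres x ≡ false → suc (d x) ≤ k + # (free x) → Un (suc j)
      choose x px zx e = first (#-∃ (free x) (+-cancelˡ-< k 0 _ (≤-trans (s≤s (≤-trans (≤-reflexive (+-identityʳ k)) (k≤d x px))) e)))
        where
        Free = ∃ λ p → free x p ≡ true
        add : ∀ p q → free x p ≡ true → free x q ≡ true → d x ≤ k ⊎ p ≢ q → Un (suc j)
        add p q fp fq o = units-add U x p q px zx (∧ˡ fp) (∧ˡ fq) (not-true (∧ʳ {light x p} fp)) (not-true (∧ʳ {light x q} fq)) o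
        first : Free → Un (suc j)
        first (p , fp) = by-degree (d x ≤? k)
          where
          second : (∃ λ q → free x q ≡ true × All (q ≢_) (p ∷ [])) → Un (suc j)
          second (q , fq , ne) = add p q fp fq (inj₂ (all₁ ne ∘ sym))
          by-degree : Dec (d x ≤ k) → Un (suc j)
          by-degree (yes le) = add p p fp fp (inj₁ le)
          by-degree (no gt) = second (#-pick (free x) (p ∷ []) (+-cancelˡ-≤ k 2 (# (free x)) (≤-trans (≤-trans (≤-reflexive (+-comm k 2)) (s≤s (≰⇒> gt))) e)))

    units-extend : Un (suc j)
    units-extend = found (tf (anyᵇ ok))
      where
      found : anyᵇ ok ≡ true ⊎ anyᵇ ok ≡ false → Un (suc j)
      found (inj₂ f) = ⊥-elim (None.absurd f)
      found (inj₁ t) = let x , e = anyᵇ-elim t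
                           cz , l = ∧-split {R x} e
                           cx , zx = ∧-split {P x} cz
                       in choose x cx (not-true zx) (≤ᵇ-true l)

  -- Greedy. If j units could not be extended, each vertex of `P` that is not a centre would have at
  -- least max(1, s) light neighbours among the at most 2j used ones, and each used one serves at
  -- most 9 max(1, s) vertices. That gives at most 18j vertices besides the j centres, fewer than
  -- 19(j + 1).
  units-exist : ∀ j → 19 * j ≤ # P → Un j
  units-exist zero _ = record { z = λ () ; a = λ () ; b = λ () ; z∈ = λ () ; a-light = λ () ; b-light = λ () ; enough = λ () ; zz = λ () ; aa = λ () ; ab = λ () ; bb = λ () }
  units-exist (suc j) h = units-extend (units-exist j (≤-trans (*-monoʳ-≤ 19 (n≤1+n j)) h)) h

-- Dense neighbourhoods

cliqueᵇ : ∀ {n} → Graph n → (Fin n → Bool) → Bool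
cliqueᵇ G T = not (anyᵇ λ u → anyᵇ λ v → T u ∧ T v ∧ not (u == v) ∧ not (adj G u v))

cliqueᵇ-sound : ∀ {n} (G : Graph n) T → cliqueᵇ G T ≡ true → Clique G T
cliqueᵇ-sound G T e u v tu tv ne with tf (adj G u v)
... | inj₁ t = t
... | inj₂ f = ⊥-elim (true≢false (anyᵇ-intro u (anyᵇ-intro v (∧-intro tu (∧-intro tv (∧-intro (not-intro (≢⇒== ne)) (not-intro f)))))) (not-true e))

cliqueᵇ-complete : ∀ {n} (G : Graph n) T → Clique G T → cliqueᵇ G T ≡ true
cliqueᵇ-complete G T cl = not-intro (≢true λ e → bad (anyᵇ-elim e))
  where
  bad : (∃ λ u → anyᵇ (λ v → T u ∧ T v ∧ not (u == v) ∧ not (adj G u v)) ≡ true) → ⊥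
  bad (u , e) with anyᵇ-elim e
  ... | v , e′ = let tu , e₁ = ∧-split e′ ; tv , e₂ = ∧-split {T v} e₁ ; ne , na = ∧-split {not (u == v)} e₂ in
    true≢false (cl u v tu tv (==f⇒≢ (not-true ne))) (not-true na)

opaque
  maximal-clique : ∀ {n} (G : Graph n) k C₀ → (∀ T → Clique G T → # T ≤ k) → Clique G C₀ → (∃ λ u → C₀ u ≡ true) →
    ∃ λ C → Clique G C × (∃ λ u → C u ≡ true × C₀ u ≡ true) × (∀ T → Clique G T → (∃ λ u → T u ≡ true × C₀ u ≡ true) → # T ≤ # C)
  maximal-clique {n} G k C₀ noK cl₀ (u₀ , c₀) = go k C₀ cl₀ (u₀ , c₀ , c₀) (m≤n+m k (# C₀))
    where
    Meets : (Fin n → Bool) → Set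
    Meets T = ∃ λ u → T u ≡ true × C₀ u ≡ true
    good : ℕ → Subset n → Bool
    good m p = cliqueᵇ G (lookup p) ∧ anyᵇ (λ u → lookup p u ∧ C₀ u) ∧ (suc m ≤ᵇ # (lookup p))
    go : ∀ fuel C → Clique G C → Meets C → k ≤ # C + fuel → ∃ λ C → Clique G C × Meets C × (∀ T → Clique G T → Meets T → # T ≤ # C)
    go fuel C cl m h with anySubset? (λ p → good (# C) p ≟ᵇ true)
    go fuel C cl m h | no none = C , cl , m , λ T clT (u , tu , cu) → ≮⇒≥ λ lt → none (tabulate T ,
      ∧-intro (cliqueᵇ-complete G _ λ u v tu tv → clT u v (trans (sym (lookup∘tabulate T u)) tu) (trans (sym (lookup∘tabulate T v)) tv))
      (∧-intro (anyᵇ-intro u (∧-intro (trans (lookup∘tabulate T u) tu) cu))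
               (true-≤ᵇ (≤-trans lt (≤-reflexive (#-cong λ u → sym (lookup∘tabulate T u)))))))
    go zero C cl m h | yes (p , e) = ⊥-elim (<⇒≱ (≤-trans (s≤s (≤-trans h (≤-reflexive (+-identityʳ _)))) (≤ᵇ-true (∧ʳ {anyᵇ (λ u → lookup p u ∧ C₀ u)} (∧ʳ {cliqueᵇ G (lookup p)} e))))
      (noK (lookup p) (cliqueᵇ-sound G (lookup p) (∧ˡ e))))
    go (suc fuel) C cl m h | yes (p , e) =
      let c , e₁ = ∧-split {cliqueᵇ G (lookup p)} e
          a , l = ∧-split {anyᵇ (λ u → lookup p u ∧ C₀ u)} e₁
          u , q = anyᵇ-elim a
      in go fuel (lookup p) (cliqueᵇ-sound G (lookup p) c) (u , ∧-split {lookup p u} q)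
            (≤-trans h (≤-trans (≤-reflexive (+-suc (# C) fuel)) (+-monoˡ-≤ fuel (≤ᵇ-true l))))

non : ∀ {n} → Graph n → Fin n → Fin n → Fin n → Bool
non G v u w = (adj G v u ∧ adj G v w) ∧ not (adj G u w) ∧ not (u == w)

-- Ordered pairs are counted, so each non-edge contributes two.
nonedges : ∀ {n} → Graph n → Fin n → ℕ
nonedges G v = sum (λ u → # (non G v u))

inside : ∀ {n} → Graph n → (Fin n → Bool) → Fin n → ℕ
inside G C u = # (λ b → adj G u b ∧ C b)

-- At most s + 8 neighbours in C, where |C| = k - s.
lightᵇ : ∀ {n} → Graph n → ℕ → (Fin n → Bool) → Fin n → Fin n → Bool
lightᵇ G k C z u = (adj G z u ∧ not (C u)) ∧ (inside G C u + # C ≤ᵇ k + 8)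

record Star {n : ℕ} (G : Graph n) (k : ℕ) (v : Fin n) : Set where
  field
    C      : Fin n → Bool
    clique : Clique G C
    C≤k    : # C ≤ k
    C-size : 49 * k ≤ 50 * # C
    units  : Units (λ z → C z ∧ adj G v z) (lightᵇ G k C) (deg G) k (k / 50)

module Dense {n k : ℕ} (G : Graph n)
  (deg≤ : ∀ v → deg G v ≤ suc k)
  (noK : ∀ T → Clique G T → # T ≤ k)
  (IH : ∀ (G′ : Graph n) → (∀ u → deg G′ u ≤ deg G u) → (∃ λ u → deg G′ u < deg G u) →
        (∀ T → Clique G′ T → # T ≤ k) → Colourable G′ k)
  (nc : ¬ Colourable G k)
  (1000≤k : 1000 ≤ k)
  (v : Fin n) (k≤deg : k ≤ deg G v) (dense : 1000 * nonedges G v < k * k) where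

  open Critical G deg≤ noK IH nc

  D : Fin n → Bool
  D u = adj G v u ∧ (20 * # (non G v u) ≤ᵇ k)

  D-adj : ∀ {u} → D u ≡ true → adj G v u ≡ true
  D-adj e = ∧ˡ e

  D-non : ∀ u → D u ≡ true → 20 * # (non G v u) ≤ k
  D-non u e = ≤ᵇ-true (∧ʳ {adj G v u} e)

  -- Averaging: a bad vertex carries more than k/20 of the fewer than k²/1000 ordered non-edges.
  few-bad : 50 * # (λ u → adj G v u ∧ not (20 * # (non G v u) ≤ᵇ k)) ≤ k
  few-bad = *-cancelʳ-≤ (50 * # bad) k (20 * k) {{>-nonZero (≤-trans (≤-trans (s≤s z≤n) 1000≤k) (m≤n*m k 20))}} (begin
    50 * # bad * (20 * k) ≡⟨ eq (# bad) k ⟩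
    1000 * (# bad * k) ≤⟨ *-monoʳ-≤ 1000 le ⟩
    1000 * (20 * nonedges G v) ≡⟨ eq′ (nonedges G v) ⟩
    20 * (1000 * nonedges G v) ≤⟨ *-monoʳ-≤ 20 (<⇒≤ dense) ⟩
    20 * (k * k) ≡⟨ eq″ k ⟩
    k * (20 * k) ∎)
    where
    open ≤-Reasoning
    bad : Fin n → Bool
    bad u = adj G v u ∧ not (20 * # (non G v u) ≤ᵇ k)
    eq : ∀ b k → 50 * b * (20 * k) ≡ 1000 * (b * k)
    eq = solve-∀
    eq′ : ∀ m → 1000 * (20 * m) ≡ 20 * (1000 * m)
    eq′ = solve-∀
    eq″ : ∀ k → 20 * (k * k) ≡ k * (20 * k)
    eq″ = solve-∀
    pt : ∀ u → b2n (bad u) * k ≤ 20 * # (non G v u)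
    pt u with tf (bad u)
    ... | inj₁ t = subst (λ b → b2n b * k ≤ 20 * # (non G v u)) (sym t) (≤-trans (≤-reflexive (+-identityʳ k)) (<⇒≤ (≤ᵇ-false (not-true (∧ʳ {adj G v u} t)))))
    ... | inj₂ f = subst (λ b → b2n b * k ≤ 20 * # (non G v u)) (sym f) z≤n
    le : # bad * k ≤ 20 * nonedges G v
    le = ≤-trans (≤-reflexive (sym (sum-*ʳ k (b2n ∘ bad)))) (≤-trans (sum-mono pt) (≤-reflexive (sum-*ˡ 20 (λ u → # (non G v u)))))

  D-size : 49 * k ≤ 50 * # D
  D-size = lin 0 (+-mono-≤ (+-mono-≤ (*-monoʳ-≤ 50 k≤deg) few-bad) (≤-reflexive (cong (50 *_) (#-split (λ u → 20 * # (non G v u) ≤ᵇ k) (adj G v)))))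
             (eq k (# D) (deg G v) _)
    where
    eq : ∀ k D d b → 50 * D + (50 * k + 50 * b + 50 * d) ≡ 49 * k + (50 * d + k + 50 * (D + b)) + 0
    eq = solve-∀

  common : List (Fin n) → Fin n → Bool
  common []       w = adj G v w
  common (x ∷ xs) w = common xs w ∧ adj G w x

  common-v : ∀ xs {w} → common xs w ≡ true → adj G v w ≡ true
  common-v []       e = e
  common-v (x ∷ xs) e = common-v xs (∧ˡ e)

  common-all : ∀ xs w → common xs w ≡ true → All (λ x → adj G w x ≡ true) xs
  common-all []       w e = []
  common-all (x ∷ xs) w e = ∧ʳ {common xs w} e ∷ common-all xs w (∧ˡ e)

  -- Each vertex of `D` costs at most k/20 + 1 common neighbours. Four of them leave about 4k/5 and
  -- three about 17k/20, well above the k/2 and 2k/3 needed for `two-nonedges` and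
  -- `independent-triple`.
  common-size : ∀ xs → All (λ x → D x ≡ true) xs → 20 * k ≤ 20 * # (common xs) + length xs * (k + 20)
  common-size [] [] = ≤-trans (*-monoʳ-≤ 20 k≤deg) (≤-reflexive (sym (+-identityʳ _)))
  common-size (x ∷ xs) (dx ∷ d) = lin 0 (+-mono-≤ (+-mono-≤ (common-size xs d) (*-monoʳ-≤ 20 le)) (D-non x dx))
      (eq k (# (common xs)) (# (common (x ∷ xs))) (length xs) (# (non G v x)))
    where
    eq : ∀ k c c′ l m → 20 * c′ + suc l * (k + 20) + (20 * k + 20 * c + 20 * m) ≡ 20 * k + (20 * c + l * (k + 20) + 20 * (c′ + (m + 1)) + k) + 0
    eq = solve-∀
    le : # (common xs) ≤ # (common (x ∷ xs)) + (# (non G v x) + 1)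
    le = ≤-trans (#-cover (common (x ∷ xs)) (λ w → non G v x w ∨ (w == x)) (common xs) cov)
                 (+-monoʳ-≤ (# (common (x ∷ xs))) (subst (λ m → # (λ w → non G v x w ∨ (w == x)) ≤ # (non G v x) + m) (#-single x) (#-∨ (non G v x) (_== x))))
      where
      cov : ∀ w → common xs w ≡ true → common (x ∷ xs) w ≡ true ⊎ (non G v x w ∨ (w == x)) ≡ true
      cov w e with tf (adj G w x) | x ≟ᶠ w
      ... | inj₁ t | _ = inj₁ (∧-intro e t)
      ... | inj₂ f | yes refl = inj₂ (∨-introʳ {non G v x x} (==-refl x))
      ... | inj₂ f | no ne = inj₂ (∨-introˡ (∧-intro (∧-intro (D-adj dx) (common-v xs e)) (∧-intro (not-intro (trans (adj-sym G x w) f)) (not-intro (≢⇒== ne)))))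

  no-two : ∀ a b d e → All (λ x → D x ≡ true) (a ∷ b ∷ d ∷ e ∷ []) → Unique (a ∷ b ∷ d ∷ e ∷ []) → adj G a b ≡ false → adj G d e ≡ false → ⊥
  no-two a b d e Ds u nab nde = two-nonedges (common (a ∷ b ∷ d ∷ e ∷ [])) a b d e u nab nde (common-all (a ∷ b ∷ d ∷ e ∷ []))
    (*-cancelˡ-≤ 10 (lin 5880 (+-mono-≤ (common-size (a ∷ b ∷ d ∷ e ∷ []) Ds) (*-monoʳ-≤ 6 1000≤k)) (eq k (# (common (a ∷ b ∷ d ∷ e ∷ []))))))
    where
    eq : ∀ k w → 10 * (2 * w) + (20 * k + 6 * 1000) ≡ 10 * (k + 4) + (20 * w + 4 * (k + 20) + 6 * k) + 5880
    eq = solve-∀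

  no-three : ∀ a b d → All (λ x → D x ≡ true) (a ∷ b ∷ d ∷ []) → Unique (a ∷ b ∷ d ∷ []) → adj G a b ≡ false → adj G a d ≡ false → adj G b d ≡ false → ⊥
  no-three a b d Ds u nab nad nbd = independent-triple (common (a ∷ b ∷ d ∷ [])) a b d u nab nad nbd (common-all (a ∷ b ∷ d ∷ []))
    (*-cancelˡ-≤ 20 (lin 10740 (+-mono-≤ (*-monoʳ-≤ 3 (common-size (a ∷ b ∷ d ∷ []) Ds)) (*-monoʳ-≤ 11 1000≤k)) (eq k (# (common (a ∷ b ∷ d ∷ []))))))
    where
    eq : ∀ k w → 20 * (3 * w) + (3 * (20 * k) + 11 * 1000) ≡ 20 * (2 * k + 4) + (3 * (20 * w + 3 * (k + 20)) + 11 * k) + 10740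
    eq = solve-∀

  Pair : (Fin n → Bool) → Fin n → Fin n → Bool
  Pair P a b = (P a ∧ P b) ∧ not (a == b) ∧ not (adj G a b)

  pair? : ∀ P → (∃ λ a → ∃ λ b → P a ≡ true × P b ≡ true × a ≢ b × adj G a b ≡ false) ⊎ Clique G P
  pair? P with tf (anyᵇ λ a → anyᵇ (Pair P a))
  ... | inj₁ t = let a , t′ = anyᵇ-elim t
                     b , e = anyᵇ-elim t′
                     pp , e₁ = ∧-split {P a ∧ P b} e
                     pa , pb = ∧-split pp
                     ne , na = ∧-split {not (a == b)} e₁
                 in inj₁ (a , b , pa , pb , ==f⇒≢ (not-true ne) , not-true na)
  ... | inj₂ f = inj₂ λ a b pa pb ne → [ id , (λ na → ⊥-elim (true≢false (anyᵇ-intro a (anyᵇ-intro b (∧-intro (∧-intro pa pb) (∧-intro (not-intro (≢⇒== ne)) (not-intro na))))) f)) ]′ (tf (adj G a b))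

  -- The non-edges inside D pairwise meet and contain no triangle, so they form a star.
  centre : ∃ λ x → Clique G (λ u → D u ∧ not (u == x))
  centre with pair? D
  ... | inj₂ cl = v , λ a b pa pb → cl a b (∧ˡ pa) (∧ˡ pb)
  ... | inj₁ (a , b , Da , Db , a≢b , nab) with pair? (λ u → D u ∧ not (u == a)) | pair? (λ u → D u ∧ not (u == b))
  ... | inj₂ cl | _ = a , cl
  ... | inj₁ _ | inj₂ cl = b , cl
  ... | inj₁ (c , d , pc , pd , c≢d , ncd) | inj₁ (e , f , pe , pf , e≢f , nef) = ⊥-elim (absurd (side b c d Dc Dd c≢d ncd meet-cd) (side a e f De Df e≢f nef meet-ef))
    where
    Dc = ∧ˡ pc
    Dd = ∧ˡ pd
    De = ∧ˡ pe
    Df = ∧ˡ pf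
    ≢a : ∀ {u} → (D u ∧ not (u == a)) ≡ true → u ≢ a
    ≢a {u} p = ==f⇒≢ (not-true (∧ʳ {D u} p))
    ≢b : ∀ {u} → (D u ∧ not (u == b)) ≡ true → u ≢ b
    ≢b {u} p = ==f⇒≢ (not-true (∧ʳ {D u} p))
    side : ∀ x c d → D c ≡ true → D d ≡ true → c ≢ d → adj G c d ≡ false → c ≡ x ⊎ d ≡ x → ∃ λ g → D g ≡ true × g ≢ x × adj G x g ≡ false × (g ≡ c ⊎ g ≡ d)
    side x c d Dc Dd ne n (inj₁ refl) = d , Dd , ne ∘ sym , n , inj₂ refl
    side x c d Dc Dd ne n (inj₂ refl) = c , Dc , ne , trans (adj-sym G d c) n , inj₁ refl
    meet-cd : c ≡ b ⊎ d ≡ b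
    meet-cd with c ≟ᶠ b | d ≟ᶠ b
    ... | yes p | _ = inj₁ p
    ... | no _ | yes p = inj₂ p
    ... | no p | no q = ⊥-elim (no-two a b c d (Da ∷ Db ∷ Dc ∷ Dd ∷ []) ((a≢b ∷ ≢a pc ∘ sym ∷ ≢a pd ∘ sym ∷ []) ∷ (p ∘ sym ∷ q ∘ sym ∷ []) ∷ (c≢d ∷ []) ∷ [] ∷ []) nab ncd)
    meet-ef : e ≡ a ⊎ f ≡ a
    meet-ef with e ≟ᶠ a | f ≟ᶠ a
    ... | yes p | _ = inj₁ p
    ... | no _ | yes p = inj₂ p
    ... | no p | no q = ⊥-elim (no-two a b e f (Da ∷ Db ∷ De ∷ Df ∷ []) ((a≢b ∷ p ∘ sym ∷ q ∘ sym ∷ []) ∷ (≢b pe ∘ sym ∷ ≢b pf ∘ sym ∷ []) ∷ (e≢f ∷ []) ∷ [] ∷ []) nab nef)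
    absurd : (∃ λ g → D g ≡ true × g ≢ b × adj G b g ≡ false × (g ≡ c ⊎ g ≡ d)) → (∃ λ g → D g ≡ true × g ≢ a × adj G a g ≡ false × (g ≡ e ⊎ g ≡ f)) → ⊥
    absurd (g , Dg , g≢b , nbg , og) (h , Dh , h≢a , nah , oh) with g ≟ᶠ h
    ... | yes refl = no-three a b g (Da ∷ Db ∷ Dg ∷ []) ((a≢b ∷ h≢a ∘ sym ∷ []) ∷ (g≢b ∘ sym ∷ []) ∷ [] ∷ []) nab nah nbg
    ... | no ne = no-two b g a h (Db ∷ Dg ∷ Da ∷ Dh ∷ []) ((g≢b ∘ sym ∷ a≢b ∘ sym ∷ h≢b ∘ sym ∷ []) ∷ (g≢a ∷ ne ∷ []) ∷ (h≢a ∘ sym ∷ []) ∷ [] ∷ []) nbg nah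
      where
      g≢a : g ≢ a
      g≢a = [ (λ { refl → ≢a pc }) , (λ { refl → ≢a pd }) ]′ og
      h≢b : h ≢ b
      h≢b = [ (λ { refl → ≢b pe }) , (λ { refl → ≢b pf }) ]′ oh

  -- `C` need not contain `v`, because maximality among the cliques through `v` would not survive an
  -- exchange of `v` itself. The large overlap with `C₀`, a clique through `v`, still gives `v` many
  -- neighbours in `C`.
  record Cliques : Set where
    field
      C₀ C     : Fin n → Bool
      v∈C₀     : C₀ v ≡ true
      clique₀  : Clique G C₀
      clique   : Clique G C
      maximal  : ∀ T → Clique G T → (∃ λ u → T u ≡ true × C₀ u ≡ true) → # T ≤ # C
      C-size   : 49 * k ≤ 50 * # C
      meet-size : 48 * k ≤ 50 * # (λ u → C u ∧ C₀ u) + 100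

  cliques-exist : Cliques
  cliques-exist = build centre
    where
    build : (∃ λ x → Clique G (λ u → D u ∧ not (u == x))) → Cliques
    build (x , cl) = from (maximal-clique G k C₀ noK cl₀ (v , ⊕-new D₁ v))
      where
      D₁ : Fin n → Bool
      D₁ u = D u ∧ not (u == x)
      D₁-adj : ∀ {u} → D₁ u ≡ true → adj G v u ≡ true
      D₁-adj e = D-adj (∧ˡ e)
      C₀ = D₁ ⊕ v
      cl₀ : Clique G C₀
      cl₀ a b ca cb ne with ⊕-split D₁ v ca | ⊕-split D₁ v cb
      ... | inj₁ p | inj₁ q = cl a b p q ne
      ... | inj₁ p | inj₂ refl = adj-sym′ G (D₁-adj p)
      ... | inj₂ refl | inj₁ q = D₁-adj q
      ... | inj₂ refl | inj₂ refl = ⊥-elim (ne refl)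
      C₀-size : 49 * k ≤ 50 * # C₀
      C₀-size = ≤-trans D-size (*-monoʳ-≤ 50 (≤-trans (#-remove D x) (subst (_≤ # C₀) (+-comm (# D₁) 1)
                  (#-list D₁ C₀ (v ∷ []) ([] ∷ []) (⊕-new D₁ v ∷ []) (λ i → ∨-introˡ)
                    (≢true (λ e → true≢false (D₁-adj e) (adj-irrefl G v)) ∷ [])))))
      from : (∃ λ C → Clique G C × (∃ λ u → C u ≡ true × C₀ u ≡ true) × (∀ T → Clique G T → (∃ λ u → T u ≡ true × C₀ u ≡ true) → # T ≤ # C)) → Cliques
      from (C , clC , (z , cz , c₀z) , mx) = record
        { C₀ = C₀ ; C = C ; v∈C₀ = ⊕-new D₁ v ; clique₀ = cl₀ ; clique = clC ; maximal = mx ; C-size = Cs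
        ; meet-size = lin 0 (+-mono-≤ (+-mono-≤ Cs C₀-size) (*-monoʳ-≤ 50 inter)) (eq k (# C) (# C₀) (# (λ u → C u ∧ C₀ u))) }
        where
        Cs : 49 * k ≤ 50 * # C
        Cs = ≤-trans C₀-size (*-monoʳ-≤ 50 (mx C₀ cl₀ (v , ⊕-new D₁ v , ⊕-new D₁ v)))
        N : Fin n → Bool
        N = adj G z ⊕ z
        inN : ∀ T → Clique G T → T z ≡ true → ∀ u → T u ≡ true → N u ≡ true
        inN T cl tz u tu with u ≟ᶠ z
        ... | yes refl = ⊕-new (adj G z) z
        ... | no ne = ∨-introˡ (cl z u tz tu (ne ∘ sym))
        -- Both cliques contain `z`, so they lie in its closed neighbourhood of at most k + 2
        -- vertices.
        inter : # C + # C₀ ≤ # (λ u → C u ∧ C₀ u) + (suc k + 1)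
        inter = ≤-trans (#-inter C C₀ N (inN C clC cz) (inN C₀ cl₀ c₀z)) (+-monoʳ-≤ _ (≤-trans (subst (λ m → # N ≤ deg G z + m) (#-single z) (#-∨ (adj G z) (_== z))) (+-monoˡ-≤ 1 (deg≤ z))))
        eq : ∀ k c d m → 50 * m + 100 + (49 * k + 49 * k + 50 * (c + d)) ≡ 48 * k + (50 * c + 50 * d + 50 * (m + (suc k + 1))) + 0
        eq = solve-∀

  opaque
    cliques : Cliques
    cliques = cliques-exist

  open Cliques cliques

  private
    meet : 2 ≤ # (λ u → C u ∧ C₀ u)
    meet = *-cancelˡ-≤ 50 (lin 47800 (+-mono-≤ meet-size (*-monoʳ-≤ 48 1000≤k)) (eq k (# (λ u → C u ∧ C₀ u))))
      where
      eq : ∀ k m → 50 * m + (48 * k + 48 * 1000) ≡ 50 * 2 + (50 * m + 100 + 48 * k) + 47800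
      eq = solve-∀

    big : 2 * k + 7 ≤ 3 * # C
    big = *-cancelˡ-≤ 50 (lin 46650 (+-mono-≤ (*-monoʳ-≤ 3 C-size) (*-monoʳ-≤ 47 1000≤k)) (eq k (# C)))
      where
      eq : ∀ k c → 50 * (3 * c) + (3 * (49 * k) + 47 * 1000) ≡ 50 * (2 * k + 7) + (3 * (50 * c) + 47 * k) + 46650
      eq = solve-∀

    module S = CliqueStructure G deg≤ noK IH nc C clique
    module M = S.Maximal C₀ maximal meet big (≤-trans (≤ᵇ⇒≤ 13 1000 _) 1000≤k)

    P : Fin n → Bool
    P z = C z ∧ adj G v z

    P-C : ∀ {z} → P z ≡ true → C z ≡ true
    P-C e = ∧ˡ e

    k≤d : ∀ x → P x ≡ true → k ≤ deg G x
    k≤d x px = min-degree x (let u , cu , _ , ne = M.meet-avoiding x in #-pos (adj G x) u (clique x u (P-C px) cu (ne ∘ sym)))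

    s = k ∸ # C

    C+s : # C + s ≡ k
    C+s = m+[n∸m]≡n (noK C clique)

    more : ∀ x → P x ≡ true → suc s ≤ # (lightᵇ G k C x)
    more x px = +-cancelˡ-≤ (# C) (suc s) _ (≤-trans (≤-reflexive (trans (+-suc (# C) s) (cong suc C+s))) (proj₂ (M.light-count x (P-C px))))

    spread : ∀ u → # (λ x → P x ∧ lightᵇ G k C x u) ≤ s + 8
    spread u with tf (anyᵇ (λ x → P x ∧ lightᵇ G k C x u))
    ... | inj₂ f = ≤-trans (≤-reflexive (#-none {P = λ x → P x ∧ lightᵇ G k C x u} λ x → ≢true λ e → true≢false (anyᵇ-intro x e) f)) z≤n
    ... | inj₁ t = bound (anyᵇ-elim t)
      where
      bound : (∃ λ x → (P x ∧ lightᵇ G k C x u) ≡ true) → # (λ x → P x ∧ lightᵇ G k C x u) ≤ s + 8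
      bound (x , e) = ≤-trans (#-mono {Q = λ y → adj G u y ∧ C y} λ y e′ → let py , ly = ∧-split {P y} e′ in
            ∧-intro (adj-sym′ G (∧ˡ (∧ˡ {adj G y u ∧ not (C u)} ly))) (P-C {y} py))
          (+-cancelʳ-≤ (# C) (inside G C u) (s + 8) (≤-trans (≤ᵇ-true (∧ʳ {adj G x u ∧ not (C u)} (∧ʳ {P x} e)))
            (≤-reflexive (trans (cong (_+ 8) (sym C+s)) (eq (# C) s)))))
        where
        eq : ∀ c s → c + s + 8 ≡ s + 8 + c
        eq = solve-∀

    P-size : 19 * (k / 50) ≤ # P
    P-size = *-cancelˡ-≤ 50 (lin 28850 (+-mono-≤ (+-mono-≤ (+-mono-≤ meet-size (*-monoʳ-≤ 50 le)) (*-monoʳ-≤ 19 50M≤k)) (*-monoʳ-≤ 29 1000≤k)) (eq k (# P) (# (λ u → C u ∧ C₀ u)) (k / 50)))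
      where
      50M≤k : 50 * (k / 50) ≤ k
      50M≤k = ≤-trans (≤-reflexive (*-comm 50 (k / 50))) (m/n*n≤m k 50)
      le : # (λ u → C u ∧ C₀ u) ≤ suc (# P)
      le = ≤-trans (#-remove (λ u → C u ∧ C₀ u) v) (s≤s (#-mono λ u e → let cc , ne = ∧-split {C u ∧ C₀ u} e ; cu , c₀u = ∧-split {C u} cc in
             ∧-intro cu (clique₀ v u v∈C₀ c₀u (==f⇒≢ (not-true ne) ∘ sym))))
      eq : ∀ k c m M → 50 * c + (48 * k + 50 * m + 19 * (50 * M) + 29 * 1000) ≡ 50 * (19 * M) + (50 * m + 100 + 50 * suc c + 19 * k + 29 * k) + 28850
      eq = solve-∀

  star : Star G k v
  star = record { C = C ; clique = clique ; C≤k = noK C clique ; C-size = C-size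
                ; units = units-exist P (lightᵇ G k C) (deg G) k s k≤d deg≤ (λ x px → proj₁ (M.light-count x (P-C px))) more spread (k / 50) P-size }

-- The local lemma

Sum : ∀ {q n} → (Vec (Fin q) n → ℕ) → ℕ
Sum {n = zero}  F = F []
Sum {n = suc n} F = sum (λ c → Sum (λ ω → F (c ∷ ω)))

Sum-zero : ∀ q n → Sum {q} {n} (λ _ → 0) ≡ 0
Sum-zero q zero    = refl
Sum-zero q (suc n) = trans (sum-cong {q} (λ _ → Sum-zero q n)) (sum-zero q)

Sum-mono : ∀ {q n} {F H : Vec (Fin q) n → ℕ} → (∀ ω → F ω ≤ H ω) → Sum F ≤ Sum H
Sum-mono {n = zero}  h = h []
Sum-mono {n = suc n} h = sum-mono (λ c → Sum-mono (λ ω → h (c ∷ ω)))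

Sum-cong : ∀ {q n} {F H : Vec (Fin q) n → ℕ} → (∀ ω → F ω ≡ H ω) → Sum F ≡ Sum H
Sum-cong {n = zero}  h = h []
Sum-cong {n = suc n} h = sum-cong (λ c → Sum-cong (λ ω → h (c ∷ ω)))

Sum-+ : ∀ {q n} (F H : Vec (Fin q) n → ℕ) → Sum (λ ω → F ω + H ω) ≡ Sum F + Sum H
Sum-+ {n = zero}  F H = refl
Sum-+ {n = suc n} F H = trans (sum-cong (λ c → Sum-+ (λ ω → F (c ∷ ω)) (λ ω → H (c ∷ ω)))) (sum-+ (λ c → Sum (λ ω → F (c ∷ ω))) _)

Sum-*ʳ : ∀ {q n} c (F : Vec (Fin q) n → ℕ) → Sum (λ ω → F ω * c) ≡ Sum F * c
Sum-*ʳ {n = zero}  c F = refl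
Sum-*ʳ {n = suc n} c F = trans (sum-cong (λ a → Sum-*ʳ c (λ ω → F (a ∷ ω)))) (sum-*ʳ c (λ a → Sum (λ ω → F (a ∷ ω))))

Sum-*ˡ : ∀ {q n} c (F : Vec (Fin q) n → ℕ) → Sum (λ ω → c * F ω) ≡ c * Sum F
Sum-*ˡ {n = zero}  c F = refl
Sum-*ˡ {n = suc n} c F = trans (sum-cong (λ a → Sum-*ˡ c (λ ω → F (a ∷ ω)))) (sum-*ˡ c (λ a → Sum (λ ω → F (a ∷ ω))))

Sum-sum : ∀ {q n m} (F : Vec (Fin q) n → Fin m → ℕ) → Sum (λ ω → sum (F ω)) ≡ sum (λ i → Sum (λ ω → F ω i))
Sum-sum {n = zero}  F = refl
Sum-sum {n = suc n} F = trans (sum-cong (λ c → Sum-sum (λ ω → F (c ∷ ω)))) (sum-swap (λ c i → Sum (λ ω → F (c ∷ ω) i)))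

term≤Sum : ∀ {q n} (F : Vec (Fin q) n → ℕ) ω → F ω ≤ Sum F
term≤Sum F [] = ≤-refl
term≤Sum F (c ∷ ω) = ≤-trans (term≤Sum (λ ω → F (c ∷ ω)) ω) (term≤sum (λ c → Sum (λ ω → F (c ∷ ω))) c)

-- This identity is what makes recolouring arguments into probability bounds: a set of labellings is small
-- if each member can be recoloured in many ways while each recolouring can be undone in few.
resample : ∀ {q n} (u : Fin n) (F : Vec (Fin q) n → Vec (Fin q) n → ℕ) →
           Sum (λ ω → sum (λ c → F ω (ω [ u ]≔ c))) ≡ Sum (λ ω → sum (λ c → F (ω [ u ]≔ c) ω))
resample zero F =
  trans (sum-cong (λ x → Sum-sum (λ ω c → F (x ∷ ω) (c ∷ ω))))
    (trans (sum-swap (λ x c → Sum (λ ω → F (x ∷ ω) (c ∷ ω))))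
      (sum-cong (λ x → sym (Sum-sum (λ ω c → F (c ∷ ω) (x ∷ ω))))))
resample (suc u) F = sum-cong (λ x → resample u (λ ω ω′ → F (x ∷ ω) (x ∷ ω′)))

cnt : ∀ {q n} → (Vec (Fin q) n → Bool) → ℕ
cnt P = Sum (λ ω → b2n (P ω))

cnt-mono : ∀ {q n} {P Q : Vec (Fin q) n → Bool} → (∀ ω → P ω ≡ true → Q ω ≡ true) → cnt P ≤ cnt Q
cnt-mono h = Sum-mono (λ ω → b2n-mono (h ω))

opaque
  cnt-∃ : ∀ {q n} (P : Vec (Fin q) n → Bool) → 0 < cnt P → ∃ λ ω → P ω ≡ true
  cnt-∃ {n = zero} P h with P [] in e
  ... | true = [] , e
  cnt-∃ {n = suc n} P h =
    let c , e = #-∃ (λ c → 1 ≤ᵇ cnt (λ ω → P (c ∷ ω))) pos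
        ω , p = cnt-∃ (λ ω → P (c ∷ ω)) (≤ᵇ-true e)
    in c ∷ ω , p
    where
    all-zero : ∀ {m} (f : Fin m → ℕ) → # (λ c → 1 ≤ᵇ f c) ≡ 0 → sum f ≡ 0
    all-zero {zero} f e = refl
    all-zero {suc m} f e with f zero in q
    ... | zero = all-zero (f ∘ suc) e
    pos : 0 < # (λ c → 1 ≤ᵇ cnt (λ ω → P (c ∷ ω)))
    pos = n≢0⇒n>0 λ z → n>0⇒n≢0 h (all-zero (λ c → cnt (λ ω → P (c ∷ ω))) z)

module _ {q n : ℕ} (P Q : Vec (Fin q) n → Bool) (X : ℕ) where

  -- Double counting by `resample`: a labelling of `P` has at least X recolourings in `Q`, and to
  -- undo one only the old label of `u` must be known, which satisfies `R`.
  recolour₁ : ∀ u (R : Fin q → Bool) → (∀ ω → P ω ≡ true → X ≤ # (λ c → Q (ω [ u ]≔ c))) → (∀ ω → P ω ≡ true → R (lookup ω u) ≡ true) →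
              cnt P * X ≤ cnt Q * # R
  recolour₁ u R h r = begin
    cnt P * X ≡⟨ Sum-*ʳ X (λ ω → b2n (P ω)) ⟨
    Sum (λ ω → b2n (P ω) * X) ≤⟨ Sum-mono pt ⟩
    Sum (λ ω → sum (λ c → b2n (P ω ∧ Q (ω [ u ]≔ c)))) ≡⟨ resample u (λ ω ω′ → b2n (P ω ∧ Q ω′)) ⟩
    Sum (λ ω → sum (λ c → b2n (P (ω [ u ]≔ c) ∧ Q ω))) ≤⟨ Sum-mono (λ ω → sum-mono (λ c → pt′ ω c)) ⟩
    Sum (λ ω → sum (λ c → b2n (Q ω) * b2n (R c))) ≡⟨ Sum-cong (λ ω → sum-*ˡ (b2n (Q ω)) (λ c → b2n (R c))) ⟩
    Sum (λ ω → b2n (Q ω) * # R) ≡⟨ Sum-*ʳ (# R) (λ ω → b2n (Q ω)) ⟩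
    cnt Q * # R ∎
    where
    open ≤-Reasoning
    pt : ∀ ω → b2n (P ω) * X ≤ sum (λ c → b2n (P ω ∧ Q (ω [ u ]≔ c)))
    pt ω with P ω in e
    ... | true  = ≤-trans (≤-reflexive (+-identityʳ X)) (h ω e)
    ... | false = z≤n
    pt′ : ∀ ω c → b2n (P (ω [ u ]≔ c) ∧ Q ω) ≤ b2n (Q ω) * b2n (R c)
    pt′ ω c with P (ω [ u ]≔ c) in e
    ... | false = z≤n
    ... | true  = subst (λ b → b2n (Q ω) ≤ b2n (Q ω) * b2n b) (sym (trans (cong R (sym (lookup∘update u ω c))) (r (ω [ u ]≔ c) e))) (≤-reflexive (sym (*-identityʳ _)))

  -- One new colour is chosen for both vertices, but undoing needs two old labels. The lost factor
  -- `q` is regained by summing over the many pairs that may be altered.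
  recolour₂ : ∀ u w → (∀ ω → P ω ≡ true → X ≤ # (λ c → Q ((ω [ u ]≔ c) [ w ]≔ c))) → cnt P * X ≤ cnt Q * (q * q)
  recolour₂ u w h = begin
    cnt P * X ≡⟨ Sum-*ʳ X (λ ω → b2n (P ω)) ⟨
    Sum (λ ω → b2n (P ω) * X) ≤⟨ Sum-mono pt ⟩
    Sum (λ ω → sum (λ c → H ω (ω [ u ]≔ c))) ≡⟨ resample u H ⟩
    Sum (λ ω → sum (λ c → sum (λ d → b2n (P (ω [ u ]≔ c) ∧ Q (ω [ w ]≔ d))))) ≡⟨ Sum-sum (λ ω c → sum (λ d → b2n (P (ω [ u ]≔ c) ∧ Q (ω [ w ]≔ d)))) ⟩
    sum (λ c → Sum (λ ω → sum (λ d → b2n (P (ω [ u ]≔ c) ∧ Q (ω [ w ]≔ d))))) ≡⟨ sum-cong (λ c → resample w (λ ω ω′ → b2n (P (ω [ u ]≔ c) ∧ Q ω′))) ⟩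
    sum (λ c → Sum (λ ω → sum (λ d → b2n (P ((ω [ w ]≔ d) [ u ]≔ c) ∧ Q ω)))) ≤⟨ sum-mono {q} (λ c → Sum-mono (λ ω → sum-mono {q} (λ d → drop (P ((ω [ w ]≔ d) [ u ]≔ c))))) ⟩
    sum {q} (λ c → Sum (λ ω → sum {q} (λ d → b2n (Q ω)))) ≡⟨ sum-const q _ ⟩
    q * Sum (λ ω → sum {q} (λ d → b2n (Q ω))) ≡⟨ cong (q *_) (Sum-cong (λ ω → trans (sum-const q (b2n (Q ω))) (*-comm q _))) ⟩
    q * Sum (λ ω → b2n (Q ω) * q) ≡⟨ cong (q *_) (Sum-*ʳ q (λ ω → b2n (Q ω))) ⟩
    q * (cnt Q * q) ≡⟨ eq q (cnt Q) ⟩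
    cnt Q * (q * q) ∎
    where
    open ≤-Reasoning
    eq : ∀ q c → q * (c * q) ≡ c * (q * q)
    eq = solve-∀
    H : Vec (Fin q) n → Vec (Fin q) n → ℕ
    H ω ω′ = sum (λ d → b2n (P ω ∧ Q (ω′ [ w ]≔ d)))
    drop : ∀ a {b} → b2n (a ∧ b) ≤ b2n b
    drop true  = ≤-refl
    drop false = z≤n
    pt : ∀ ω → b2n (P ω) * X ≤ sum (λ c → H ω (ω [ u ]≔ c))
    pt ω with P ω in e
    ... | true  = ≤-trans (≤-reflexive (+-identityʳ X)) (≤-trans (h ω e) (sum-mono λ c → term≤sum (λ d → b2n (Q ((ω [ u ]≔ c) [ w ]≔ d))) c))
    ... | false = z≤n

-- The lopsided local lemma: the bound on an event is only needed relative to the avoidance of far events.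
module Local {q n : ℕ} (Ω : Vec (Fin q) n → Bool) (E : Fin n → Vec (Fin q) n → Bool) (near : Fin n → Fin n → Bool) (N d : ℕ)
  (Ω-pos : 0 < cnt Ω) (near≤d : ∀ v → # (near v) ≤ d) (1≤d : 1 ≤ d) (4d≤N : 4 * d ≤ N) where

  avoid : (Fin n → Bool) → Vec (Fin q) n → Bool
  avoid S ω = not (anyᵇ (λ w → S w ∧ E w ω))

  avoid-elim : ∀ S ω w → avoid S ω ≡ true → S w ≡ true → E w ω ≡ false
  avoid-elim S ω w a s = ≢true λ e → true≢false (anyᵇ-intro w (∧-intro s e)) (not-true a)

  avoid-intro : ∀ S ω → (∀ w → S w ≡ true → E w ω ≡ false) → avoid S ω ≡ true
  avoid-intro S ω h = not-intro (≢true λ e → let w , p = anyᵇ-elim e in true≢false (∧ʳ {S w} p) (h w (∧ˡ p)))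

  avoid-⊆ : ∀ S S′ ω → (∀ w → S′ w ≡ true → S w ≡ true) → avoid S ω ≡ true → avoid S′ ω ≡ true
  avoid-⊆ S S′ ω h a = avoid-intro S′ ω λ w s → avoid-elim S ω w a (h w s)

  good : (Fin n → Bool) → ℕ
  good S = cnt (λ ω → Ω ω ∧ avoid S ω)

  hit : (Fin n → Bool) → Fin n → ℕ
  hit S v = cnt (λ ω → (Ω ω ∧ avoid S ω) ∧ E v ω)

  module _ (local : ∀ v S → (∀ w → S w ≡ true → near v w ≡ false) → N * hit S v ≤ good S) where

    private
      split-good : ∀ (S S₁ S₂ : Fin n → Bool) → (∀ w → S w ≡ true → S₁ w ≡ true ⊎ S₂ w ≡ true) → good S₂ ≤ good S + sum (λ w → b2n (S₁ w) * hit S₂ w)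
      split-good S S₁ S₂ cov = begin
        good S₂ ≤⟨ Sum-mono pt ⟩
        Sum (λ ω → b2n (Ω ω ∧ avoid S ω) + sum (λ w → b2n (S₁ w) * b2n ((Ω ω ∧ avoid S₂ ω) ∧ E w ω))) ≡⟨ Sum-+ (λ ω → b2n (Ω ω ∧ avoid S ω)) _ ⟩
        good S + Sum (λ ω → sum (λ w → b2n (S₁ w) * b2n ((Ω ω ∧ avoid S₂ ω) ∧ E w ω))) ≡⟨ cong (good S +_) (Sum-sum (λ ω w → b2n (S₁ w) * b2n ((Ω ω ∧ avoid S₂ ω) ∧ E w ω))) ⟩
        good S + sum (λ w → Sum (λ ω → b2n (S₁ w) * b2n ((Ω ω ∧ avoid S₂ ω) ∧ E w ω))) ≡⟨ cong (good S +_) (sum-cong λ w → Sum-*ˡ (b2n (S₁ w)) (λ ω → b2n ((Ω ω ∧ avoid S₂ ω) ∧ E w ω))) ⟩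
        good S + sum (λ w → b2n (S₁ w) * hit S₂ w) ∎
        where
        open ≤-Reasoning
        pt : ∀ ω → b2n (Ω ω ∧ avoid S₂ ω) ≤ b2n (Ω ω ∧ avoid S ω) + sum (λ w → b2n (S₁ w) * b2n ((Ω ω ∧ avoid S₂ ω) ∧ E w ω))
        pt ω with tf (Ω ω ∧ avoid S₂ ω) | tf (anyᵇ (λ w → S w ∧ E w ω))
        ... | inj₂ f | _ = ≤-trans (≤-reflexive (cong b2n f)) z≤n
        ... | inj₁ t | inj₂ f = ≤-trans (b2n-mono {Ω ω ∧ avoid S₂ ω} {Ω ω ∧ avoid S ω} (λ _ → ∧-intro (∧ˡ {Ω ω} t) (not-intro f))) (m≤m+n _ _)
        ... | inj₁ t | inj₁ h = witness (anyᵇ-elim h)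
          where
          witness : (∃ λ w → (S w ∧ E w ω) ≡ true) → b2n (Ω ω ∧ avoid S₂ ω) ≤ b2n (Ω ω ∧ avoid S ω) + sum (λ w → b2n (S₁ w) * b2n ((Ω ω ∧ avoid S₂ ω) ∧ E w ω))
          witness (w , e) = ≤-trans (≤-trans (b2n≤1 _) one) (≤-trans (term≤sum (λ w → b2n (S₁ w) * b2n ((Ω ω ∧ avoid S₂ ω) ∧ E w ω)) w) (m≤n+m _ _))
            where
            Ew = ∧ʳ {S w} e
            s₁ : S₁ w ≡ true
            s₁ = [ id , (λ s₂ → ⊥-elim (true≢false Ew (avoid-elim S₂ ω w (∧ʳ {Ω ω} t) s₂))) ]′ (cov w (∧ˡ e))
            one : 1 ≤ b2n (S₁ w) * b2n ((Ω ω ∧ avoid S₂ ω) ∧ E w ω)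
            one = ≤-reflexive (sym (cong₂ (λ a b → b2n a * b2n b) s₁ (∧-intro t Ew)))

    -- Induction on the size of `S`, split into a near part `S₁` and a far part `S₂`. Each of the at
    -- most d events of `S₁` takes at most a fraction 2/N of the labellings avoiding `S₂`. As 4d ≤
    -- N, at least half of these also avoid `S₁`, so passing from `S₂` to `S` costs a factor 2.
    conditional : ∀ m S v → # S ≤ m → N * hit S v ≤ 2 * good S
    conditional m S v h with tf (anyᵇ (λ w → S w ∧ near v w))
    ... | inj₂ none = ≤-trans (local v S (λ w s → ≢true λ nr → true≢false (anyᵇ-intro w (∧-intro s nr)) none)) (m≤m+n _ _)
    conditional zero S v h | inj₁ t = let w , e = anyᵇ-elim t in ⊥-elim (<⇒≱ (#-pos S w (∧ˡ e)) h)
    conditional (suc m) S v h | inj₁ t = ≤-trans (≤-trans (*-monoʳ-≤ N (cnt-mono sub)) (local v S₂ (λ w s → not-true (∧ʳ {S w} s)))) A≤2B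
      where
      S₁ S₂ : Fin n → Bool
      S₁ w = S w ∧ near v w
      S₂ w = S w ∧ not (near v w)
      sub : ∀ ω → ((Ω ω ∧ avoid S ω) ∧ E v ω) ≡ true → ((Ω ω ∧ avoid S₂ ω) ∧ E v ω) ≡ true
      sub ω e = let oa , ev = ∧-split {Ω ω ∧ avoid S ω} e ; o , a = ∧-split {Ω ω} oa in
        ∧-intro (∧-intro o (avoid-⊆ S S₂ ω (λ w s → ∧ˡ s) a)) ev
      S₂<S : # S₂ ≤ m
      S₂<S = let w , e = anyᵇ-elim t ; s , nr = ∧-split {S w} e in
        ≤-pred (≤-trans (subst (_≤ # S) (+-comm (# S₂) 1) (#-one S₂ S w s (λ i e → ∧ˡ e)
          (≢true (λ e′ → true≢false nr (not-true (∧ʳ {S w} e′)))))) h)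
      Σ≤ : N * sum (λ w → b2n (S₁ w) * hit S₂ w) ≤ 2 * d * good S₂
      Σ≤ = begin
        N * sum (λ w → b2n (S₁ w) * hit S₂ w) ≡⟨ sum-*ˡ N (λ w → b2n (S₁ w) * hit S₂ w) ⟨
        sum (λ w → N * (b2n (S₁ w) * hit S₂ w)) ≤⟨ sum-mono (λ w → ≤-trans (≤-reflexive (eq N (b2n (S₁ w)) (hit S₂ w))) (*-monoʳ-≤ (b2n (S₁ w)) (conditional m S₂ w S₂<S))) ⟩
        sum (λ w → b2n (S₁ w) * (2 * good S₂)) ≡⟨ sum-*ʳ (2 * good S₂) (b2n ∘ S₁) ⟩
        # S₁ * (2 * good S₂) ≤⟨ *-monoˡ-≤ (2 * good S₂) (≤-trans (#-mono {Q = near v} λ w s → ∧ʳ {S w} s) (near≤d v)) ⟩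
        d * (2 * good S₂) ≡⟨ eq′ d (good S₂) ⟩
        2 * d * good S₂ ∎
        where
        open ≤-Reasoning
        eq : ∀ a b c → a * (b * c) ≡ b * (a * c)
        eq = solve-∀
        eq′ : ∀ d g → d * (2 * g) ≡ 2 * d * g
        eq′ = solve-∀
      A≤2B : good S₂ ≤ 2 * good S
      A≤2B = *-cancelˡ-≤ N {{>-nonZero (≤-trans (≤-trans 1≤d (m≤m+n d _)) 4d≤N)}} (lin 0
               (+-mono-≤ (+-mono-≤ (*-monoʳ-≤ (2 * N) (split-good S S₁ S₂ λ w s → [ (λ x → inj₁ (∧-intro s x)) , (λ x → inj₂ (∧-intro s (not-intro x))) ]′ (tf (near v w)))) (*-monoʳ-≤ 2 Σ≤)) (*-monoˡ-≤ (good S₂) 4d≤N))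
               (eq N (good S₂) (good S) (sum (λ w → b2n (S₁ w) * hit S₂ w)) d))
        where
        eq : ∀ N a b s d → N * (2 * b) + (2 * N * a + 2 * (N * s) + 4 * d * a) ≡ N * a + (2 * N * (b + s) + 2 * (2 * d * a) + N * a) + 0
        eq = solve-∀

    -- Avoiding one more event keeps at least half of the labellings, by `conditional` and 4 ≤ N.
    good-pos : ∀ m S → # S ≤ m → 0 < good S
    good-pos m S h with tf (anyᵇ S)
    ... | inj₂ none = ≤-trans Ω-pos (cnt-mono λ ω o → ∧-intro o (avoid-intro S ω λ w s → ⊥-elim (true≢false (anyᵇ-intro w s) none)))
    good-pos zero S h | inj₁ t = let w , s = anyᵇ-elim t in ⊥-elim (<⇒≱ (#-pos S w s) h)
    good-pos (suc m) S h | inj₁ t = step (anyᵇ-elim t)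
      where
      step : (∃ λ w → S w ≡ true) → 0 < good S
      step (v , sv) = n≢0⇒n>0 λ z → n>0⇒n≢0 (good-pos m S₂ S₂<S) (zero-out z)
        where
        S₂ : Fin n → Bool
        S₂ w = S w ∧ not (w == v)
        S₂<S : # S₂ ≤ m
        S₂<S = ≤-pred (≤-trans (subst (_≤ # S) (+-comm (# S₂) 1) (#-one S₂ S v sv (λ i e → ∧ˡ e)
          (≢true (λ e′ → true≢false (==-refl v) (not-true (∧ʳ {S v} e′)))))) h)
        le : good S₂ ≤ good S + hit S₂ v
        le = ≤-trans (split-good S (_== v) S₂ λ w s → [ inj₁ , (λ x → inj₂ (∧-intro s (not-intro x))) ]′ (tf (w == v)))
               (≤-reflexive (cong (good S +_) (sum-δ v (hit S₂))))
        zero-out : good S ≡ 0 → good S₂ ≡ 0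
        zero-out z = n≤0⇒n≡0 (lin 0 (+-mono-≤ (+-mono-≤ (*-monoʳ-≤ 4 le) (*-monoˡ-≤ (hit S₂ v) 4≤N)) (+-mono-≤ (conditional m S₂ v S₂<S) (+-mono-≤ (*-monoʳ-≤ 4 (≤-reflexive z)) (z≤n {good S₂})))) (eq (good S₂) (good S) (hit S₂ v) N))
          where
          4≤N : 4 ≤ N
          4≤N = ≤-trans (*-monoʳ-≤ 4 1≤d) 4d≤N
          eq : ∀ a b x N → 0 + (4 * a + 4 * x + (N * x + (4 * b + 0))) ≡ a + (4 * (b + x) + N * x + (2 * a + (4 * 0 + a))) + 0
          eq = solve-∀

    avoid-all : ∃ λ ω → Ω ω ≡ true × (∀ v → E v ω ≡ false)
    avoid-all = let ω , e = cnt-∃ (λ ω → Ω ω ∧ avoid (λ _ → true) ω) (good-pos n (λ _ → true) (≤-reflexive (#-full n)))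
                    o , a = ∧-split {Ω ω} e
                in ω , o , λ v → avoid-elim (λ _ → true) ω v a refl

-- Random partial colourings

-- Labels below k are colours, the others leave a vertex blank.
module Labels {k K : ℕ} where

  opaque
    real : Fin (k + K) → Bool
    real l = [ (λ _ → true) , (λ _ → false) ]′ (splitAt k l)

    real-↑ˡ : ∀ i → real (i ↑ˡ K) ≡ true
    real-↑ˡ i = cong [ (λ _ → true) , (λ _ → false) ]′ (splitAt-↑ˡ k i K)

    real-↑ʳ : ∀ i → real (k ↑ʳ i) ≡ false
    real-↑ʳ i = cong [ (λ _ → true) , (λ _ → false) ]′ (splitAt-↑ʳ k K i)

    colour : ∀ l → real l ≡ true → ∃ λ (i : Fin k) → i ↑ˡ K ≡ l
    colour l e with splitAt k l in q
    ... | inj₁ i = i , splitAt⁻¹-↑ˡ q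

  #real : # real ≡ k
  #real = trans (sum-split k (b2n ∘ real)) (trans (cong₂ _+_
    (trans (#-cong {P = λ i → real (i ↑ˡ K)} real-↑ˡ) (#-full k)) (#-none {P = λ i → real (k ↑ʳ i)} real-↑ʳ)) (+-identityʳ k))

  #blank : # (not ∘ real) ≡ K
  #blank = trans (sum-split k (b2n ∘ not ∘ real)) (cong₂ _+_
    (#-none {P = λ i → not (real (i ↑ˡ K))} (cong not ∘ real-↑ˡ))
    (trans (#-cong {P = λ i → not (real (k ↑ʳ i))} (cong not ∘ real-↑ʳ)) (#-full K)))

module _ {n : ℕ} (G : Graph n) where

  grow : (Fin n → Bool) → Fin n → Bool
  grow P u = P u ∨ anyᵇ (λ w → P w ∧ adj G w u)

  ball : ℕ → Fin n → Fin n → Bool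
  ball zero    v = _== v
  ball (suc r) v = grow (ball r v)

  ball-refl : ∀ r v → ball r v v ≡ true
  ball-refl zero    v = ==-refl v
  ball-refl (suc r) v = ∨-introˡ (ball-refl r v)

  ball-suc : ∀ r {v u} → ball r v u ≡ true → ball (suc r) v u ≡ true
  ball-suc r e = ∨-introˡ e

  ball-adj : ∀ r {v u w} → ball r v u ≡ true → adj G u w ≡ true → ball (suc r) v w ≡ true
  ball-adj r {v} {u} {w} e a = ∨-introʳ {ball r v w} (anyᵇ-intro u (∧-intro e a))

  ball-meet : ∀ a b {v w u} → ball a v u ≡ true → ball b w u ≡ true → ball (a + b) v w ≡ true
  ball-meet a zero {v} {w} {u} p q = subst₂ (λ m x → ball m v x ≡ true) (sym (+-identityʳ a)) (==⇒≡ q) p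
  ball-meet a (suc b) {v} {w} {u} p q with ∨-split {ball b w u} q
  ... | inj₁ q′ = subst (λ m → ball m v w ≡ true) (sym (+-suc a b)) (ball-suc (a + b) (ball-meet a b p q′))
  ... | inj₂ q′ = let x , e = anyᵇ-elim q′ ; bx , xu = ∧-split {ball b w x} e in
        subst (λ m → ball m v w ≡ true) (sym (+-suc a b)) (ball-meet (suc a) b (ball-adj a p (adj-sym′ G xu)) bx)

  #ball : ∀ D → (∀ v → deg G v ≤ D) → ∀ r v → # (ball r v) ≤ (suc D) ^ r
  #ball D h zero    v = ≤-reflexive (#-single v)
  #ball D h (suc r) v = ≤-trans (≤-trans (#-∨ P (λ u → anyᵇ (λ w → P w ∧ adj G w u))) (≤-trans (+-monoʳ-≤ (# P) le) (≤-reflexive (eq (# P) D)))) (*-monoʳ-≤ (suc D) (#ball D h r v))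
    where
    P = ball r v
    eq : ∀ p D → p + p * D ≡ suc D * p
    eq = solve-∀
    le : # (λ u → anyᵇ (λ w → P w ∧ adj G w u)) ≤ # P * D
    le = begin
      # (λ u → anyᵇ (λ w → P w ∧ adj G w u)) ≤⟨ sum-mono (λ u → pt u) ⟩
      sum (λ u → sum (λ w → b2n (P w) * b2n (adj G w u))) ≡⟨ sum-swap (λ u w → b2n (P w) * b2n (adj G w u)) ⟩
      sum (λ w → sum (λ u → b2n (P w) * b2n (adj G w u))) ≡⟨ sum-cong (λ w → sum-*ˡ (b2n (P w)) (λ u → b2n (adj G w u))) ⟩
      sum (λ w → b2n (P w) * deg G w) ≤⟨ sum-mono (λ w → *-monoʳ-≤ (b2n (P w)) (h w)) ⟩
      sum (λ w → b2n (P w) * D) ≡⟨ sum-*ʳ D (b2n ∘ P) ⟩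
      # P * D ∎
      where
      open ≤-Reasoning
      pt : ∀ u → b2n (anyᵇ (λ w → P w ∧ adj G w u)) ≤ sum (λ w → b2n (P w) * b2n (adj G w u))
      pt u with tf (anyᵇ (λ w → P w ∧ adj G w u))
      ... | inj₂ f = ≤-trans (≤-reflexive (cong b2n f)) z≤n
      ... | inj₁ t = let w , e = anyᵇ-elim t ; p , a = ∧-split {P w} e in
            ≤-trans (≤-trans (b2n≤1 _) (≤-reflexive (sym (cong₂ (λ a b → b2n a * b2n b) p a)))) (term≤sum (λ w → b2n (P w) * b2n (adj G w u)) w)

module Labelled {n : ℕ} (G : Graph n) (k K : ℕ) where

  open Labels {k} {K} public

  q : ℕ
  q = k + K

  L : Set
  L = Vec (Fin q) n

  lab : L → Fin n → Fin q
  lab = lookup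

  lab-new : ∀ (ω : L) u c → lab (ω [ u ]≔ c) u ≡ c
  lab-new ω u c = lookup∘update u ω c

  lab-old : ∀ (ω : L) u c {w} → w ≢ u → lab (ω [ u ]≔ c) w ≡ lab ω w
  lab-old ω u c ne = lookup∘update′ ne ω c

  R : L → Fin n → Bool
  R ω u = real (lab ω u)

  clash : L → Fin n → Fin n → Bool
  clash ω u w = adj G u w ∧ R ω u ∧ (lab ω u == lab ω w)

  -- Adjacent vertices may carry the same blank; only colours must differ. Having `K` different
  -- blanks gives the blank state weight `K` against weight 1 for each colour.
  Ω : L → Bool
  Ω ω = not (anyᵇ λ u → anyᵇ λ w → clash ω u w)

  Ω-elim : ∀ ω → Ω ω ≡ true → ∀ u w → adj G u w ≡ true → R ω u ≡ true → lab ω u ≢ lab ω w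
  Ω-elim ω o u w a r e = true≢false (anyᵇ-intro u (anyᵇ-intro w (∧-intro a (∧-intro r (subst (λ x → (lab ω u == x) ≡ true) e (==-refl (lab ω u))))))) (not-true o)

  Ω-intro : ∀ ω → (∀ u w → adj G u w ≡ true → R ω u ≡ true → lab ω u ≢ lab ω w) → Ω ω ≡ true
  Ω-intro ω h = not-intro (≢true λ e → bad (anyᵇ-elim e))
    where
    bad : (∃ λ u → anyᵇ (λ w → clash ω u w) ≡ true) → ⊥
    bad (u , e) = let w , e′ = anyᵇ-elim e ; a , e″ = ∧-split {adj G u w} e′ ; r , s = ∧-split {R ω u} e″ in h u w a r (==⇒≡ s)

  Ω-update : ∀ ω u c → (∀ w → adj G u w ≡ true → real c ≡ true → lab ω w ≢ c) → Ω ω ≡ true → Ω (ω [ u ]≔ c) ≡ true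
  Ω-update ω u c fresh o = Ω-intro (ω [ u ]≔ c) h
    where
    h : ∀ x y → adj G x y ≡ true → R (ω [ u ]≔ c) x ≡ true → lab (ω [ u ]≔ c) x ≢ lab (ω [ u ]≔ c) y
    h x y a r e with x ≟ᶠ u | y ≟ᶠ u
    ... | yes refl | yes refl = adj-≢ G a refl
    ... | yes refl | no y≢ = fresh y a (subst (λ l → real l ≡ true) (lab-new ω x c) r) (trans (sym (lab-old ω x c y≢)) (trans (sym e) (lab-new ω x c)))
    ... | no x≢ | yes refl = fresh x (adj-sym′ G a) (subst (λ l → real l ≡ true) (trans e (lab-new ω y c)) r) (trans (sym (lab-old ω y c x≢)) (trans e (lab-new ω y c)))
    ... | no x≢ | no y≢ = Ω-elim ω o x y a (subst (λ l → real l ≡ true) (lab-old ω u c x≢) r) (trans (sym (lab-old ω u c x≢)) (trans e (lab-old ω u c y≢)))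

  Ω-blank : ∀ ω u c → real c ≡ false → Ω ω ≡ true → Ω (ω [ u ]≔ c) ≡ true
  Ω-blank ω u c nc = Ω-update ω u c λ w _ r → ⊥-elim (true≢false r nc)

  rc : L → Fin n → ℕ
  rc ω u = # (λ w → adj G u w ∧ R ω w)

  rc-update : ∀ ω u c y → rc (ω [ u ]≔ c) y ≤ rc ω y + 1
  rc-update ω u c y = subst (λ m → rc (ω [ u ]≔ c) y ≤ rc ω y + m) (#-single u) (#-cover (λ w → adj G y w ∧ R ω w) (_== u) (λ w → adj G y w ∧ R (ω [ u ]≔ c) w) cov)
    where
    cov : ∀ w → (adj G y w ∧ R (ω [ u ]≔ c) w) ≡ true → (adj G y w ∧ R ω w) ≡ true ⊎ (w == u) ≡ true
    cov w e with w ≟ᶠ u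
    ... | yes refl = inj₂ (==-refl u)
    ... | no ne = inj₁ (subst (λ l → (adj G y w ∧ real l) ≡ true) (lab-old ω u c ne) e)

  rc-blank : ∀ ω u c y → real c ≡ false → rc (ω [ u ]≔ c) y ≤ rc ω y
  rc-blank ω u c y nc = #-mono {P = λ w → adj G y w ∧ R (ω [ u ]≔ c) w} λ w e → h w e (w ≟ᶠ u)
    where
    h : ∀ w → (adj G y w ∧ R (ω [ u ]≔ c) w) ≡ true → Dec (w ≡ u) → (adj G y w ∧ R ω w) ≡ true
    h w e (yes refl) = ⊥-elim (true≢false (subst (λ l → real l ≡ true) (lab-new ω u c) (∧ʳ {adj G y w} e)) nc)
    h w e (no ne) = subst (λ l → (adj G y w ∧ real l) ≡ true) (lab-old ω u c ne) e

  taken : L → (Fin n → Bool) → Fin q → Bool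
  taken ω P c = anyᵇ (λ w → P w ∧ (lab ω w == c))

  untaken : ∀ ω P c → taken ω P c ≡ false → ∀ w → P w ≡ true → lab ω w ≢ c
  untaken ω P c f w p refl = true≢false (anyᵇ-intro w (∧-intro p (==-refl (lab ω w)))) f

  #taken-nbhd : ∀ ω u → # (λ c → real c ∧ taken ω (adj G u) c) ≤ rc ω u
  #taken-nbhd ω u = #-image (lab ω) (λ c → real c ∧ taken ω (adj G u) c) (λ w → adj G u w ∧ R ω w) h
    where
    h : ∀ c → (real c ∧ taken ω (adj G u) c) ≡ true → ∃ λ w → (adj G u w ∧ R ω w) ≡ true × lab ω w ≡ c
    h c e = let r , t = ∧-split {real c} e ; w , p = anyᵇ-elim t ; a , s = ∧-split {adj G u w} p in
      w , ∧-intro a (subst (λ l → real l ≡ true) (sym (==⇒≡ s)) r) , ==⇒≡ s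

  #taken : ∀ ω P → # (λ c → real c ∧ taken ω P c) ≤ # P
  #taken ω P = #-image (lab ω) (λ c → real c ∧ taken ω P c) P λ c e → let w , p = anyᵇ-elim (∧ʳ {real c} e) in w , ∧ˡ p , ==⇒≡ (∧ʳ {P w} p)

  fresh₃ : L → (P₁ P₂ P₃ : Fin n → Bool) → Fin q → Bool
  fresh₃ ω P₁ P₂ P₃ c = real c ∧ not (taken ω P₁ c) ∧ not (taken ω P₂ c) ∧ not (taken ω P₃ c)

  #fresh₃ : ∀ ω P₁ P₂ P₃ {m₁ m₂ m₃} → # (λ c → real c ∧ taken ω P₁ c) ≤ m₁ → # (λ c → real c ∧ taken ω P₂ c) ≤ m₂ → # (λ c → real c ∧ taken ω P₃ c) ≤ m₃ →
            k ≤ # (fresh₃ ω P₁ P₂ P₃) + (m₁ + (m₂ + m₃))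
  #fresh₃ ω P₁ P₂ P₃ {m₁} {m₂} {m₃} h₁ h₂ h₃ = begin
    k ≡⟨ #real ⟨
    # real ≤⟨ #-cover (fresh₃ ω P₁ P₂ P₃) (λ c → t₁ c ∨ (t₂ c ∨ t₃ c)) real cov ⟩
    # (fresh₃ ω P₁ P₂ P₃) + # (λ c → t₁ c ∨ (t₂ c ∨ t₃ c)) ≤⟨ +-monoʳ-≤ _ (≤-trans (#-∨ t₁ (λ c → t₂ c ∨ t₃ c)) (+-mono-≤ h₁ (≤-trans (#-∨ t₂ t₃) (+-mono-≤ h₂ h₃)))) ⟩
    # (fresh₃ ω P₁ P₂ P₃) + (m₁ + (m₂ + m₃)) ∎
    where
    open ≤-Reasoning
    t₁ t₂ t₃ : Fin q → Bool
    t₁ c = real c ∧ taken ω P₁ c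
    t₂ c = real c ∧ taken ω P₂ c
    t₃ c = real c ∧ taken ω P₃ c
    cov : ∀ c → real c ≡ true → fresh₃ ω P₁ P₂ P₃ c ≡ true ⊎ (t₁ c ∨ (t₂ c ∨ t₃ c)) ≡ true
    cov c r with tf (taken ω P₁ c) | tf (taken ω P₂ c) | tf (taken ω P₃ c)
    ... | inj₁ t | _ | _ = inj₂ (∨-introˡ (∧-intro r t))
    ... | inj₂ _ | inj₁ t | _ = inj₂ (∨-introʳ {t₁ c} (∨-introˡ (∧-intro r t)))
    ... | inj₂ _ | inj₂ _ | inj₁ t = inj₂ (∨-introʳ {t₁ c} (∨-introʳ {t₂ c} (∧-intro r t)))
    ... | inj₂ a | inj₂ b | inj₂ d = inj₁ (∧-intro r (∧-intro (not-intro a) (∧-intro (not-intro b) (not-intro d))))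

  record Fresh (ω : L) (P₁ P₂ P₃ : Fin n → Bool) (c : Fin q) : Set where
    field
      isReal : real c ≡ true
      f₁ : ∀ w → P₁ w ≡ true → lab ω w ≢ c
      f₂ : ∀ w → P₂ w ≡ true → lab ω w ≢ c
      f₃ : ∀ w → P₃ w ≡ true → lab ω w ≢ c

  fresh₃-elim : ∀ ω P₁ P₂ P₃ c → fresh₃ ω P₁ P₂ P₃ c ≡ true → Fresh ω P₁ P₂ P₃ c
  fresh₃-elim ω P₁ P₂ P₃ c e =
    let r , e₁ = ∧-split {real c} e ; a , e₂ = ∧-split {not (taken ω P₁ c)} e₁ ; b , d = ∧-split {not (taken ω P₂ c)} e₂ in
    record { isReal = r ; f₁ = untaken ω P₁ c (not-true a) ; f₂ = untaken ω P₂ c (not-true b) ; f₃ = untaken ω P₃ c (not-true d) }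

  Ω-pair : ∀ ω u w c → adj G u w ≡ false → (∀ x → adj G u x ≡ true → lab ω x ≢ c) → (∀ x → adj G w x ≡ true → lab ω x ≢ c) →
           Ω ω ≡ true → Ω ((ω [ u ]≔ c) [ w ]≔ c) ≡ true
  Ω-pair ω u w c nuw fu fw o = Ω-update (ω [ u ]≔ c) w c
    (λ x a _ e → fw x a (trans (sym (lab-old ω u c (differ (adj G w) a (trans (adj-sym G w u) nuw)))) e))
    (Ω-update ω u c (λ x a _ → fu x a) o)

  -- The slack `r` grows during a series of alterations, since a recoloured pair can add two
  -- coloured neighbours to a vertex.
  valid : ℕ → ℕ → Fin n → L → Bool
  valid θ r v ω = not (anyᵇ λ u → ball G 2 v u ∧ not (rc ω u ≤ᵇ θ + r))

  valid-elim : ∀ θ r v ω → valid θ r v ω ≡ true → ∀ u → ball G 2 v u ≡ true → rc ω u ≤ θ + r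
  valid-elim θ r v ω e u b with tf (rc ω u ≤ᵇ θ + r)
  ... | inj₁ t = ≤ᵇ-true t
  ... | inj₂ f = ⊥-elim (true≢false (anyᵇ-intro u (∧-intro b (not-intro f))) (not-true e))

  valid-intro : ∀ θ r v ω → (∀ u → ball G 2 v u ≡ true → rc ω u ≤ θ + r) → valid θ r v ω ≡ true
  valid-intro θ r v ω h = not-intro (≢true λ e → let u , p = anyᵇ-elim e ; b , q = ∧-split {ball G 2 v u} p in true≢false (true-≤ᵇ (h u b)) (not-true q))

  valid-pair : ∀ θ r v ω u w c d → valid θ r v ω ≡ true → valid θ (r + 2) v ((ω [ u ]≔ c) [ w ]≔ d) ≡ true
  valid-pair θ r v ω u w c d e = valid-intro θ (r + 2) v ((ω [ u ]≔ c) [ w ]≔ d) λ y b →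
    ≤-trans (rc-update (ω [ u ]≔ c) w d y) (≤-trans (+-monoˡ-≤ 1 (rc-update ω u c y))
      (≤-trans (≤-reflexive (+-assoc (rc ω y) 1 1)) (≤-trans (+-monoˡ-≤ 2 (valid-elim θ r v ω e y b)) (≤-reflexive (+-assoc θ r 2)))))

  valid-blank : ∀ θ r v ω u c → real c ≡ false → valid θ r v ω ≡ true → valid θ r v (ω [ u ]≔ c) ≡ true
  valid-blank θ r v ω u c nc e = valid-intro θ r v (ω [ u ]≔ c) λ y b → ≤-trans (rc-blank ω u c y nc) (valid-elim θ r v ω e y b)

  -- All alterations made for `v` stay within distance 2. The `H` in mind is the avoidance of events
  -- too far away to notice them.
  Inv : Fin n → (L → Bool) → Set
  Inv v H = ∀ ω u c → ball G 2 v u ≡ true → H (ω [ u ]≔ c) ≡ H ω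

-- Rare events by repeated alteration

chain : ∀ r (A : ℕ → ℕ) t → (∀ j → j < t → A j * r ≤ A (suc j)) → A 0 * r ^ t ≤ A t
chain r A zero    h = ≤-reflexive (*-identityʳ (A 0))
chain r A (suc t) h = begin
  A 0 * r ^ suc t     ≡⟨ eq (A 0) r (r ^ t) ⟩
  A 0 * r ^ t * r     ≤⟨ *-monoˡ-≤ r (chain r A t (λ j j<t → h j (m<n⇒m<1+n j<t))) ⟩
  A t * r             ≤⟨ h t ≤-refl ⟩
  A (suc t)           ∎
  where
  open ≤-Reasoning
  eq : ∀ a r p → a * (r * p) ≡ a * p * r
  eq = solve-∀

ratio : ∀ r {a b X Y} → 0 < Y → r * Y ≤ X → a * X ≤ b * Y → a * r ≤ b
ratio r {a} {b} {X} {Y} 0<Y h e = *-cancelʳ-≤ (a * r) b Y {{>-nonZero 0<Y}} (begin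
  a * r * Y   ≡⟨ *-assoc a r Y ⟩
  a * (r * Y) ≤⟨ *-monoʳ-≤ a h ⟩
  a * X       ≤⟨ e ⟩
  b * Y       ∎)
  where open ≤-Reasoning

module Counts {n k K : ℕ} (G : Graph n) (deg≤ : ∀ v → deg G v ≤ suc k) (v : Fin n)
  (H : Vec (Fin (k + K)) n → Bool) where

  open Labelled G k K

  module _ (inv : Inv v H) where

    crowded : ℕ → L → Bool
    crowded J ω = (Ω ω ∧ H ω) ∧ (J ≤ᵇ rc ω v)

    -- Blanking one of the at least J coloured neighbours of v.
    crowded-step : ∀ J → cnt (crowded (suc J)) * (suc J * K) ≤ cnt (crowded J) * (suc k * k)
    crowded-step J = begin
      cnt (crowded (suc J)) * (suc J * K) ≡⟨ Sum-*ʳ (suc J * K) (λ ω → b2n (crowded (suc J) ω)) ⟨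
      Sum (λ ω → b2n (crowded (suc J) ω) * (suc J * K)) ≤⟨ Sum-mono pt ⟩
      Sum (λ ω → sum (λ u → b2n (P u ω) * K)) ≡⟨ Sum-sum (λ ω u → b2n (P u ω) * K) ⟩
      sum (λ u → Sum (λ ω → b2n (P u ω) * K)) ≡⟨ sum-cong (λ u → Sum-*ʳ K (λ ω → b2n (P u ω))) ⟩
      sum (λ u → cnt (P u) * K) ≤⟨ sum-mono per-u ⟩
      sum (λ u → b2n (adj G v u) * (cnt (crowded J) * k)) ≡⟨ sum-*ʳ (cnt (crowded J) * k) (λ u → b2n (adj G v u)) ⟩
      deg G v * (cnt (crowded J) * k) ≤⟨ *-monoˡ-≤ _ (deg≤ v) ⟩
      suc k * (cnt (crowded J) * k) ≡⟨ eq (suc k) (cnt (crowded J)) k ⟩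
      cnt (crowded J) * (suc k * k) ∎
      where
      open ≤-Reasoning
      eq : ∀ a b c → a * (b * c) ≡ b * (a * c)
      eq = solve-∀
      P : Fin n → L → Bool
      P u ω = crowded (suc J) ω ∧ (adj G v u ∧ R ω u)
      pt : ∀ ω → b2n (crowded (suc J) ω) * (suc J * K) ≤ sum (λ u → b2n (P u ω) * K)
      pt ω with crowded (suc J) ω in e
      ... | false = z≤n
      ... | true = ≤-trans (≤-reflexive (+-identityʳ _)) (≤-trans (*-monoˡ-≤ K {suc J} {rc ω v} (≤ᵇ-true (∧ʳ {Ω ω ∧ H ω} e))) (≤-reflexive (sym (sum-*ʳ K (λ u → b2n (adj G v u ∧ R ω u))))))
      per-u : ∀ u → cnt (P u) * K ≤ b2n (adj G v u) * (cnt (crowded J) * k)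
      per-u u with tf (adj G v u)
      ... | inj₂ f = ≤-trans (≤-reflexive (cong (_* K) (n≤0⇒n≡0 (≤-trans (cnt-mono {P = P u} {Q = λ _ → false} (λ ω e → ⊥-elim (true≢false (∧ˡ (∧ʳ {crowded (suc J) ω} e)) f))) (≤-reflexive (Sum-zero q n)))))) z≤n
      ... | inj₁ t = ≤-trans (subst (λ m → cnt (P u) * K ≤ cnt (crowded J) * m) #real
                (recolour₁ (P u) (crowded J) K u real blanks (λ ω e → ∧ʳ {adj G v u} (∧ʳ {crowded (suc J) ω} e))))
              (≤-reflexive (sym (trans (cong (λ b → b2n b * (cnt (crowded J) * k)) t) (*-identityˡ _))))
        where
        bu : ball G 2 v u ≡ true
        bu = ball-suc G 1 (ball-adj G 0 (ball-refl G 0 v) t)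
        blanks : ∀ ω → P u ω ≡ true → K ≤ # (λ c → crowded J (ω [ u ]≔ c))
        blanks ω e = ≤-trans (≤-reflexive (sym #blank)) (#-mono λ c nc →
          let e₁ , _ = ∧-split {crowded (suc J) ω} e ; oh , cr = ∧-split {Ω ω ∧ H ω} e₁ ; o , h = ∧-split {Ω ω} oh in
          ∧-intro (∧-intro (Ω-blank ω u c (not-true nc) o) (trans (inv ω u c bu) h)) (true-≤ᵇ (drop c (≤ᵇ-true cr))))
          where
          drop : ∀ c → suc J ≤ rc ω v → J ≤ rc (ω [ u ]≔ c) v
          drop c h = ≤-pred (≤-trans h (≤-trans (subst (λ m → rc ω v ≤ rc (ω [ u ]≔ c) v + m) (#-single u)
            (#-cover (λ w → adj G v w ∧ R (ω [ u ]≔ c) w) (_== u) (λ w → adj G v w ∧ R ω w) cov)) (≤-reflexive (+-comm _ 1))))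
            where
            cov : ∀ w → (adj G v w ∧ R ω w) ≡ true → (adj G v w ∧ R (ω [ u ]≔ c) w) ≡ true ⊎ (w == u) ≡ true
            cov w e with w ≟ᶠ u
            ... | yes refl = inj₂ (==-refl u)
            ... | no ne = inj₁ (subst (λ l → (adj G v w ∧ real l) ≡ true) (sym (lab-old ω u c ne)) e)

    -- Beyond `J`, each further coloured neighbour halves the count: blanking offers at least J * K
    -- choices against at most (k + 1) * k ways to undo it.
    crowded-bound : ∀ J I → 2 * (suc k * k) ≤ J * K → 0 < k → cnt (crowded (J + I)) * 2 ^ I ≤ cnt (λ ω → Ω ω ∧ H ω)
    crowded-bound J I h 0<k = ≤-trans (go I) (cnt-mono {P = crowded J} {Q = λ ω → Ω ω ∧ H ω} λ ω e → ∧ˡ e)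
      where
      go : ∀ I → cnt (crowded (J + I)) * 2 ^ I ≤ cnt (crowded J)
      go zero = ≤-reflexive (trans (*-identityʳ _) (cong (cnt ∘ crowded) (+-identityʳ J)))
      go (suc I) = begin
        cnt (crowded (J + suc I)) * (2 * 2 ^ I) ≡⟨ cong (λ m → cnt (crowded m) * (2 * 2 ^ I)) (+-suc J I) ⟩
        cnt (crowded (suc (J + I))) * (2 * 2 ^ I) ≡⟨ *-assoc (cnt (crowded (suc (J + I)))) 2 (2 ^ I) ⟨
        cnt (crowded (suc (J + I))) * 2 * 2 ^ I ≤⟨ *-monoˡ-≤ (2 ^ I) (ratio 2 {cnt (crowded (suc (J + I)))} {cnt (crowded (J + I))} {suc (J + I) * K} {suc k * k} (≤-trans 0<k (m≤m+n k _)) (≤-trans h (*-monoˡ-≤ K (≤-trans (m≤m+n J I) (n≤1+n (J + I))))) (crowded-step (J + I))) ⟩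
        cnt (crowded (J + I)) * 2 ^ I ≤⟨ go I ⟩
        cnt (crowded J) ∎
        where open ≤-Reasoning

  shares : L → Fin n → Bool
  shares ω u = (adj G v u ∧ R ω u) ∧ anyᵇ (λ w → adj G v w ∧ (lab ω u == lab ω w) ∧ not (u == w))

  shares-intro : ∀ ω u w → adj G v u ≡ true → R ω u ≡ true → adj G v w ≡ true → lab ω u ≡ lab ω w → u ≢ w → shares ω u ≡ true
  shares-intro ω u w a r a′ e ne = ∧-intro (∧-intro a r) (anyᵇ-intro w (∧-intro a′ (∧-intro (subst (λ x → (lab ω u == x) ≡ true) e (==-refl (lab ω u))) (not-intro (≢⇒== ne)))))

  shares-elim : ∀ ω u → shares ω u ≡ true → adj G v u ≡ true × R ω u ≡ true × ∃ λ w → adj G v w ≡ true × lab ω u ≡ lab ω w × u ≢ w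
  shares-elim ω u e = let x , y = ∧-split {adj G v u ∧ R ω u} e ; a , r = ∧-split {adj G v u} x
                          w , p = anyᵇ-elim y ; a′ , p₁ = ∧-split {adj G v w} p ; s , ne = ∧-split {lab ω u == lab ω w} p₁
                      in a , r , w , a′ , ==⇒≡ s , ==f⇒≢ (not-true ne)

  module _ (θ : ℕ) where

    scarce : ℕ → ℕ → L → Bool
    scarce m r ω = (Ω ω ∧ H ω) ∧ valid θ r v ω ∧ (# (shares ω) ≤ᵇ m)

    -- Holds for a pair just recoloured and makes it recognisable: `u` determines `w`, and `u` is
    -- one of the at most m + 2 vertices that share a colour. So locating the pair costs only m + 2.
    private-pair : Fin n → Fin n → L → Bool
    private-pair u w ω = (R ω u ∧ (lab ω u == lab ω w)) ∧ not (anyᵇ λ x → adj G v x ∧ not (x == u) ∧ not (x == w) ∧ (lab ω x == lab ω u))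

    module _ (inv : Inv v H) where

      -- Recolouring a non-adjacent pair of neighbours of v with a common colour that is new around both and around v.
      scarce-step : ∀ m r X → (X + (θ + r + (θ + r + (θ + r))) ≤ k) → cnt (scarce m r) * (nonedges G v * X) ≤ cnt (scarce (m + 2) (r + 2)) * ((m + 2) * (q * q))
      scarce-step m r X hX = begin
        cnt (scarce m r) * (nonedges G v * X) ≡⟨ eq (cnt (scarce m r)) (nonedges G v) X ⟩
        nonedges G v * (cnt (scarce m r) * X) ≡⟨ sum-*ʳ (cnt (scarce m r) * X) (λ u → # (non G v u)) ⟨
        sum (λ u → # (non G v u) * (cnt (scarce m r) * X)) ≡⟨ sum-cong (λ u → sum-*ʳ (cnt (scarce m r) * X) (λ w → b2n (non G v u w))) ⟨
        sum (λ u → sum (λ w → b2n (non G v u w) * (cnt (scarce m r) * X))) ≤⟨ sum-mono (λ u → sum-mono (λ w → per-pair u w)) ⟩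
        sum (λ u → sum (λ w → cnt (Q u w) * (q * q))) ≡⟨ sum-cong (λ u → sum-*ʳ (q * q) (λ w → cnt (Q u w))) ⟩
        sum (λ u → sum (λ w → cnt (Q u w)) * (q * q)) ≡⟨ sum-*ʳ (q * q) (λ u → sum (λ w → cnt (Q u w))) ⟩
        sum (λ u → sum (λ w → cnt (Q u w))) * (q * q) ≡⟨ cong (_* (q * q)) (sum-cong (λ u → Sum-sum (λ ω w → b2n (Q u w ω)))) ⟨
        sum (λ u → Sum (λ ω → sum (λ w → b2n (Q u w ω)))) * (q * q) ≡⟨ cong (_* (q * q)) (Sum-sum (λ ω u → sum (λ w → b2n (Q u w ω)))) ⟨
        Sum (λ ω → sum (λ u → sum (λ w → b2n (Q u w ω)))) * (q * q) ≤⟨ *-monoˡ-≤ (q * q) (Sum-mono reverse) ⟩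
        Sum (λ ω → b2n (A′ ω) * (m + 2)) * (q * q) ≡⟨ cong (_* (q * q)) (Sum-*ʳ (m + 2) (λ ω → b2n (A′ ω))) ⟩
        cnt A′ * (m + 2) * (q * q) ≡⟨ *-assoc (cnt A′) (m + 2) (q * q) ⟩
        cnt A′ * ((m + 2) * (q * q)) ∎
        where
        open ≤-Reasoning
        eq : ∀ a b c → a * (b * c) ≡ b * (a * c)
        eq = solve-∀
        A′ = scarce (m + 2) (r + 2)
        Q : Fin n → Fin n → L → Bool
        Q u w ω = A′ ω ∧ non G v u w ∧ private-pair u w ω
        reverse : ∀ ω → sum (λ u → sum (λ w → b2n (Q u w ω))) ≤ b2n (A′ ω) * (m + 2)
        reverse ω with A′ ω in e
        ... | false = ≤-reflexive (trans (sum-cong {n} (λ u → sum-zero n)) (sum-zero n))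
        ... | true = ≤-trans (sum-mono (λ u → one u)) (≤-trans (≤ᵇ-true (∧ʳ {valid θ (r + 2) v ω} (∧ʳ {Ω ω ∧ H ω} e))) (≤-reflexive (sym (+-identityʳ _))))
          where
          one : ∀ u → # (λ w → non G v u w ∧ private-pair u w ω) ≤ b2n (shares ω u)
          one u with tf (anyᵇ (λ w → non G v u w ∧ private-pair u w ω))
          ... | inj₂ f = ≤-trans (≤-reflexive (#-none {P = λ w → non G v u w ∧ private-pair u w ω} λ w → ≢true λ e → true≢false (anyᵇ-intro w e) f)) z≤n
          ... | inj₁ t = uniq (anyᵇ-elim t)
            where
            uniq : (∃ λ w → (non G v u w ∧ private-pair u w ω) ≡ true) → # (λ w → non G v u w ∧ private-pair u w ω) ≤ b2n (shares ω u)
            uniq (w , e) = ≤-trans (subst (# (λ w → non G v u w ∧ private-pair u w ω) ≤_) (#-single w) (#-mono same)) (≤-reflexive (sym (cong b2n sh)))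
              where
              nn = ∧ˡ {non G v u w} e
              pp = ∧ʳ {non G v u w} e
              vu = ∧ˡ {adj G v u} (∧ˡ {adj G v u ∧ adj G v w} nn)
              vw = ∧ʳ {adj G v u} (∧ˡ {adj G v u ∧ adj G v w} nn)
              u≢w = ==f⇒≢ (not-true (∧ʳ {not (adj G u w)} (∧ʳ {adj G v u ∧ adj G v w} nn)))
              rl = ∧-split {R ω u} (∧ˡ {R ω u ∧ (lab ω u == lab ω w)} pp)
              nobody = not-true (∧ʳ {R ω u ∧ (lab ω u == lab ω w)} pp)
              sh : shares ω u ≡ true
              sh = shares-intro ω u w vu (proj₁ rl) vw (==⇒≡ (proj₂ rl)) u≢w
              same : ∀ x → (non G v u x ∧ private-pair u x ω) ≡ true → (x == w) ≡ true
              same x e′ with tf (x == w)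
              ... | inj₁ t = t
              ... | inj₂ f = ⊥-elim (true≢false (anyᵇ-intro x (∧-intro vx (∧-intro (not-intro (≢⇒== (u≢x ∘ sym))) (∧-intro (not-intro f) xl)))) nobody)
                where
                nn′ = ∧ˡ {non G v u x} e′
                pp′ = ∧ʳ {non G v u x} e′
                vx = ∧ʳ {adj G v u} (∧ˡ {adj G v u ∧ adj G v x} nn′)
                u≢x = ==f⇒≢ (not-true (∧ʳ {not (adj G u x)} (∧ʳ {adj G v u ∧ adj G v x} nn′)))
                xl : (lab ω x == lab ω u) ≡ true
                xl = subst (λ l → (lab ω x == l) ≡ true) (sym (==⇒≡ (∧ʳ {R ω u} (∧ˡ {R ω u ∧ (lab ω u == lab ω x)} pp′)))) (==-refl (lab ω x))
        per-pair : ∀ u w → b2n (non G v u w) * (cnt (scarce m r) * X) ≤ cnt (Q u w) * (q * q)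
        per-pair u w with tf (non G v u w)
        ... | inj₂ f = ≤-trans (≤-reflexive (cong (λ b → b2n b * (cnt (scarce m r) * X)) f)) z≤n
        ... | inj₁ nn = ≤-trans (≤-reflexive (trans (cong (λ b → b2n b * (cnt (scarce m r) * X)) nn) (*-identityˡ _))) (recolour₂ (scarce m r) (Q u w) X u w forward)
          where
          vu = ∧ˡ {adj G v u} (∧ˡ {adj G v u ∧ adj G v w} nn)
          vw = ∧ʳ {adj G v u} (∧ˡ {adj G v u ∧ adj G v w} nn)
          nuw = not-true (∧ˡ {not (adj G u w)} (∧ʳ {adj G v u ∧ adj G v w} nn))
          u≢w = ==f⇒≢ (not-true (∧ʳ {not (adj G u w)} (∧ʳ {adj G v u ∧ adj G v w} nn)))
          bu : ball G 2 v u ≡ true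
          bu = ball-suc G 1 (ball-adj G 0 (ball-refl G 0 v) vu)
          bw : ball G 2 v w ≡ true
          bw = ball-suc G 1 (ball-adj G 0 (ball-refl G 0 v) vw)
          forward : ∀ ω → scarce m r ω ≡ true → X ≤ # (λ c → Q u w ((ω [ u ]≔ c) [ w ]≔ c))
          -- A colour new around `u` and `w` keeps the labelling proper. New around `v` as well, it
          -- draws no other neighbour of `v` into a sharing.
          forward ω e = ≤-trans (+-cancelʳ-≤ (θ + r + (θ + r + (θ + r))) X _ (≤-trans hX (#fresh₃ ω (adj G u) (adj G w) (adj G v)
              (≤-trans (#taken-nbhd ω u) (va u bu)) (≤-trans (#taken-nbhd ω w) (va w bw)) (≤-trans (#taken-nbhd ω v) (va v (ball-refl G 2 v))))))
              (#-mono λ c fc → good c (fresh₃-elim ω (adj G u) (adj G w) (adj G v) c fc))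
            where
            oh = ∧-split {Ω ω} (∧ˡ {Ω ω ∧ H ω} e)
            vs = ∧-split {valid θ r v ω} (∧ʳ {Ω ω ∧ H ω} e)
            va = valid-elim θ r v ω (proj₁ vs)
            good : ∀ c → Fresh ω (adj G u) (adj G w) (adj G v) c → Q u w ((ω [ u ]≔ c) [ w ]≔ c) ≡ true
            good c fr = ∧-intro (∧-intro (∧-intro (Ω-pair ω u w c nuw f₁ f₂ (proj₁ oh)) (trans (inv (ω [ u ]≔ c) w c bw) (trans (inv ω u c bu) (proj₂ oh))))
                          (∧-intro (valid-pair θ r v ω u w c c (proj₁ vs)) (true-≤ᵇ (≤-trans more (+-monoˡ-≤ 2 (≤ᵇ-true (proj₂ vs)))))))
                        (∧-intro nn (∧-intro (∧-intro (subst (λ l → real l ≡ true) (sym lu) isReal) (subst₂ (λ a b → (a == b) ≡ true) (sym lu) (sym lw) (==-refl c)))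
                          (not-intro (≢true λ e → let x , p = anyᵇ-elim e ; vx , p₁ = ∧-split {adj G v x} p ; nu , p₂ = ∧-split {not (x == u)} p₁ ; nw , s = ∧-split {not (x == w)} p₂ in
                             f₃ x vx (trans (sym (lx (==f⇒≢ (not-true nu)) (==f⇒≢ (not-true nw)))) (trans (==⇒≡ s) lu))))))
              where
              open Fresh fr
              ω′ : L
              ω′ = (ω [ u ]≔ c) [ w ]≔ c
              lu : lab ω′ u ≡ c
              lu = trans (lab-old (ω [ u ]≔ c) w c u≢w) (lab-new ω u c)
              lw : lab ω′ w ≡ c
              lw = lab-new (ω [ u ]≔ c) w c
              lx : ∀ {x} → x ≢ u → x ≢ w → lab ω′ x ≡ lab ω x
              lx nu nw = trans (lab-old (ω [ u ]≔ c) w c nw) (lab-old ω u c nu)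
              more : # (shares ω′) ≤ # (shares ω) + 2
              more = ≤-trans (#-cover (shares ω) (λ x → (x == u) ∨ (x == w)) (shares ω′) cov)
                       (+-monoʳ-≤ (# (shares ω)) (≤-trans (#-∨ (_== u) (_== w)) (≤-reflexive (cong₂ _+_ (#-single u) (#-single w)))))
                where
                cov : ∀ x → shares ω′ x ≡ true → shares ω x ≡ true ⊎ ((x == u) ∨ (x == w)) ≡ true
                cov x e with x ≟ᶠ u | x ≟ᶠ w
                ... | yes refl | _ = inj₂ (∨-introˡ (==-refl x))
                ... | no _ | yes refl = inj₂ (∨-introʳ {x == u} (==-refl x))
                ... | no x≢u | no x≢w with shares-elim ω′ x e
                ... | vx , rx , y , vy , s , x≢y with y ≟ᶠ u | y ≟ᶠ w
                ... | yes refl | _ = ⊥-elim (f₃ x vx (trans (sym (lx x≢u x≢w)) (trans s lu)))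
                ... | no _ | yes refl = ⊥-elim (f₃ x vx (trans (sym (lx x≢u x≢w)) (trans s lw)))
                ... | no y≢u | no y≢w = inj₁ (shares-intro ω x y vx (subst (λ l → real l ≡ true) (lx x≢u x≢w) rx) vy (trans (sym (lx x≢u x≢w)) (trans s (lx y≢u y≢w))) x≢y)

#≤1 : ∀ {n} (P : Fin n → Bool) → (∀ x y → P x ≡ true → P y ≡ true → x ≡ y) → # P ≤ 1
#≤1 P h with tf (anyᵇ P)
... | inj₂ f = ≤-trans (≤-reflexive (#-none {P = P} λ x → ≢true λ e → true≢false (anyᵇ-intro x e) f)) z≤n
... | inj₁ t = let x , p = anyᵇ-elim t in
      subst (# P ≤_) (#-single x) (#-mono λ y q → subst (λ w → (y == w) ≡ true) (h y x q p) (==-refl y))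

module StarCounts {n k K : ℕ} (G : Graph n) (v : Fin n) (st : Star G k v) (H : Vec (Fin (k + K)) n → Bool) (θ : ℕ) where

  open Star st
  open Units units
  open Labelled G k K

  J : ℕ
  J = k / 50

  z-C : ∀ i → C (z i) ≡ true
  z-C i = ∧ˡ (z∈ i)

  z-adj : ∀ i → adj G v (z i) ≡ true
  z-adj i = ∧ʳ {C (z i)} (z∈ i)

  lightOf : ∀ i l → lightᵇ G k C (z i) l ≡ true → adj G (z i) l ≡ true × C l ≡ false × inside G C l + # C ≤ k + 8
  lightOf i l e = let x , y = ∧-split {adj G (z i) l ∧ not (C l)} e ; p , q = ∧-split {adj G (z i) l} x in p , not-true q , ≤ᵇ-true y

  -- The lights are matched with `C` minus the centres, so that recolouring a partner never disturbs
  -- a centre.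
  X : Fin n → Bool
  X x = C x ∧ not (centres x)

  X-C : ∀ {x} → X x ≡ true → C x ≡ true
  X-C e = ∧ˡ e

  X-z : ∀ {x} → X x ≡ true → ∀ i → z i ≢ x
  X-z {x} e i = differ centres (anyᵇ-intro i (==-refl (z i))) (not-true (∧ʳ {C x} e))

  matched : L → Fin n → Bool
  matched ω l = R ω l ∧ anyᵇ (λ x → X x ∧ (lab ω x == lab ω l))

  sat : L → Fin J → Bool
  sat ω i = not (R ω (z i)) ∧ matched ω (a i) ∧ matched ω (b i)

  poor : ℕ → ℕ → L → Bool
  poor m r ω = (Ω ω ∧ H ω) ∧ valid θ r v ω ∧ (# (sat ω) ≤ᵇ m)

  others : L → Fin J → Fin J → Bool
  others ω i i′ = not (i′ == i) ∧ sat ω i′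

  -- The state while unit `i` is being satisfied: its centre is blank, the other units are still
  -- poor, and `e` records that `a i` is already matched.
  stage : Fin J → Bool → ℕ → ℕ → L → Bool
  stage i e m r ω = (Ω ω ∧ H ω) ∧ valid θ r v ω ∧ (# (others ω i) ≤ᵇ m) ∧ not (R ω (z i)) ∧ (not e ∨ matched ω (a i))

  record Stage (i : Fin J) (e : Bool) (m r : ℕ) (ω : L) : Set where
    field
      o  : Ω ω ≡ true
      h  : H ω ≡ true
      va : valid θ r v ω ≡ true
      ot : # (others ω i) ≤ m
      bl : R ω (z i) ≡ false
      ma : e ≡ true → matched ω (a i) ≡ true

  stage-elim : ∀ i e m r ω → stage i e m r ω ≡ true → Stage i e m r ω
  stage-elim i e m r ω s =
    let oh , s₁ = ∧-split {Ω ω ∧ H ω} s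
        va , s₂ = ∧-split {valid θ r v ω} s₁
        ot , s₃ = ∧-split {# (others ω i) ≤ᵇ m} s₂
        bl , ma = ∧-split {not (R ω (z i))} s₃
    in record { o = ∧ˡ {Ω ω} oh ; h = ∧ʳ {Ω ω} oh ; va = va ; ot = ≤ᵇ-true ot ; bl = not-true bl
              ; ma = λ e≡ → [ (λ ne → ⊥-elim (true≢false e≡ (not-true ne))) , id ]′ (∨-split {not e} ma) }

  stage-intro : ∀ i e m r ω → Stage i e m r ω → stage i e m r ω ≡ true
  stage-intro i e m r ω s = ∧-intro (∧-intro o h) (∧-intro va (∧-intro (true-≤ᵇ ot) (∧-intro (not-intro bl) (last (tf e)))))
    where
    open Stage s
    last : e ≡ true ⊎ e ≡ false → (not e ∨ matched ω (a i)) ≡ true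
    last (inj₁ t) = ∨-introʳ {not e} (ma t)
    last (inj₂ f) = ∨-introˡ (not-intro f)

  unique-in-C : ∀ ω → Ω ω ≡ true → ∀ c → real c ≡ true → ∀ x y → C x ≡ true → C y ≡ true → lab ω x ≡ c → lab ω y ≡ c → x ≡ y
  unique-in-C ω o c rc x y cx cy ex ey with x ≟ᶠ y
  ... | yes p = p
  ... | no ne = ⊥-elim (Ω-elim ω o x y (clique x y cx cy ne) (subst (λ l → real l ≡ true) (sym ex) rc) (trans ex (sym ey)))

  ball-z : ∀ i → ball G 1 v (z i) ≡ true
  ball-z i = ball-adj G 0 (ball-refl G 0 v) (z-adj i)

  ball-X : ∀ i {x} → X x ≡ true → ball G 2 v x ≡ true
  ball-X i xx = ball-adj G 1 (ball-z i) (clique (z i) _ (z-C i) (X-C xx) (X-z xx i))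

  module _ (inv : Inv v H) where

    -- The old label of `z i` is arbitrary, so undoing costs `q`. Neither `X` nor any light contains
    -- `z i`, so no other unit becomes satisfied.
    blank-centre : ∀ i m r → cnt (poor m r) * K ≤ cnt (stage i false m r) * q
    blank-centre i m r = subst (λ y → cnt (poor m r) * K ≤ cnt (stage i false m r) * y) (#-full q)
      (recolour₁ (poor m r) (stage i false m r) K (z i) (λ _ → true) fwd (λ _ _ → refl))
      where
      fwd : ∀ ω → poor m r ω ≡ true → K ≤ # (λ c → stage i false m r (ω [ z i ]≔ c))
      fwd ω e = ≤-trans (≤-reflexive (sym #blank)) (#-mono λ c nc → stage-intro i false m r (ω [ z i ]≔ c) (mk c (not-true nc)))
        where
        oh = ∧-split {Ω ω} (∧ˡ {Ω ω ∧ H ω} e)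
        vs = ∧-split {valid θ r v ω} (∧ʳ {Ω ω ∧ H ω} e)
        mk : ∀ c → real c ≡ false → Stage i false m r (ω [ z i ]≔ c)
        mk c nc = record
          { o = Ω-blank ω (z i) c nc (proj₁ oh) ; h = trans (inv ω (z i) c (ball-suc G 1 (ball-z i))) (proj₂ oh)
          ; va = valid-blank θ r v ω (z i) c nc (proj₁ vs)
          ; ot = ≤-trans (#-mono {Q = sat ω} λ i′ e′ → keep i′ (==f⇒≢ (not-true (∧ˡ {not (i′ == i)} e′))) (∧ʳ {not (i′ == i)} e′)) (≤ᵇ-true (proj₂ vs))
          ; bl = trans (cong real (lab-new ω (z i) c)) nc ; ma = λ () }
          where
          ω′ : L
          ω′ = ω [ z i ]≔ c
          old : ∀ {x} → x ≢ z i → lab ω′ x ≡ lab ω x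
          old = lab-old ω (z i) c
          keep-m : ∀ l → C l ≡ false → matched ω′ l ≡ true → matched ω l ≡ true
          keep-m l cl e = let rl , t = ∧-split {R ω′ l} e ; x , p = anyᵇ-elim t ; xx , s = ∧-split {X x} p
                              ol = old (differ C (z-C i) cl ∘ sym) in
            ∧-intro (subst (λ w → real w ≡ true) ol rl) (anyᵇ-intro x (∧-intro xx (subst₂ (λ s t → (s == t) ≡ true) (old (X-z xx i ∘ sym)) ol s)))
          keep : ∀ i′ → i′ ≢ i → sat ω′ i′ ≡ true → sat ω i′ ≡ true
          keep i′ ne e = let bz , mm = ∧-split {not (R ω′ (z i′))} e ; m₁ , m₂ = ∧-split {matched ω′ (a i′)} mm in
            ∧-intro (subst (λ w → not (real w) ≡ true) (old (zz i′ i ne)) bz)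
              (∧-intro (keep-m (a i′) (proj₁ (proj₂ (lightOf i′ (a i′) (a-light i′)))) m₁) (keep-m (b i′) (proj₁ (proj₂ (lightOf i′ (b i′) (b-light i′)))) m₂))

    -- `ξ` counts partners: `C` without the centres, without the at most k + 8 - |C| neighbours of
    -- `l`, and without one vertex that may carry the colour of `a i`. `f` counts colours absent
    -- around `l`, around the partner and from the lights of all units.
    module Match (i : Fin J) (l : Fin n) (l≡ : l ≡ a i ⊎ l ≡ b i) (e : Bool) (m r ξ f : ℕ)
      (hξ : ξ + J + k + 9 ≤ 2 * # C) (hf : f + (θ + r + (θ + r + (J + J))) ≤ k) where

      l-light : lightᵇ G k C (z i) l ≡ true
      l-light = [ (λ { refl → a-light i }) , (λ { refl → b-light i }) ]′ l≡

      l-adj = proj₁ (lightOf i l l-light)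
      l∉C = proj₁ (proj₂ (lightOf i l l-light))
      l-in = proj₂ (proj₂ (lightOf i l l-light))

      ball-l : ball G 2 v l ≡ true
      ball-l = ball-adj G 1 (ball-z i) l-adj

      a∉C : ∀ i′ → C (a i′) ≡ false
      a∉C i′ = proj₁ (proj₂ (lightOf i′ (a i′) (a-light i′)))

      b∉C : ∀ i′ → C (b i′) ≡ false
      b∉C i′ = proj₁ (proj₂ (lightOf i′ (b i′) (b-light i′)))

      l≢a : ∀ i′ → i′ ≢ i → a i′ ≢ l
      l≢a i′ ne = [ (λ { refl → aa i′ i ne }) , (λ { refl → ab i′ i ne }) ]′ l≡

      l≢b : ∀ i′ → i′ ≢ i → b i′ ≢ l
      l≢b i′ ne = [ (λ { refl → ba i′ i ne }) , (λ { refl → bb i′ i ne }) ]′ l≡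

      pre post : L → Bool
      pre ω = stage i e m r ω
      post ω = stage i e m (r + 2) ω ∧ matched ω l

      -- At most one vertex, since `C` is a clique. Recolouring it would destroy the match of `a i`
      -- while `b i` is being matched.
      same-as-a : L → Fin n → Bool
      same-as-a ω x = C x ∧ R ω (a i) ∧ (lab ω x == lab ω (a i))

      elig : L → Fin n → Bool
      elig ω x = (X x ∧ not (adj G l x)) ∧ not (same-as-a ω x)

      P Q : Fin n → L → Bool
      P x ω = pre ω ∧ elig ω x
      Q x ω = post ω ∧ (X x ∧ R ω l ∧ (lab ω x == lab ω l))

      #elig : ∀ ω → Ω ω ≡ true → ξ ≤ # (elig ω)
      #elig ω o = lin 0 (+-mono-≤ (+-mono-≤ (+-mono-≤ (+-mono-≤ (+-mono-≤ hξ l-in)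
            (#-cover (elig ω) (λ x → centres x ∨ ((adj G l x ∧ C x) ∨ same-as-a ω x)) C cov))
            (#-∨ centres (λ x → (adj G l x ∧ C x) ∨ same-as-a ω x))) (≤-trans (#-∨ (λ x → adj G l x ∧ C x) (same-as-a ω)) (+-monoʳ-≤ (inside G C l) one))) #centres)
            (eq ξ J k (# C) (inside G C l) (# (elig ω)) (# (λ x → centres x ∨ ((adj G l x ∧ C x) ∨ same-as-a ω x))) (# (λ x → (adj G l x ∧ C x) ∨ same-as-a ω x)) (# centres))
        where
        eq : ∀ ξ J k c d E u w s → E + (ξ + J + k + 9 + (d + c) + c + u + w + s) ≡ ξ + (2 * c + (k + 8) + (E + u) + (s + w) + (d + 1) + J) + 0
        eq = solve-∀
        one : # (same-as-a ω) ≤ 1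
        one = #≤1 (same-as-a ω) λ x y p p′ → let cx , p₁ = ∧-split {C x} p ; ra , ex = ∧-split {R ω (a i)} p₁
                                                 cy , p₂ = ∧-split {C y} p′ ; _ , ey = ∧-split {R ω (a i)} p₂ in
              unique-in-C ω o (lab ω (a i)) ra x y cx cy (==⇒≡ ex) (==⇒≡ ey)
        cov : ∀ x → C x ≡ true → elig ω x ≡ true ⊎ (centres x ∨ ((adj G l x ∧ C x) ∨ same-as-a ω x)) ≡ true
        cov x cx with tf (centres x) | tf (adj G l x) | tf (same-as-a ω x)
        ... | inj₁ t | _ | _ = inj₂ (∨-introˡ t)
        ... | inj₂ _ | inj₁ t | _ = inj₂ (∨-introʳ {centres x} (∨-introˡ (∧-intro t cx)))
        ... | inj₂ _ | inj₂ _ | inj₁ t = inj₂ (∨-introʳ {centres x} (∨-introʳ {adj G l x ∧ C x} t))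
        ... | inj₂ p | inj₂ p′ | inj₂ p″ = inj₁ (∧-intro (∧-intro (∧-intro cx (not-intro p)) (not-intro p′)) (not-intro p″))

      -- Avoiding the colours on `used` keeps the new colour of `x` from matching a light of another
      -- unit, so the number of other satisfied units does not grow.
      module Recolour (x : Fin n) (ω : L) (pre-ω : pre ω ≡ true) (el : elig ω x ≡ true) (c : Fin q) (fr : Fresh ω (adj G l) (adj G x) used c) where
        open Stage (stage-elim i e m r ω pre-ω)
        open Fresh fr

        xx : X x ≡ true
        xx = ∧ˡ {X x} (∧ˡ {X x ∧ not (adj G l x)} el)

        nlx : adj G l x ≡ false
        nlx = not-true (∧ʳ {X x} (∧ˡ {X x ∧ not (adj G l x)} el))

        not-a : same-as-a ω x ≡ false
        not-a = not-true (∧ʳ {X x ∧ not (adj G l x)} el)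

        ω′ : L
        ω′ = (ω [ l ]≔ c) [ x ]≔ c

        x≢l : x ≢ l
        x≢l = differ C (X-C xx) l∉C

        lab-x : lab ω′ x ≡ c
        lab-x = lab-new (ω [ l ]≔ c) x c

        lab-l : lab ω′ l ≡ c
        lab-l = trans (lab-old (ω [ l ]≔ c) x c (x≢l ∘ sym)) (lab-new ω l c)

        old : ∀ {y} → y ≢ x → y ≢ l → lab ω′ y ≡ lab ω y
        old p q = trans (lab-old (ω [ l ]≔ c) x c p) (lab-old ω l c q)

        old-z : ∀ i′ → lab ω′ (z i′) ≡ lab ω (z i′)
        old-z i′ = old (X-z xx i′) (differ C (z-C i′) l∉C)

        match-l : matched ω′ l ≡ true
        match-l = ∧-intro (subst (λ w → real w ≡ true) (sym lab-l) isReal) (anyᵇ-intro x (∧-intro xx (subst₂ (λ s t → (s == t) ≡ true) (sym lab-x) (sym lab-l) (==-refl c))))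

        match-old : ∀ l′ → C l′ ≡ false → l′ ≢ l → used l′ ≡ true → matched ω′ l′ ≡ true → matched ω l′ ≡ true
        match-old l′ cl′ ne us p = let rl , t = ∧-split {R ω′ l′} p in ∧-intro (subst (λ w → real w ≡ true) ol rl) (find (anyᵇ-elim t))
          where
          ol : lab ω′ l′ ≡ lab ω l′
          ol = old (differ C (X-C xx) cl′ ∘ sym) ne
          find : (∃ λ y → (X y ∧ (lab ω′ y == lab ω′ l′)) ≡ true) → anyᵇ (λ y → X y ∧ (lab ω y == lab ω l′)) ≡ true
          find (y , q) with y ≟ᶠ x
          ... | yes refl = ⊥-elim (f₃ l′ us (trans (sym ol) (trans (sym (==⇒≡ (∧ʳ {X y} q))) lab-x)))
          ... | no y≢x = anyᵇ-intro y (∧-intro (∧ˡ {X y} q) (subst₂ (λ s t → (s == t) ≡ true) (old y≢x (differ C (X-C (∧ˡ {X y} q)) l∉C)) ol (∧ʳ {X y} q)))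

        match-a : e ≡ true → matched ω′ (a i) ≡ true
        match-a t with a i ≟ᶠ l
        ... | yes p = subst (λ w → matched ω′ w ≡ true) (sym p) match-l
        ... | no ne = let ra , t′ = ∧-split {R ω (a i)} (ma t) in ∧-intro (subst (λ w → real w ≡ true) (sym ol) ra) (find ra (anyᵇ-elim t′))
          where
          ol : lab ω′ (a i) ≡ lab ω (a i)
          ol = old (differ C (X-C xx) (a∉C i) ∘ sym) ne
          find : R ω (a i) ≡ true → (∃ λ y → (X y ∧ (lab ω y == lab ω (a i))) ≡ true) → anyᵇ (λ y → X y ∧ (lab ω′ y == lab ω′ (a i))) ≡ true
          find ra (y , q) = anyᵇ-intro y (∧-intro xy (subst₂ (λ s t → (s == t) ≡ true) (sym (old (differ (same-as-a ω) (∧-intro (X-C xy) (∧-intro ra s)) not-a) (differ C (X-C xy) l∉C))) (sym ol) s))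
            where
            xy = ∧ˡ {X y} q
            s = ∧ʳ {X y} q

        sat-old : ∀ i′ → i′ ≢ i → sat ω′ i′ ≡ true → sat ω i′ ≡ true
        sat-old i′ ne p = let bz , mm = ∧-split {not (R ω′ (z i′))} p ; m₁ , m₂ = ∧-split {matched ω′ (a i′)} mm in
          ∧-intro (subst (λ w → not (real w) ≡ true) (old-z i′) bz)
            (∧-intro (match-old (a i′) (a∉C i′) (l≢a i′ ne) (used-a i′) m₁) (match-old (b i′) (b∉C i′) (l≢b i′ ne) (used-b i′) m₂))

        stage′ : Stage i e m (r + 2) ω′
        stage′ = record
          { o = Ω-pair ω l x c nlx f₁ f₂ o
          ; h = trans (inv (ω [ l ]≔ c) x c (ball-X i xx)) (trans (inv ω l c ball-l) h)
          ; va = valid-pair θ r v ω l x c c va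
          ; ot = ≤-trans (#-mono {Q = others ω i} λ i′ p → let ne , s = ∧-split {not (i′ == i)} p in ∧-intro ne (sat-old i′ (==f⇒≢ (not-true ne)) s)) ot
          ; bl = trans (cong real (old-z i)) bl
          ; ma = match-a }

        result : Q x ω′ ≡ true
        result = ∧-intro (∧-intro (stage-intro i e m (r + 2) ω′ stage′) match-l)
          (∧-intro xx (∧-intro (subst (λ w → real w ≡ true) (sym lab-l) isReal) (subst₂ (λ s t → (s == t) ≡ true) (sym lab-x) (sym lab-l) (==-refl c))))

      per-x : ∀ x → cnt (P x) * f ≤ cnt (Q x) * (q * q)
      per-x x = recolour₂ (P x) (Q x) f l x fwd
        where
        fwd : ∀ ω → P x ω ≡ true → f ≤ # (λ c → Q x ((ω [ l ]≔ c) [ x ]≔ c))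
        fwd ω p = ≤-trans (+-cancelʳ-≤ (θ + r + (θ + r + (J + J))) f _ (≤-trans hf (#fresh₃ ω (adj G l) (adj G x) used
                    (≤-trans (#taken-nbhd ω l) (va′ l ball-l)) (≤-trans (#taken-nbhd ω x) (va′ x (ball-X i xx))) (≤-trans (#taken ω used) #used))))
                  (#-mono λ c fc → Recolour.result x ω pre-ω el c (fresh₃-elim ω (adj G l) (adj G x) used c fc))
          where
          pre-ω = ∧ˡ {pre ω} p
          el = ∧ʳ {pre ω} p
          xx = ∧ˡ {X x} (∧ˡ {X x ∧ not (adj G l x)} el)
          va′ = valid-elim θ r v ω (Stage.va (stage-elim i e m r ω pre-ω))

      -- The result determines `x`: properness lets only one vertex of `C` carry the colour of `l`.
      -- So ξ * f choices stand against the two old labels alone.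
      match : cnt pre * (ξ * f) ≤ cnt post * (q * q)
      match = begin
        cnt pre * (ξ * f) ≡⟨ *-assoc (cnt pre) ξ f ⟨
        cnt pre * ξ * f ≡⟨ cong (_* f) (Sum-*ʳ ξ (λ ω → b2n (pre ω))) ⟨
        Sum (λ ω → b2n (pre ω) * ξ) * f ≤⟨ *-monoˡ-≤ f (Sum-mono pt) ⟩
        Sum (λ ω → sum (λ x → b2n (P x ω))) * f ≡⟨ cong (_* f) (Sum-sum (λ ω x → b2n (P x ω))) ⟩
        sum (λ x → cnt (P x)) * f ≡⟨ sum-*ʳ f (λ x → cnt (P x)) ⟨
        sum (λ x → cnt (P x) * f) ≤⟨ sum-mono per-x ⟩
        sum (λ x → cnt (Q x) * (q * q)) ≡⟨ sum-*ʳ (q * q) (λ x → cnt (Q x)) ⟩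
        sum (λ x → cnt (Q x)) * (q * q) ≡⟨ cong (_* (q * q)) (Sum-sum (λ ω x → b2n (Q x ω))) ⟨
        Sum (λ ω → sum (λ x → b2n (Q x ω))) * (q * q) ≤⟨ *-monoˡ-≤ (q * q) (Sum-mono pt′) ⟩
        cnt post * (q * q) ∎
        where
        open ≤-Reasoning
        pt : ∀ ω → b2n (pre ω) * ξ ≤ sum (λ x → b2n (P x ω))
        pt ω with tf (pre ω)
        ... | inj₂ f = ≤-trans (≤-reflexive (cong (λ b → b2n b * ξ) f)) z≤n
        ... | inj₁ t = ≤-trans (≤-reflexive (trans (cong (λ b → b2n b * ξ) t) (+-identityʳ ξ))) (≤-trans (#elig ω (Stage.o (stage-elim i e m r ω t))) (#-mono {Q = λ x → P x ω} λ x el → ∧-intro t el))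
        pt′ : ∀ ω → sum (λ x → b2n (Q x ω)) ≤ b2n (post ω)
        pt′ ω with tf (post ω)
        ... | inj₂ f = ≤-trans (≤-reflexive (#-none {P = λ x → Q x ω} λ x → ≢true λ p → true≢false (∧ˡ {post ω} p) f)) z≤n
        ... | inj₁ t = ≤-trans (#≤1 (λ x → Q x ω) same) (≤-reflexive (sym (cong b2n t)))
          where
          o = Stage.o (stage-elim i e m (r + 2) ω (∧ˡ {stage i e m (r + 2) ω} t))
          same : ∀ x y → Q x ω ≡ true → Q y ω ≡ true → x ≡ y
          same x y p p′ = let xx , p₁ = ∧-split {X x} (∧ʳ {post ω} p) ; rl , ex = ∧-split {R ω l} p₁
                              xy , p₂ = ∧-split {X y} (∧ʳ {post ω} p′) ; _ , ey = ∧-split {R ω l} p₂ in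
            unique-in-C ω o (lab ω l) rl x y (X-C xx) (X-C xy) (==⇒≡ ex) (==⇒≡ ey)

    module _ (m r ξ f : ℕ) (hξ : ξ + J + k + 9 ≤ 2 * # C) (hf : f + (θ + (r + 2) + (θ + (r + 2) + (J + J))) ≤ k) where

      private
        final : Fin J → L → Bool
        final i ω = stage i true m (r + 2 + 2) ω ∧ matched ω (b i)

        -- Three alterations in a row: blank the centre, match `a i`, match `b i`. If the two lights
        -- coincide, the last step recolours the same vertex again, and the count remains uniform.
        per-unit : ∀ i → cnt (poor m r) * (K * (ξ * f) * (ξ * f)) ≤ cnt (final i) * (q * (q * q) * (q * q))
        per-unit i = begin
          cnt (poor m r) * (K * (ξ * f) * (ξ * f)) ≡⟨ eq₁ (cnt (poor m r)) K (ξ * f) ⟩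
          cnt (poor m r) * K * (ξ * f) * (ξ * f) ≤⟨ *-monoˡ-≤ (ξ * f) (*-monoˡ-≤ (ξ * f) (blank-centre i m r)) ⟩
          cnt (stage i false m r) * q * (ξ * f) * (ξ * f) ≡⟨ eq₂ (cnt (stage i false m r)) q (ξ * f) ⟩
          cnt (stage i false m r) * (ξ * f) * (q * (ξ * f)) ≤⟨ *-monoˡ-≤ (q * (ξ * f)) (≤-trans (Match.match i (a i) (inj₁ refl) false m r ξ f hξ hf′) (*-monoˡ-≤ (q * q) (cnt-mono to-true))) ⟩
          cnt (stage i true m (r + 2)) * (q * q) * (q * (ξ * f)) ≡⟨ eq₃ (cnt (stage i true m (r + 2))) q (ξ * f) ⟩
          cnt (stage i true m (r + 2)) * (ξ * f) * (q * (q * q)) ≤⟨ *-monoˡ-≤ (q * (q * q)) (Match.match i (b i) (inj₂ refl) true m (r + 2) ξ f hξ hf) ⟩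
          cnt (final i) * (q * q) * (q * (q * q)) ≡⟨ eq₄ (cnt (final i)) (q * q) (q * (q * q)) ⟩
          cnt (final i) * (q * (q * q) * (q * q)) ∎
          where
          open ≤-Reasoning
          eq₁ : ∀ a K x → a * (K * x * x) ≡ a * K * x * x
          eq₁ = solve-∀
          eq₂ : ∀ a q x → a * q * x * x ≡ a * x * (q * x)
          eq₂ = solve-∀
          eq₃ : ∀ a q x → a * (q * q) * (q * x) ≡ a * x * (q * (q * q))
          eq₃ = solve-∀
          eq₄ : ∀ a x y → a * x * y ≡ a * (y * x)
          eq₄ = solve-∀
          le : θ + r ≤ θ + (r + 2)
          le = +-monoʳ-≤ θ (m≤m+n r 2)
          hf′ : f + (θ + r + (θ + r + (J + J))) ≤ k
          hf′ = ≤-trans (+-monoʳ-≤ f (+-mono-≤ le (+-monoˡ-≤ (J + J) le))) hf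
          to-true : ∀ ω → (stage i false m (r + 2) ω ∧ matched ω (a i)) ≡ true → stage i true m (r + 2) ω ≡ true
          to-true ω p = let s , mt = ∧-split {stage i false m (r + 2) ω} p ; S = stage-elim i false m (r + 2) ω s in
            stage-intro i true m (r + 2) ω (record { o = Stage.o S ; h = Stage.h S ; va = Stage.va S ; ot = Stage.ot S ; bl = Stage.bl S ; ma = λ _ → mt })

      -- Blanking z i and giving each of its two lights a fresh colour shared with some vertex of C.
      poor-step : cnt (poor m r) * (J * (K * (ξ * f) * (ξ * f))) ≤ cnt (poor (m + 1) (r + 2 + 2)) * ((m + 1) * (q * (q * q) * (q * q)))
      poor-step = begin
        cnt (poor m r) * (J * F) ≡⟨ eq (cnt (poor m r)) J F ⟩
        J * (cnt (poor m r) * F) ≡⟨ sum-const J (cnt (poor m r) * F) ⟨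
        sum {J} (λ i → cnt (poor m r) * F) ≤⟨ sum-mono per-unit ⟩
        sum (λ i → cnt (final i) * Y) ≡⟨ sum-*ʳ Y (λ i → cnt (final i)) ⟩
        sum (λ i → cnt (final i)) * Y ≡⟨ cong (_* Y) (Sum-sum (λ ω i → b2n (final i ω))) ⟨
        Sum (λ ω → sum (λ i → b2n (final i ω))) * Y ≤⟨ *-monoˡ-≤ Y (Sum-mono pt) ⟩
        Sum (λ ω → b2n (poor (m + 1) (r + 2 + 2) ω) * (m + 1)) * Y ≡⟨ cong (_* Y) (Sum-*ʳ (m + 1) (λ ω → b2n (poor (m + 1) (r + 2 + 2) ω))) ⟩
        cnt (poor (m + 1) (r + 2 + 2)) * (m + 1) * Y ≡⟨ *-assoc (cnt (poor (m + 1) (r + 2 + 2))) (m + 1) Y ⟩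
        cnt (poor (m + 1) (r + 2 + 2)) * ((m + 1) * Y) ∎
        where
        open ≤-Reasoning
        F = K * (ξ * f) * (ξ * f)
        Y = q * (q * q) * (q * q)
        eq : ∀ a b c → a * (b * c) ≡ b * (a * c)
        eq = solve-∀
        pt : ∀ ω → sum (λ i → b2n (final i ω)) ≤ b2n (poor (m + 1) (r + 2 + 2) ω) * (m + 1)
        pt ω with tf (anyᵇ (λ i → final i ω))
        ... | inj₂ none = ≤-trans (≤-reflexive (#-none {P = λ i → final i ω} λ i → ≢true λ p → true≢false (anyᵇ-intro i p) none)) z≤n
        ... | inj₁ t = bound (anyᵇ-elim t)
          where
          sat-of : ∀ i → final i ω ≡ true → sat ω i ≡ true
          sat-of i p = let s , mt = ∧-split {stage i true m (r + 2 + 2) ω} p ; S = stage-elim i true m (r + 2 + 2) ω s in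
            ∧-intro (not-intro (Stage.bl S)) (∧-intro (Stage.ma S refl) mt)
          bound : (∃ λ i → final i ω ≡ true) → sum (λ i → b2n (final i ω)) ≤ b2n (poor (m + 1) (r + 2 + 2) ω) * (m + 1)
          bound (i , p) = ≤-trans (#-mono {Q = sat ω} sat-of) (≤-trans few (≤-reflexive (sym (trans (cong (λ b → b2n b * (m + 1)) in-poor) (+-identityʳ (m + 1))))))
            where
            S = stage-elim i true m (r + 2 + 2) ω (∧ˡ {stage i true m (r + 2 + 2) ω} p)
            few : # (sat ω) ≤ m + 1
            few = ≤-trans (#-cover (others ω i) (_== i) (sat ω) λ i′ s → [ inj₂ , (λ ne → inj₁ (∧-intro (not-intro ne) s)) ]′ (tf (i′ == i)))
                    (+-mono-≤ (Stage.ot S) (≤-reflexive (#-single i)))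
            in-poor : poor (m + 1) (r + 2 + 2) ω ≡ true
            in-poor = ∧-intro (∧-intro (Stage.o S) (Stage.h S)) (∧-intro (Stage.va S) (true-≤ᵇ few))

-- Estimates

n<2^n : ∀ n → n < 2 ^ n
n<2^n zero    = ≤-refl
n<2^n (suc n) = ≤-trans (+-mono-≤ (≤-trans (s≤s z≤n) (n<2^n n)) (n<2^n n)) (≤-reflexive (cong (2 ^ n +_) (sym (+-identityʳ (2 ^ n)))))

^-distribʳ-* : ∀ n a b → (a * b) ^ n ≡ a ^ n * b ^ n
^-distribʳ-* zero    a b = refl
^-distribʳ-* (suc n) a b = trans (cong (a * b *_) (^-distribʳ-* n a b)) (eq a b (a ^ n) (b ^ n))
  where
  eq : ∀ a b x y → a * b * (x * y) ≡ a * x * (b * y)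
  eq = solve-∀

div-upper : ∀ k d .{{_ : NonZero d}} → k < d * suc (k / d)
div-upper k d = begin-strict
  k                     ≡⟨ m≡m%n+[m/n]*n k d ⟩
  _                     <⟨ +-monoˡ-< (k / d * d) (m%n<n k d) ⟩
  d + k / d * d         ≡⟨ *-comm (suc (k / d)) d ⟩
  d * suc (k / d)       ∎
  where open ≤-Reasoning

div-lower : ∀ k d .{{_ : NonZero d}} → d * (k / d) ≤ k
div-lower k d = ≤-trans (≤-reflexive (*-comm d (k / d))) (m/n*n≤m k d)

div-≥ : ∀ m k d .{{_ : NonZero d}} → m * d ≤ k → m ≤ k / d
div-≥ m k d h = ≤-trans (≤-reflexive (sym (m*n/n≡m m d))) (/-monoˡ-≤ d h)

module Numbers (k : ℕ) (large : 7399999999 ≤ k) where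

  -- `J` and `I` make up the tolerated number `θ` of coloured neighbours: beyond `J`, about k/4, the
  -- counts halve, and `I` more neighbours make crowding rare enough. `h` is one percent of `k`,
  -- `r₀` the gain of one alteration and `M` the number of units.
  K J I θ h r₀ M : ℕ
  K = 8 * k
  J = suc (k / 4)
  I = 10 * (k / 500)
  θ = J + I
  h = k / 100
  r₀ = h / 1000000
  M = k / 50

  at-least : ∀ m → (m ≤ᵇ 7399999999) ≡ true → m ≤ k
  at-least m e = ≤-trans (≤ᵇ-true e) large

  h≥ : 73000000 ≤ h
  h≥ = div-≥ 73000000 k 100 (at-least 7300000000 refl)

  r₀≥ : 73 ≤ r₀
  r₀≥ = div-≥ 73 h 1000000 h≥

  r₀≤ : 1000000 * r₀ ≤ h
  r₀≤ = div-lower h 1000000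

  h≤ : 100 * h ≤ k
  h≤ = div-lower k 100

  k≤h : k ≤ 101 * h
  k≤h = lin 0 (+-mono-≤ (div-upper k 100) (≤-trans (≤ᵇ-true {99} refl) h≥)) (eq k h)
    where
    eq : ∀ k h → 101 * h + (suc k + 99) ≡ k + (100 * suc h + h) + 0
    eq = solve-∀

  2h≤M : 2 * h ≤ M
  2h≤M = div-≥ (2 * h) k 50 (≤-trans (≤-reflexive (eq h)) h≤)
    where
    eq : ∀ h → 2 * h * 50 ≡ 100 * h
    eq = solve-∀

  50M≤k : 50 * M ≤ k
  50M≤k = div-lower k 50

  J-large : suc k ≤ 4 * J
  J-large = div-upper k 4

  crowded-ratio : 2 * (suc k * k) ≤ J * K
  crowded-ratio = ≤-trans (≤-trans (≤-reflexive (eq₁ (suc k) k)) (*-monoˡ-≤ (2 * k) J-large)) (≤-reflexive (eq₂ J k))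
    where
    eq₁ : ∀ a k → 2 * (a * k) ≡ a * (2 * k)
    eq₁ = solve-∀
    eq₂ : ∀ J k → 4 * J * (2 * k) ≡ J * (8 * k)
    eq₂ = solve-∀

  θ≤ : 100 * θ ≤ 27 * k + 100
  θ≤ = lin 0 (+-mono-≤ (*-monoʳ-≤ 25 (div-lower k 4)) (*-monoʳ-≤ 2 (div-lower k 500))) (eq k (k / 4) (k / 500))
    where
    eq : ∀ k a b → 27 * k + 100 + (25 * (4 * a) + 2 * (500 * b)) ≡ 100 * (suc a + 10 * b) + (25 * k + 2 * k) + 0
    eq = solve-∀

  -- In percent of `k`: 18 for the fresh colours and three times 27 for the neighbourhoods.
  sparse-room : ∀ r → r ≤ 120 → 18 * h + (θ + r + (θ + r + (θ + r))) ≤ k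
  sparse-room r hr = *-cancelˡ-≤ 100 (lin 0 (+-mono-≤ (+-mono-≤ (+-mono-≤ (*-monoʳ-≤ 18 h≤) (*-monoʳ-≤ 3 θ≤)) (*-monoʳ-≤ 300 hr)) (at-least 36300 refl)) (eq k h θ r))
    where
    eq : ∀ k h t r → 100 * k + (18 * (100 * h) + 3 * (100 * t) + 300 * r + 36300) ≡ 100 * (18 * h + (t + r + (t + r + (t + r)))) + (18 * k + 3 * (27 * k + 100) + 300 * 120 + k) + 0
    eq = solve-∀

  star-room : ∀ r → r ≤ 120 → 40 * h + (θ + r + (θ + r + (M + M))) ≤ k
  star-room r hr = *-cancelˡ-≤ 100 (lin k (+-mono-≤ (+-mono-≤ (+-mono-≤ (+-mono-≤ (*-monoʳ-≤ 40 h≤) (*-monoʳ-≤ 2 θ≤)) (*-monoʳ-≤ 200 hr)) (*-monoʳ-≤ 4 50M≤k)) (at-least 24200 refl)) (eq k h θ r M))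
    where
    eq : ∀ k h t r M → 100 * k + (40 * (100 * h) + 2 * (100 * t) + 200 * r + 4 * (50 * M) + 24200) ≡ 100 * (40 * h + (t + r + (t + r + (M + M)))) + (40 * k + 2 * (27 * k + 100) + 200 * 120 + 4 * k + k) + k
    eq = solve-∀

  -- In percent of `k`: 90 + 2 + 100, below twice the 98 of the clique.
  star-choices : ∀ c → 49 * k ≤ 50 * c → 90 * h + M + k + 9 ≤ 2 * c
  star-choices c hc = *-cancelˡ-≤ 50 (lin k (+-mono-≤ (+-mono-≤ (+-mono-≤ (*-monoʳ-≤ 2 hc) (*-monoʳ-≤ 45 h≤)) 50M≤k) (at-least 450 refl)) (eq k h M c))
    where
    eq : ∀ k h M c → 50 * (2 * c) + (2 * (49 * k) + 45 * (100 * h) + 50 * M + 450) ≡ 50 * (90 * h + M + k + 9) + (2 * (50 * c) + 45 * k + k + k) + k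
    eq = solve-∀

  q≤ : k + K ≤ 909 * h
  q≤ = ≤-trans (*-monoʳ-≤ 9 k≤h) (≤-reflexive (eq h))
    where
    eq : ∀ h → 9 * (101 * h) ≡ 909 * h
    eq = solve-∀

  -- Measured in units of `h`: 61 * 909² = 50403141 against 100 * 100 * 18 = 180000. Starting from
  -- 3, 28 steps of two keep `m` below 61.
  sparse-ratio : ∀ m s → m ≤ 61 → k * k ≤ 1000 * s → r₀ * (m * ((k + K) * (k + K))) ≤ s * (18 * h)
  sparse-ratio m s hm hs = *-cancelˡ-≤ 1000 (begin
    1000 * (r₀ * (m * ((k + K) * (k + K)))) ≤⟨ *-monoʳ-≤ 1000 (*-monoʳ-≤ r₀ (*-mono-≤ hm (*-mono-≤ q≤ q≤))) ⟩
    1000 * (r₀ * (61 * (909 * h * (909 * h)))) ≡⟨ eq₁ r₀ h ⟩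
    50403141 * 1000 * r₀ * (h * h) ≤⟨ *-monoˡ-≤ (h * h) (*-monoˡ-≤ r₀ (≤ᵇ-true {50403141 * 1000} {180000 * 1000000} refl)) ⟩
    180000 * 1000000 * r₀ * (h * h) ≡⟨ eq₂ 180000 1000000 r₀ (h * h) ⟩
    180000 * (1000000 * r₀) * (h * h) ≤⟨ *-monoˡ-≤ (h * h) (*-monoʳ-≤ 180000 r₀≤) ⟩
    180000 * h * (h * h) ≡⟨ eq₃ h ⟩
    100 * h * (100 * h) * (18 * h) ≤⟨ *-monoˡ-≤ (18 * h) (*-mono-≤ h≤ h≤) ⟩
    k * k * (18 * h) ≤⟨ *-monoˡ-≤ (18 * h) hs ⟩
    1000 * s * (18 * h) ≡⟨ *-assoc 1000 s (18 * h) ⟩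
    1000 * (s * (18 * h)) ∎)
    where
    open ≤-Reasoning
    eq₁ : ∀ r h → 1000 * (r * (61 * (909 * h * (909 * h)))) ≡ 50403141 * 1000 * r * (h * h)
    eq₁ = solve-∀
    eq₂ : ∀ a b r x → a * b * r * x ≡ a * (b * r) * x
    eq₂ = solve-∀
    eq₃ : ∀ h → 180000 * h * (h * h) ≡ 100 * h * (100 * h) * (18 * h)
    eq₃ = solve-∀

  -- This estimate governs the divisor 1000000 in `r₀`: 30 * 909^5 is only about a tenth below
  -- 20736000000 * 1000000, where 20736000000 = 2 * 8 * 100 * (90 * 40)².
  star-ratio : ∀ m → m ≤ 30 → r₀ * (m * ((k + K) * ((k + K) * (k + K)) * ((k + K) * (k + K)))) ≤ M * (K * (90 * h * (40 * h)) * (90 * h * (40 * h)))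
  star-ratio m hm = begin
    r₀ * (m * (q * (q * q) * (q * q))) ≤⟨ *-monoʳ-≤ r₀ (*-mono-≤ hm (*-mono-≤ (*-mono-≤ q≤ (*-mono-≤ q≤ q≤)) (*-mono-≤ q≤ q≤))) ⟩
    r₀ * (30 * (Q * (Q * Q) * (Q * Q))) ≡⟨ eq₁ 30 909 r₀ h ⟩
    30 * (909 * (909 * 909) * (909 * 909)) * r₀ * (h * (h * h) * (h * h)) ≤⟨ *-monoˡ-≤ (h * (h * h) * (h * h)) (*-monoˡ-≤ r₀ (≤ᵇ-true {30 * (909 * (909 * 909) * (909 * 909))} {20736000000 * 1000000} refl)) ⟩
    20736000000 * 1000000 * r₀ * (h * (h * h) * (h * h)) ≡⟨ eq₂ 20736000000 1000000 r₀ (h * (h * h) * (h * h)) ⟩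
    20736000000 * (1000000 * r₀) * (h * (h * h) * (h * h)) ≤⟨ *-monoˡ-≤ (h * (h * h) * (h * h)) (*-monoʳ-≤ 20736000000 r₀≤) ⟩
    20736000000 * h * (h * (h * h) * (h * h)) ≡⟨ eq₃ h ⟩
    2 * h * (8 * (100 * h) * (90 * h * (40 * h)) * (90 * h * (40 * h))) ≤⟨ *-mono-≤ 2h≤M (*-monoˡ-≤ (90 * h * (40 * h)) (*-monoˡ-≤ (90 * h * (40 * h)) (*-monoʳ-≤ 8 h≤))) ⟩
    M * (K * (90 * h * (40 * h)) * (90 * h * (40 * h))) ∎
    where
    open ≤-Reasoning
    q = k + K
    Q = 909 * h
    eq₁ : ∀ a b r h → r * (a * (b * h * (b * h * (b * h)) * (b * h * (b * h)))) ≡ a * (b * (b * b) * (b * b)) * r * (h * (h * h) * (h * h))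
    eq₁ = solve-∀
    eq₂ : ∀ a b r x → a * b * r * x ≡ a * (b * r) * x
    eq₂ = solve-∀
    eq₃ : ∀ h → 20736000000 * h * (h * (h * h) * (h * h)) ≡ 2 * h * (8 * (100 * h) * (90 * h * (40 * h)) * (90 * h * (40 * h)))
    eq₃ = solve-∀

  k+2≤ : 2 + k ≤ 102000000 * r₀
  k+2≤ = lin 0 (+-mono-≤ (+-mono-≤ (div-upper k 100) (*-monoʳ-≤ 100 (div-upper h 1000000))) (≤-trans (≤ᵇ-true {100000001} {2000000 * 73} refl) (*-monoʳ-≤ 2000000 r₀≥))) (eq k h r₀)
    where
    eq : ∀ k h r → 102000000 * r + (suc k + 100 * suc h + 100000001) ≡ 2 + k + (100 * suc h + 100 * (1000000 * suc r) + 2000000 * r) + 0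
    eq = solve-∀

  -- Five of the 28 factors match the fifth power of `k`, taken in units of `r₀`; the other 23, each
  -- at least 73, absorb the constant.
  many-steps : 8 * (2 + k) ^ 5 ≤ r₀ ^ 28
  many-steps = begin
    8 * (2 + k) ^ 5 ≤⟨ *-monoʳ-≤ 8 (^-monoˡ-≤ 5 k+2≤) ⟩
    8 * (102000000 * r₀) ^ 5 ≡⟨ cong (8 *_) (^-distribʳ-* 5 102000000 r₀) ⟩
    8 * (102000000 ^ 5 * r₀ ^ 5) ≡⟨ *-assoc 8 (102000000 ^ 5) (r₀ ^ 5) ⟨
    8 * 102000000 ^ 5 * r₀ ^ 5 ≤⟨ *-monoˡ-≤ (r₀ ^ 5) (≤-trans (≤ᵇ-true {8 * 102000000 ^ 5} {73 ^ 23} refl) (^-monoˡ-≤ 23 r₀≥)) ⟩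
    r₀ ^ 23 * r₀ ^ 5 ≡⟨ ^-distribˡ-+-* r₀ 23 5 ⟨
    r₀ ^ 28 ∎
    where open ≤-Reasoning

  -- With m = k / 500, the power 2^(10m) is at least (m + 1)^10. Half of these ten factors cover (k
  -- + 2)^5 up to 8 * 501^5, and the other half exceed that constant.
  many-halvings : 8 * (2 + k) ^ 5 ≤ 2 ^ I
  many-halvings = begin
    8 * (2 + k) ^ 5 ≤⟨ *-monoʳ-≤ 8 (^-monoˡ-≤ 5 le) ⟩
    8 * (501 * suc m) ^ 5 ≡⟨ cong (8 *_) (^-distribʳ-* 5 501 (suc m)) ⟩
    8 * (501 ^ 5 * suc m ^ 5) ≡⟨ *-assoc 8 (501 ^ 5) (suc m ^ 5) ⟨
    8 * 501 ^ 5 * suc m ^ 5 ≤⟨ *-monoˡ-≤ (suc m ^ 5) (≤-trans (≤ᵇ-true {8 * 501 ^ 5} {1002 ^ 5} refl) (^-monoˡ-≤ 5 (≤-trans (n≤1+n 1002) (s≤s m≥)))) ⟩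
    suc m ^ 5 * suc m ^ 5 ≡⟨ ^-distribˡ-+-* (suc m) 5 5 ⟨
    suc m ^ 10 ≤⟨ ^-monoˡ-≤ 10 (n<2^n m) ⟩
    (2 ^ m) ^ 10 ≡⟨ ^-*-assoc 2 m 10 ⟩
    2 ^ (m * 10) ≡⟨ cong (2 ^_) (*-comm m 10) ⟩
    2 ^ I ∎
    where
    open ≤-Reasoning
    m = k / 500
    m≥ : 1002 ≤ m
    m≥ = div-≥ 1002 k 500 (at-least 501000 refl)
    le : 2 + k ≤ 501 * suc m
    le = lin 0 (+-mono-≤ (div-upper k 500) (s≤s (z≤n {m}))) (eq k m)
      where
      eq : ∀ k m → 501 * suc m + (suc k + 1) ≡ 2 + k + (500 * suc m + suc m) + 0
      eq = solve-∀

-- Bad events and their rarity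

data Kind {n : ℕ} (G : Graph n) (k : ℕ) (v : Fin n) : Set where
  low    : deg G v < k → Kind G k v
  sparse : k * k ≤ 1000 * nonedges G v → Kind G k v
  star   : Star G k v → Kind G k v

module Events {n k : ℕ} (G : Graph n) (deg≤ : ∀ v → deg G v ≤ suc k) (kind : ∀ v → Kind G k v) (large : 7399999999 ≤ k) where

  open Numbers k large
  open Labelled G k K

  shares : Fin n → L → Fin n → Bool
  shares v = Counts.shares {K = K} G deg≤ v (λ _ → true)

  sat : ∀ v → Star G k v → L → Fin M → Bool
  sat v st = StarCounts.sat {K = K} G v st (λ _ → true) θ

  -- A labelling crowded within distance 2 of `v` is not charged to `v`, since the crowded vertex
  -- has its own event. Hence `valid` is available for the alterations around `v`.
  defect : ∀ v → Kind G k v → L → Bool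
  defect v (low _)    ω = false
  defect v (sparse _) ω = valid θ 0 v ω ∧ (# (shares v ω) ≤ᵇ 3)
  defect v (star st)  ω = valid θ 0 v ω ∧ (# (sat v st ω) ≤ᵇ 1)

  event : Fin n → L → Bool
  event v ω = (J + I ≤ᵇ rc ω v) ∨ defect v (kind v) ω

  -- Radius 3, because `valid` reads the labels on the neighbours of vertices at distance 2.
  Agree : Fin n → L → L → Set
  Agree v ω ω′ = ∀ y → ball G 3 v y ≡ true → lab ω y ≡ lab ω′ y

  agree-sym : ∀ v ω ω′ → Agree v ω ω′ → Agree v ω′ ω
  agree-sym v ω ω′ g y b = sym (g y b)

  module _ (v : Fin n) (ω ω′ : L) (g : Agree v ω ω′) where

    near-v : ∀ {y} → adj G v y ≡ true → ball G 3 v y ≡ true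
    near-v a = ball-suc G 2 (ball-suc G 1 (ball-adj G 0 (ball-refl G 0 v) a))

    rc-agree : ∀ y → ball G 2 v y ≡ true → rc ω y ≡ rc ω′ y
    rc-agree y b = #-cong λ w → bool-ext {adj G y w ∧ R ω w} {adj G y w ∧ R ω′ w}
      (λ e → let a , r = ∧-split {adj G y w} e in ∧-intro a (subst (λ l → real l ≡ true) (g w (ball-adj G 2 b a)) r))
      (λ e → let a , r = ∧-split {adj G y w} e in ∧-intro a (subst (λ l → real l ≡ true) (sym (g w (ball-adj G 2 b a))) r))

    valid-agree : ∀ r → valid θ r v ω ≡ true → valid θ r v ω′ ≡ true
    valid-agree r e = valid-intro θ r v ω′ λ u b → subst (_≤ θ + r) (rc-agree u b) (valid-elim θ r v ω e u b)

    shares-agree : ∀ u → shares v ω u ≡ true → shares v ω′ u ≡ true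
    shares-agree u e = let a , r , w , a′ , s , ne = Counts.shares-elim {K = K} G deg≤ v (λ _ → true) ω u e in
      Counts.shares-intro {K = K} G deg≤ v (λ _ → true) ω′ u w a (subst (λ l → real l ≡ true) (g u (near-v a)) r) a′ (trans (sym (g u (near-v a))) (trans s (g w (near-v a′)))) ne

    sat-agree : ∀ st i → sat v st ω i ≡ true → sat v st ω′ i ≡ true
    sat-agree st i e =
      let bz , mm = ∧-split {not (R ω (z i))} e ; m₁ , m₂ = ∧-split {matched ω (a i)} mm in
      ∧-intro (subst (λ l → not (real l) ≡ true) (g (z i) (ball-suc G 2 (ball-suc G 1 (ball-z i)))) bz)
        (∧-intro (keep (a i) (proj₁ (lightOf i (a i) (a-light i))) m₁) (keep (b i) (proj₁ (lightOf i (b i) (b-light i))) m₂))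
      where
      open Star st
      open Units units
      open StarCounts {K = K} G v st (λ _ → true) θ using (X; matched; ball-z; ball-X; lightOf)
      keep : ∀ l → adj G (z i) l ≡ true → matched ω l ≡ true → matched ω′ l ≡ true
      keep l zl e = let r , t = ∧-split {R ω l} e ; x , p = anyᵇ-elim t ; xx , s = ∧-split {X x} p
                        bl = g l (ball-suc G 2 (ball-adj G 1 (ball-z i) zl)) in
        ∧-intro (subst (λ w → real w ≡ true) bl r) (anyᵇ-intro x (∧-intro xx (subst₂ (λ s t → (s == t) ≡ true) (g x (ball-suc G 2 (ball-X i xx))) bl s)))

  defect-agree : ∀ v kd ω ω′ → Agree v ω ω′ → defect v kd ω ≡ true → defect v kd ω′ ≡ true
  defect-agree v (low _) ω ω′ g ()
  defect-agree v (sparse _) ω ω′ g e = let va , s = ∧-split {valid θ 0 v ω} e in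
    ∧-intro (valid-agree v ω ω′ g 0 va) (true-≤ᵇ (≤-trans (#-mono (shares-agree v ω′ ω (agree-sym v ω ω′ g))) (≤ᵇ-true s)))
  defect-agree v (star st) ω ω′ g e = let va , s = ∧-split {valid θ 0 v ω} e in
    ∧-intro (valid-agree v ω ω′ g 0 va) (true-≤ᵇ (≤-trans (#-mono (sat-agree v ω′ ω (agree-sym v ω ω′ g) st)) (≤ᵇ-true s)))

  event-agree : ∀ v ω ω′ → Agree v ω ω′ → event v ω ≡ true → event v ω′ ≡ true
  event-agree v ω ω′ g e = [ (λ t → ∨-introˡ (subst (λ m → (J + I ≤ᵇ m) ≡ true) (rc-agree v ω ω′ g v (ball-refl G 2 v)) t)) ,
    (λ d → ∨-introʳ {J + I ≤ᵇ rc ω′ v} (defect-agree v (kind v) ω ω′ g d)) ]′ (∨-split {J + I ≤ᵇ rc ω v} e)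

  event-local : ∀ v ω u c → ball G 3 v u ≡ false → event v (ω [ u ]≔ c) ≡ event v ω
  event-local v ω u c f = bool-ext (event-agree v (ω [ u ]≔ c) ω g) (event-agree v ω (ω [ u ]≔ c) (agree-sym v (ω [ u ]≔ c) ω g))
    where
    g : Agree v (ω [ u ]≔ c) ω
    g y b = lab-old ω u c (differ (ball G 3 v) b f)

  module _ (v : Fin n) (H : L → Bool) (inv : Inv v H) where

    private
      all : ℕ
      all = cnt (λ ω → Ω ω ∧ H ω)

      q>0 : 0 < k
      q>0 = at-least 1 refl

      module Cn = Counts {K = K} G deg≤ v H
      ms rs ps qs : ℕ → ℕ
      ms zero = 3
      ms (suc j) = ms j + 2
      rs zero = 0
      rs (suc j) = rs j + 2
      ps zero = 1
      ps (suc j) = ps j + 1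
      qs zero = 0
      qs (suc j) = qs j + 2 + 2

      ms≡ : ∀ j → ms j ≡ 2 * j + 3
      ms≡ zero = refl
      ms≡ (suc j) = trans (cong (_+ 2) (ms≡ j)) (eq j)
        where
        eq : ∀ j → 2 * j + 3 + 2 ≡ 2 * suc j + 3
        eq = solve-∀
      rs≡ : ∀ j → rs j ≡ 2 * j
      rs≡ zero = refl
      rs≡ (suc j) = trans (cong (_+ 2) (rs≡ j)) (eq j)
        where
        eq : ∀ j → 2 * j + 2 ≡ 2 * suc j
        eq = solve-∀
      ps≡ : ∀ j → ps j ≡ j + 1
      ps≡ zero = refl
      ps≡ (suc j) = cong (_+ 1) (trans (ps≡ j) (+-comm j 1))
      qs≡ : ∀ j → qs j ≡ 4 * j
      qs≡ zero = refl
      qs≡ (suc j) = trans (cong (λ m → m + 2 + 2) (qs≡ j)) (eq j)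
        where
        eq : ∀ j → 4 * j + 2 + 2 ≡ 4 * suc j
        eq = solve-∀

      j≤27 : ∀ {j} → j < 28 → j ≤ 27
      j≤27 = ≤-pred

    -- 28 alterations in a row, each gaining a factor `r₀`. The bound m on shared or satisfied items
    -- and the slack r grow along the way and remain within the limits of the estimates.
    defect-rare : ∀ kd → cnt (λ ω → (Ω ω ∧ H ω) ∧ defect v kd ω) * r₀ ^ 28 ≤ all
    defect-rare (low _) = ≤-trans (≤-reflexive (cong (_* r₀ ^ 28) (n≤0⇒n≡0 (≤-trans
      (cnt-mono {P = λ ω → (Ω ω ∧ H ω) ∧ false} {Q = λ _ → false} (λ ω e → ∧ʳ {Ω ω ∧ H ω} e)) (≤-reflexive (Sum-zero q n)))))) z≤n
    defect-rare (sparse s) = ≤-trans (chain r₀ (λ j → cnt (Cn.scarce θ (ms j) (rs j))) 28 step) (cnt-mono {P = Cn.scarce θ (ms 28) (rs 28)} {Q = λ ω → Ω ω ∧ H ω} λ ω e → ∧ˡ e)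
      where
      step : ∀ j → j < 28 → cnt (Cn.scarce θ (ms j) (rs j)) * r₀ ≤ cnt (Cn.scarce θ (ms (suc j)) (rs (suc j)))
      step j lt = ratio r₀ {cnt (Cn.scarce θ (ms j) (rs j))} {cnt (Cn.scarce θ (ms j + 2) (rs j + 2))} {nonedges G v * (18 * h)} {(ms j + 2) * (q * q)}
        (*-mono-≤ (m≤n+m 1 (ms j + 1) ∙ ≤-reflexive (+-assoc (ms j) 1 1)) (*-mono-≤ (≤-trans q>0 (m≤m+n k K)) (≤-trans q>0 (m≤m+n k K))))
        (sparse-ratio (ms j + 2) (nonedges G v) (≤-trans (≤-reflexive (cong (_+ 2) (ms≡ j))) (+-monoˡ-≤ 2 (+-monoˡ-≤ 3 (≤-trans (*-monoʳ-≤ 2 (j≤27 lt)) (≤ᵇ-true {54} {56} refl))))) s)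
        (Cn.scarce-step θ inv (ms j) (rs j) (18 * h) (sparse-room (rs j) (≤-trans (≤-reflexive (rs≡ j)) (≤-trans (*-monoʳ-≤ 2 (j≤27 lt)) (≤ᵇ-true {54} {120} refl)))))
        where
        _∙_ = ≤-trans
    defect-rare (star st) = ≤-trans (chain r₀ (λ j → cnt (SC.poor (ps j) (qs j))) 28 step) (cnt-mono {P = SC.poor (ps 28) (qs 28)} {Q = λ ω → Ω ω ∧ H ω} λ ω e → ∧ˡ e)
      where
      module SC = StarCounts {K = K} G v st H θ
      q₁ : 1 ≤ q
      q₁ = ≤-trans q>0 (m≤m+n k K)
      step : ∀ j → j < 28 → cnt (SC.poor (ps j) (qs j)) * r₀ ≤ cnt (SC.poor (ps (suc j)) (qs (suc j)))
      step j lt = ratio r₀ {cnt (SC.poor (ps j) (qs j))} {cnt (SC.poor (ps j + 1) (qs j + 2 + 2))} {M * (K * (90 * h * (40 * h)) * (90 * h * (40 * h)))} {(ps j + 1) * (q * (q * q) * (q * q))}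
        (*-mono-≤ (m≤n+m 1 (ps j)) (*-mono-≤ (*-mono-≤ q₁ (*-mono-≤ q₁ q₁)) (*-mono-≤ q₁ q₁)))
        (star-ratio (ps j + 1) (≤-trans (≤-reflexive (cong (_+ 1) (ps≡ j))) (≤-trans (+-monoˡ-≤ 1 (+-monoˡ-≤ 1 (j≤27 lt))) (≤ᵇ-true {29} {30} refl))))
        (SC.poor-step inv (ps j) (qs j) (90 * h) (40 * h) (star-choices (# (Star.C st)) (Star.C-size st))
          (star-room (qs j + 2) (≤-trans (≤-reflexive (cong (_+ 2) (qs≡ j))) (≤-trans (+-monoˡ-≤ 2 (*-monoʳ-≤ 4 (j≤27 lt))) (≤ᵇ-true {110} {120} refl)))))

    -- The 8 in the estimates is 2 * 4: the factor 2 covers the two causes, crowding and defect, and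
    -- 4 is what the local lemma asks for.
    event-rare : 4 * (2 + k) ^ 5 * cnt (λ ω → (Ω ω ∧ H ω) ∧ event v ω) ≤ all
    event-rare = *-cancelˡ-≤ 2 (begin
      2 * (4 * D * cnt (λ ω → (Ω ω ∧ H ω) ∧ event v ω)) ≡⟨ eq D (cnt (λ ω → (Ω ω ∧ H ω) ∧ event v ω)) ⟩
      cnt (λ ω → (Ω ω ∧ H ω) ∧ event v ω) * (8 * D) ≤⟨ *-monoˡ-≤ (8 * D) split ⟩
      (cnt (Cn.crowded inv (J + I)) + cnt (λ ω → (Ω ω ∧ H ω) ∧ defect v (kind v) ω)) * (8 * D) ≡⟨ *-distribʳ-+ (8 * D) (cnt (Cn.crowded inv (J + I))) _ ⟩
      cnt (Cn.crowded inv (J + I)) * (8 * D) + cnt (λ ω → (Ω ω ∧ H ω) ∧ defect v (kind v) ω) * (8 * D) ≤⟨ +-mono-≤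
          (≤-trans (*-monoʳ-≤ (cnt (Cn.crowded inv (J + I))) many-halvings) (Cn.crowded-bound inv J I crowded-ratio q>0))
          (≤-trans (*-monoʳ-≤ (cnt (λ ω → (Ω ω ∧ H ω) ∧ defect v (kind v) ω)) many-steps) (defect-rare (kind v))) ⟩
      all + all ≡⟨ cong (all +_) (+-identityʳ all) ⟨
      2 * all ∎)
      where
      open ≤-Reasoning
      D = (2 + k) ^ 5
      eq : ∀ D c → 2 * (4 * D * c) ≡ c * (8 * D)
      eq = solve-∀
      split : cnt (λ ω → (Ω ω ∧ H ω) ∧ event v ω) ≤ cnt (Cn.crowded inv (J + I)) + cnt (λ ω → (Ω ω ∧ H ω) ∧ defect v (kind v) ω)
      split = ≤-trans (Sum-mono {F = λ ω → b2n ((Ω ω ∧ H ω) ∧ event v ω)} λ ω → pt (Ω ω ∧ H ω) (J + I ≤ᵇ rc ω v) (defect v (kind v) ω))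
        (≤-reflexive (Sum-+ (λ ω → b2n (Cn.crowded inv (J + I) ω)) (λ ω → b2n ((Ω ω ∧ H ω) ∧ defect v (kind v) ω))))
        where
        pt : ∀ a b c → b2n (a ∧ (b ∨ c)) ≤ b2n (a ∧ b) + b2n (a ∧ c)
        pt false b c = z≤n
        pt true true c = s≤s z≤n
        pt true false c = ≤-refl

  private
    dd : ℕ
    dd = (2 + k) ^ 5

    some-blank : ∃ λ l → real l ≡ false
    some-blank = let l , e = #-∃ (not ∘ real) (subst (0 <_) (sym #blank) (≤-trans (at-least 1 refl) (m≤m+n k _))) in l , not-true e

    Ω-pos : 0 < cnt Ω
    Ω-pos = ≤-trans (≤-reflexive (sym (cong b2n (Ω-intro ω₀ λ u w a r → ⊥-elim (true≢false (subst (λ l → real l ≡ true) (lookup-replicate u (proj₁ some-blank)) r) (proj₂ some-blank)))))) (term≤Sum (λ ω → b2n (Ω ω)) ω₀)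
      where
      ω₀ : L
      ω₀ = replicate n (proj₁ some-blank)

    -- Radius 5 = 2 + 3: alterations reach distance 2 and events read labels up to distance 3.
    module LLL = Local Ω event (ball G 5) (4 * dd) dd Ω-pos (#ball G (suc k) deg≤ 5) (m^n>0 (2 + k) 5) ≤-refl

    local : ∀ v S → (∀ w → S w ≡ true → ball G 5 v w ≡ false) → 4 * dd * LLL.hit S v ≤ LLL.good S
    local v S far = event-rare v (LLL.avoid S) inv
      where
      same : ∀ ω u c → ball G 2 v u ≡ true → ∀ w → S w ≡ true → event w (ω [ u ]≔ c) ≡ event w ω
      same ω u c b w s = event-local w ω u c (≢true λ t → true≢false (ball-meet G 2 3 b t) (far w s))
      inv : Inv v (LLL.avoid S)
      inv ω u c b = bool-ext
        (λ e → LLL.avoid-intro S ω λ w s → trans (sym (same ω u c b w s)) (LLL.avoid-elim S (ω [ u ]≔ c) w e s))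
        (λ e → LLL.avoid-intro S (ω [ u ]≔ c) λ w s → trans (same ω u c b w s) (LLL.avoid-elim S ω w e s))

  opaque
    labelling : ∃ λ ω → Ω ω ≡ true × (∀ v → event v ω ≡ false)
    labelling = LLL.avoid-all local

-- The theorem

module Completion {n k : ℕ} (G : Graph n) (deg≤ : ∀ v → deg G v ≤ suc k) (kind : ∀ v → Kind G k v) (large : 7399999999 ≤ k) where

  open Numbers k large using (K; J; I; θ; at-least)
  open Labelled G k K
  open Events G deg≤ kind large

  module _ (ω : L) (proper : Ω ω ≡ true) (calm : ∀ v → event v ω ≡ false) where

    private
      S : Fin n → Bool
      S = R ω

      -- A value for blank labels; only the colours of vertices in `S` are ever compared.
      default : Fin k
      default = proj₁ (#-∃ {k} (λ _ → true) (≤-trans (at-least 1 refl) (≤-reflexive (sym (#-full k)))))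

      colourOf : Fin q → Fin k
      colourOf l with tf (real l)
      ... | inj₁ r = proj₁ (colour l r)
      ... | inj₂ _ = default

      colourOf-real : ∀ l → real l ≡ true → colourOf l ↑ˡ K ≡ l
      colourOf-real l r with tf (real l)
      ... | inj₁ r′ = proj₂ (colour l r′)
      ... | inj₂ f = ⊥-elim (true≢false r f)

      c : Fin n → Fin k
      c u = colourOf (lab ω u)

      c-proper : ProperOn G S c
      c-proper u v su sv a e = Ω-elim ω proper u v a su (trans (sym (colourOf-real _ su)) (trans (cong (_↑ˡ K) e) (colourOf-real _ sv)))

      flat : Fin n → ℕ
      flat _ = 0

      -- All blank neighbours count as pending here, so a good vertex can be coloured at any time,
      -- and giving good vertices the higher rank is harmless to them.
      good : Fin n → Bool
      good v = suc (# (seen G c S v) + # (pending G S flat v)) ≤ᵇ k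

      rank : Fin n → ℕ
      rank v = b2n (good v)

      good-by : ∀ v xs → Unique xs → Dropped G c S flat v xs → deg G v < k + length xs → good v ≡ true
      good-by v xs u d h = true-≤ᵇ (dropped-bound G c S flat v xs u d h)

      all-valid : ∀ v → valid θ 0 v ω ≡ true
      all-valid v = valid-intro θ 0 v ω λ u _ → ≤-trans (<⇒≤ (≤ᵇ-false (≢true λ t → true≢false (∨-introˡ t) (calm u)))) (≤-reflexive (sym (+-identityʳ θ)))

      -- Take a sharing vertex `u₁` with partner `p₁`, and a sharing `u₂` distinct from both; `u₁`
      -- and `u₂` are the repetitions. If the partner of `u₂` is `u₁` itself, all three have one
      -- colour and `p₁` is the twin of both.
      two-saved : ∀ v → 3 < # (shares v ω) → good v ≡ true
      two-saved v h = pick₁ (#-∃ (shares v ω) (≤-trans (s≤s z≤n) h))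
        where
        el = Counts.shares-elim {K = K} G deg≤ v (λ _ → true) ω
        pick₁ : (∃ λ u → shares v ω u ≡ true) → good v ≡ true
        pick₁ (u₁ , s₁) = from (el u₁ s₁)
          where
          from : adj G v u₁ ≡ true × R ω u₁ ≡ true × (∃ λ w → adj G v w ≡ true × lab ω u₁ ≡ lab ω w × u₁ ≢ w) → good v ≡ true
          from (a₁ , r₁ , p₁ , b₁ , e₁ , u₁≢p₁) = pick₂ (#-pick (shares v ω) (u₁ ∷ p₁ ∷ []) (≤-trans (n≤1+n 3) h))
            where
            pick₂ : (∃ λ u → shares v ω u ≡ true × All (u ≢_) (u₁ ∷ p₁ ∷ [])) → good v ≡ true
            pick₂ (u₂ , s₂ , n₂) = from₂ (el u₂ s₂)
              where
              real-of : ∀ {x y} → R ω x ≡ true → lab ω x ≡ lab ω y → R ω y ≡ true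
              real-of r e = subst (λ l → real l ≡ true) e r
              from₂ : adj G v u₂ ≡ true × R ω u₂ ≡ true × (∃ λ w → adj G v w ≡ true × lab ω u₂ ≡ lab ω w × u₂ ≢ w) → good v ≡ true
              from₂ (a₂ , r₂ , p₂ , b₂ , e₂ , u₂≢p₂) = good-by v (u₁ ∷ u₂ ∷ []) ((all₁ n₂ ∘ sym ∷ []) ∷ [] ∷ [])
                ((a₁ , inj₁ (r₁ , p₁ , real-of r₁ e₁ , b₁ , u₁≢p₁ ∘ sym ∷ all₂ n₂ ∘ sym ∷ [] , cong colourOf (sym e₁))) ∷
                 (a₂ , inj₁ (r₂ , rep (p₂ ≟ᶠ u₁))) ∷ []) (≤-trans (s≤s (deg≤ v)) (≤-reflexive (+-comm 2 k)))
                where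
                rep : Dec (p₂ ≡ u₁) → ∃ λ u → S u ≡ true × adj G v u ≡ true × All (u ≢_) (u₁ ∷ u₂ ∷ []) × c u ≡ c u₂
                rep (no ne) = p₂ , real-of r₂ e₂ , b₂ , ne ∷ u₂≢p₂ ∘ sym ∷ [] , cong colourOf (sym e₂)
                rep (yes refl) = p₁ , real-of r₁ e₁ , b₁ , u₁≢p₁ ∘ sym ∷ all₂ n₂ ∘ sym ∷ [] , cong colourOf (trans (sym e₁) (sym e₂))

      module OnStar (v : Fin n) (st : Star G k v) where
        open Star st
        open Units units
        open StarCounts {K = K} G v st (λ _ → true) θ using (X; X-C; X-z; matched; z-C; z-adj; lightOf)

        -- The partners of the lights lie in `C`, so they are neighbours of `z i` and differ from
        -- the lights, which lie outside `C`. Each light thus repeats a colour at `z i`.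
        sat-good : ∀ i → sat v st ω i ≡ true → good (z i) ≡ true
        sat-good i e = by (enough i)
          where
          ms = ∧-split {matched ω (a i)} (∧ʳ {not (R ω (z i))} e)
          LA = lightOf i (a i) (a-light i)
          LB = lightOf i (b i) (b-light i)
          partner : ∀ l → matched ω l ≡ true → R ω l ≡ true × ∃ λ x → X x ≡ true × lab ω x ≡ lab ω l
          partner l m = let r , t = ∧-split {R ω l} m ; x , p = anyᵇ-elim t ; xx , s = ∧-split {X x} p in r , x , xx , ==⇒≡ s
          drop : ∀ l xs → adj G (z i) l ≡ true → matched ω l ≡ true → (∀ {x} → C x ≡ true → All (x ≢_) xs) →
                 adj G (z i) l ≡ true × ((S l ≡ true × ∃ λ u → S u ≡ true × adj G (z i) u ≡ true × All (u ≢_) xs × c u ≡ c l) ⊎ (S l ≡ false × flat (z i) < flat l))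
          drop l xs zl m out = let r , x , xx , s = partner l m in
            zl , inj₁ (r , x , subst (λ t → real t ≡ true) (sym s) r , clique (z i) x (z-C i) (X-C xx) (X-z xx i) , out (X-C xx) , cong colourOf s)
          by : deg G (z i) ≤ k ⊎ a i ≢ b i → good (z i) ≡ true
          by (inj₁ le) = good-by (z i) (a i ∷ []) ([] ∷ [])
            (drop (a i) (a i ∷ []) (proj₁ LA) (proj₁ ms) (λ cx → differ C cx (proj₁ (proj₂ LA)) ∷ []) ∷ []) (≤-trans (s≤s le) (≤-reflexive (+-comm 1 k)))
          by (inj₂ ne) = good-by (z i) (a i ∷ b i ∷ []) ((ne ∷ []) ∷ [] ∷ [])
            (drop (a i) (a i ∷ b i ∷ []) (proj₁ LA) (proj₁ ms) out ∷ drop (b i) (a i ∷ b i ∷ []) (proj₁ LB) (proj₂ ms) out ∷ [])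
            (≤-trans (s≤s (deg≤ (z i))) (≤-reflexive (+-comm 2 k)))
            where
            out : ∀ {x} → C x ≡ true → All (x ≢_) (a i ∷ b i ∷ [])
            out cx = differ C cx (proj₁ (proj₂ LA)) ∷ differ C cx (proj₁ (proj₂ LB)) ∷ []

        -- As `v` is not good, its two good blank neighbours have higher rank and are still
        -- uncoloured when its turn comes.
        room-star : good v ≡ false → 1 < # (sat v st ω) → # (seen G c S v) + # (pending G S rank v) < k
        room-star bad h = pick₁ (#-∃ (sat v st ω) (≤-trans (s≤s z≤n) h))
          where
          blank : ∀ i → sat v st ω i ≡ true → S (z i) ≡ false
          blank i e = not-true (∧ˡ {not (R ω (z i))} e)
          higher : ∀ i → sat v st ω i ≡ true → rank v < rank (z i)
          higher i e = subst₂ (λ s t → b2n s < b2n t) (sym bad) (sym (sat-good i e)) ≤-refl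
          pick₁ : (∃ λ i → sat v st ω i ≡ true) → # (seen G c S v) + # (pending G S rank v) < k
          pick₁ (i , si) = pick₂ (#-pick (sat v st ω) (i ∷ []) h)
            where
            pick₂ : (∃ λ j → sat v st ω j ≡ true × All (j ≢_) (i ∷ [])) → # (seen G c S v) + # (pending G S rank v) < k
            pick₂ (j , sj , ne) = dropped-bound G c S rank v (z i ∷ z j ∷ []) ((zz i j (all₁ ne ∘ sym) ∷ []) ∷ [] ∷ [])
              ((z-adj i , inj₂ (blank i si , higher i si)) ∷ (z-adj j , inj₂ (blank j sj , higher j sj)) ∷ []) (≤-trans (s≤s (deg≤ v)) (≤-reflexive (+-comm 2 k)))

      quiet : ∀ v kd → kind v ≡ kd → defect v kd ω ≡ false
      quiet v kd refl = ≢true λ t → true≢false (∨-introʳ {J + I ≤ᵇ rc ω v} t) (calm v)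

      room : ∀ v → S v ≡ false → # (seen G c S v) + # (pending G S rank v) < k
      room v _ with tf (good v)
      ... | inj₁ t = ≤-trans (s≤s (+-monoʳ-≤ (# (seen G c S v)) (#-mono {P = pending G S rank v} {Q = pending G S flat v} λ u e →
              let s , e₁ = ∧-split {not (S u)} e ; a , _ = ∧-split {adj G v u} e₁ in ∧-intro s (∧-intro a refl)))) (≤ᵇ-true t)
      ... | inj₂ f = by (kind v) (quiet v (kind v) refl)
        where
        by : ∀ kd → defect v kd ω ≡ false → # (seen G c S v) + # (pending G S rank v) < k
        by (low lt) _ = ⊥-elim (true≢false (good-by v [] [] [] (≤-trans lt (≤-reflexive (sym (+-identityʳ k))))) f)
        by (sparse s) d = ⊥-elim (true≢false (two-saved v (≤ᵇ-false (≢true λ t → true≢false (∧-intro (all-valid v) t) d))) f)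
        by (star st) d = OnStar.room-star v st f (≤ᵇ-false (≢true λ t → true≢false (∧-intro (all-valid v) t) d))

    complete : Colourable G k
    complete = greedy G c S rank c-proper room

  colourable : Colourable G k
  colourable = let ω , o , calm = labelling in complete ω o calm

-- Descent from a minimal counterexample

properᵇ : ∀ {n k} → Graph n → Vec (Fin k) n → Bool
properᵇ G ω = not (anyᵇ λ u → anyᵇ λ w → adj G u w ∧ (lookup ω u == lookup ω w))

-- The structure of critical graphs is derived from the absence of a colouring, so colourability has
-- to be decided first; a search over all labellings does this.
colourable? : ∀ {n} (G : Graph n) k → Dec (Colourable G k)
colourable? {n} G k = decide (0 <? cnt {k} (properᵇ G))
  where
  decide : Dec (0 < cnt {k} (properᵇ G)) → Dec (Colourable G k)
  decide (yes h) = let ω , p = cnt-∃ (properᵇ G) h in yes (lookup ω , λ u w a e →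
    true≢false (anyᵇ-intro u (anyᵇ-intro w (∧-intro a (subst (λ l → (lookup ω u == l) ≡ true) e (==-refl (lookup ω u)))))) (not-true p))
  decide (no h) = no λ (c , p) → h (≤-trans (≤-reflexive (sym (cong b2n (fine c p)))) (term≤Sum (λ ω → b2n (properᵇ G ω)) (tabulate c)))
    where
    fine : ∀ c → ProperColouring G k c → properᵇ G (tabulate c) ≡ true
    fine c p = not-intro (≢true λ e → bad (anyᵇ-elim e))
      where
      bad : (∃ λ u → anyᵇ (λ w → adj G u w ∧ (lookup (tabulate c) u == lookup (tabulate c) w)) ≡ true) → ⊥
      bad (u , e) = let w , e′ = anyᵇ-elim e ; a , s = ∧-split {adj G u w} e′ in
        p u w a (trans (sym (lookup∘tabulate c u)) (trans (==⇒≡ s) (lookup∘tabulate c w)))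

sum-< : ∀ {n} {f g : Fin n → ℕ} → (∀ i → f i ≤ g i) → (∃ λ i → f i < g i) → sum f < sum g
sum-< {suc n} h (zero , lt)  = +-mono-<-≤ lt (sum-mono (h ∘ suc))
sum-< {suc n} h (suc i , lt) = +-mono-≤-< (h zero) (sum-< (h ∘ suc) (i , lt))

-- `k` is fixed instead of tied to the maximum degree, so the degree bound passes to reduced graphs,
-- whose maximum degree may drop. The descent is on the degree sum, twice the number of edges.
borodin-kostochka : ∀ {n k} → 7399999999 ≤ k → ∀ (G : Graph n) → (∀ v → deg G v ≤ suc k) → (∀ T → Clique G T → # T ≤ k) → Colourable G k
borodin-kostochka {n} {k} large G = go (suc (sum (deg G))) G ≤-refl
  where
  go : ∀ m (G : Graph n) → sum (deg G) < m → (∀ v → deg G v ≤ suc k) → (∀ T → Clique G T → # T ≤ k) → Colourable G k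
  go (suc m) G (s≤s lt) deg≤ noK = decide (colourable? G k)
    where
    IH : ∀ (G′ : Graph n) → (∀ u → deg G′ u ≤ deg G u) → (∃ λ u → deg G′ u < deg G u) → (∀ T → Clique G′ T → # T ≤ k) → Colourable G′ k
    IH G′ le st = go m G′ (≤-trans (sum-< le st) lt) (λ v → ≤-trans (le v) (deg≤ v))
    decide : Dec (Colourable G k) → Colourable G k
    decide (yes c) = c
    decide (no nc) = Completion.colourable G deg≤ kind large
      where
      kind : ∀ v → Kind G k v
      kind v = by (k ≤? deg G v) (suc (1000 * nonedges G v) ≤? k * k)
        where
        by : Dec (k ≤ deg G v) → Dec (1000 * nonedges G v < k * k) → Kind G k v
        by (no l) _ = low (≰⇒> l)
        by (yes _) (no s) = sparse (≮⇒≥ s)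
        by (yes d) (yes s) = star (Dense.star G deg≤ noK IH nc (≤-trans (≤ᵇ-true {1000} {7399999999} refl) large) v d s)

size-tabulate : ∀ {n} (P : Fin n → Bool) → ∣ tabulate P ∣ ≡ # P
size-tabulate {zero} P = refl
size-tabulate {suc n} P with P zero
... | true  = cong suc (size-tabulate (P ∘ suc))
... | false = size-tabulate (P ∘ suc)

∈⇒≤max : ∀ {m} xs → m ∈ xs → m ≤ foldr _⊔_ 0 xs
∈⇒≤max (x ∷ xs) (here refl) = m≤m⊔n x _
∈⇒≤max (x ∷ xs) (there p)   = ≤-trans (∈⇒≤max xs p) (m≤n⊔m x _)

theorem3 : ∀ {n} (G : Graph n) (w : ℕ) → IsCliqueNumber G w →
    7400000000 ≤ maxDegree G → Colourable G ((maxDegree G ∸ 1) ⊔ w)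
theorem3 {n} G w (_ , largest) large = borodin-kostochka (≤-trans (∸-monoˡ-≤ 1 large) (m≤m⊔n _ w)) G deg-bound clique-bound
  where
  k = (maxDegree G ∸ 1) ⊔ w
  deg-bound : ∀ v → deg G v ≤ suc k
  deg-bound v = begin
    deg G v             ≡⟨ size-tabulate (adj G v) ⟨
    degree G v          ≤⟨ ∈⇒≤max (map (degree G) (allFin n)) (∈-map⁺ (degree G) (∈-allFin v)) ⟩
    maxDegree G         ≤⟨ m≤n+m∸n (maxDegree G) 1 ⟩
    suc (maxDegree G ∸ 1) ≤⟨ s≤s (m≤m⊔n _ w) ⟩
    suc k               ∎
    where open ≤-Reasoning
  clique-bound : ∀ T → Clique G T → # T ≤ k
  clique-bound T cl = begin
    # T            ≡⟨ size-tabulate T ⟨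
    ∣ tabulate T ∣ ≤⟨ largest (tabulate T) (λ u v tu tv → cl u v (inT tu) (inT tv)) ⟩
    w              ≤⟨ m≤n⊔m (maxDegree G ∸ 1) w ⟩
    k              ∎
    where
    open ≤-Reasoning
    inT : ∀ {u} → u ∈ˢ tabulate T → T u ≡ true
    inT {u} p = trans (sym (lookup∘tabulate T u)) ([]=⇒lookup p)
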